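{- Let $H$ be a 3-uniform marked hypergraph that is not a trivial Maker win, with $|V(H)\setminus M(H)|\ge2$, and suppose that for every $x\in V(H)\setminus M(H)$ there exists an $x$-snake in $H$. Then $H$ is a Breaker win if and only if $J_1(\mathcal D_1,H)$ holds.
   Context: A marked hypergraph $H$: finite nonempty $V(H)$, edge set $E(H)$ of nonempty subsets of $V(H)$, marked set $M(H)\subseteq V(H)$; 3-uniform: all edges of size 3. Subhypergraph $X$: $V(X)\subseteq V(H)$, $E(X)\subseteq E(H)$, $M(X)=V(X)\cap M(H)$. $H^{+x}$ marks non-marked $x$; $H^{ -y}$ deletes $y$ and all edges containing it. Trivial Maker win: some edge $e$ with $|e\setminus M(H)|\le1$. Maker win (recursive): if $|V(H)\setminus M(H)|\le1$, iff trivial Maker win; otherwise iff some non-marked $x$ has $H^{+x-y}$ a Maker win for all non-marked $y\ne x$. Otherwise Breaker win. $ab$-path of length 0: the vertex $a=b$; of length $L\ge1$: edges $e_1,\dots,e_L$ (3-sets), vertex set $\bigcup e_i$, $|e_i\cap e_{i+1}|=1$, $e_i\cap e_j=\varnothing$ for $|i-j|\ge2$, $a\ne b$, $a\in e_1\setminus\bigcup_{i\ge2}e_i$, $b\in e_L\setminus\bigcup_{i<L}e_i$. $a$-cycle of length $L\ge2$: edges $e_1,\dots,e_L$, vertex set $\bigcup e_i$, $a\in e_1\cap e_L$, $a\notin e_i$ for $1<i<L$; if $L=2$, $|e_1\cap e_2|=2$; if $L\ge3$, $|e_i\cap e_{i+1}|=1$, $e_1\cap e_L=\{a\}$, other pairs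 with $|i-j|\ge2$ disjoint. $a$-tadpole: union of an $ab$-path $P$ (possibly length 0) and a $b$-cycle $C$ with $V(P)\cap V(C)=\{b\}$. $x$-snake: $xm$-path of positive length with $m$ marked. Pointed marked hypergraph $(D,x)$: $x\in V(D)\setminus M(D)$; isomorphism preserves edges, marks and point. $x\mathcal F(H)$: subhypergraphs $X\ni x$ of $H$ with $(X,x)$ isomorphic to a member of $\mathcal F$. $\mathrm{Int}_H(\mathcal X)$: non-marked vertices of $H$ lying in every member of $\mathcal X$. $J_1(\mathcal F,H)$: for every $x\in V(H)\setminus M(H)$, $\mathrm{Int}_{H^{+x}}(x\mathcal F(H))\ne\varnothing$. $\mathcal S$: all $(S,x)$, $S$ an $x$-snake with exactly one marked vertex; $\mathcal T$: all $(T,x)$, $T$ an $x$-tadpole with no marked vertex; $\mathcal D_1=\mathcal S\cup\mathcal T$. -}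

module Defs where

open import Data.Nat using (ℕ; zero; suc; _<_; _≤_)
open import Data.Fin using (Fin; zero; suc; toℕ; fromℕ; _≟_)
open import Data.Fin.Subset
  using (Subset; _∈_; _∉_; _⊆_; _∩_; _∪_; _─_; ⁅_⁆; ∣_∣; Nonempty)
  renaming (⊥ to ∅)
open import Data.Fin.Subset.Properties using (_∈?_)
open import Data.Fin.Properties using (any?)
open import Data.Bool using (Bool; true; false; _∧_; not)
open import Data.Vec using (lookup; tabulate)
open import Data.Product using (Σ; ∃; _×_; _,_)
open import Data.Sum using (_⊎_)
open import Data.Empty using () renaming (⊥ to ⊥₀)
open import Relation.Nullary using (¬_)
open import Relation.Nullary.Decidable using (⌊_⌋; _×-dec_)
open import Relation.Binary.PropositionalEquality using (_≡_; _≢_)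
open import Function.Bundles using (_⇔_)

-- Marked hypergraphs whose vertices are drawn from Fin n.
-- V(H) ⊆ Fin n, E(H) is a (finite) set of subsets given by its
-- characteristic function, M(H) ⊆ Fin n.

record MHG (n : ℕ) : Set where
  constructor mhg
  field
    V : Subset n
    E : Subset n → Bool
    M : Subset n
open MHG public

record WF {n : ℕ} (H : MHG n) : Set where
  field
    V-nonempty    : Nonempty (V H)
    edge⊆V        : ∀ e → E H e ≡ true → e ⊆ V H
    edge-nonempty : ∀ e → E H e ≡ true → Nonempty e
    M⊆V           : M H ⊆ V H

ThreeUniform : ∀ {n} → MHG n → Set
ThreeUniform H = ∀ e → E H e ≡ true → ∣ e ∣ ≡ 3

nonMarkedCount : ∀ {n} → MHG n → ℕ
nonMarkedCount H = ∣ V H ─ M H ∣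

TrivialMakerWin : ∀ {n} → MHG n → Set
TrivialMakerWin H = ∃ λ e → E H e ≡ true × ∣ e ─ M H ∣ ≤ 1

markV : ∀ {n} → MHG n → Fin n → MHG n
markV H x = mhg (V H) (E H) (M H ∪ ⁅ x ⁆)

delV : ∀ {n} → MHG n → Fin n → MHG n
delV H y = mhg (V H ─ ⁅ y ⁆) (λ e → E H e ∧ not (lookup e y)) (M H ─ ⁅ y ⁆)

data MakerWin {n : ℕ} : MHG n → Set where
  base : ∀ {H} → nonMarkedCount H ≤ 1 → TrivialMakerWin H → MakerWin H
  step : ∀ {H} → 2 ≤ nonMarkedCount H →
         (x : Fin n) → x ∈ V H → x ∉ M H →
         (∀ y → y ∈ V H → y ∉ M H → y ≢ x → MakerWin (delV (markV H x) y)) →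
         MakerWin H

BreakerWin : ∀ {n} → MHG n → Set
BreakerWin H = ¬ MakerWin H

record Sub {n : ℕ} (X H : MHG n) : Set where
  field
    wf   : WF X
    V⊆   : V X ⊆ V H
    E⊆   : ∀ e → E X e ≡ true → E H e ≡ true
    Meq  : M X ≡ V X ∩ M H

record Path {m : ℕ} (a b : Fin m) : Set where
  field
    k     : ℕ
    es    : Fin (suc k) → Subset m
    size3 : ∀ i → ∣ es i ∣ ≡ 3
    adj   : ∀ i j → toℕ j ≡ suc (toℕ i) → ∣ es i ∩ es j ∣ ≡ 1
    far   : ∀ i j → suc (toℕ i) < toℕ j → es i ∩ es j ≡ ∅
    a≢b   : a ≢ b
    a∈    : a ∈ es zero
    a∉    : ∀ i → 1 ≤ toℕ i → a ∉ es i
    b∈    : b ∈ es (fromℕ k)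
    b∉    : ∀ i → toℕ i < k → b ∉ es i

PathVs : ∀ {m} {a b : Fin m} → Path a b → Fin m → Set
PathVs P v = ∃ λ i → v ∈ Path.es P i

PathEs : ∀ {m} {a b : Fin m} → Path a b → Subset m → Set
PathEs P e = ∃ λ i → Path.es P i ≡ e

data Path₀ {m : ℕ} (a b : Fin m) : Set where
  len0 : a ≡ b → Path₀ a b
  pos  : Path a b → Path₀ a b

Path₀Vs : ∀ {m} {a b : Fin m} → Path₀ a b → Fin m → Set
Path₀Vs {a = a} (len0 _) v = v ≡ a
Path₀Vs (pos P) v = PathVs P v

Path₀Es : ∀ {m} {a b : Fin m} → Path₀ a b → Subset m → Set
Path₀Es (len0 _) e = ⊥₀
Path₀Es (pos P) e = PathEs P e

record Cycle {m : ℕ} (a : Fin m) : Set where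
  field
    k        : ℕ
    es       : Fin (suc (suc k)) → Subset m
    size3    : ∀ i → ∣ es i ∣ ≡ 3
    a∈first  : a ∈ es zero
    a∈last   : a ∈ es (fromℕ (suc k))
    a∉       : ∀ i → 1 ≤ toℕ i → toℕ i < suc k → a ∉ es i
    shape    :
      (k ≡ 0 × ∣ es zero ∩ es (fromℕ (suc k)) ∣ ≡ 2)
      ⊎
      (1 ≤ k
       × (∀ i j → toℕ j ≡ suc (toℕ i) → ∣ es i ∩ es j ∣ ≡ 1)
       × es zero ∩ es (fromℕ (suc k)) ≡ ⁅ a ⁆
       × (∀ i j → suc (toℕ i) < toℕ j → ¬ (toℕ i ≡ 0 × toℕ j ≡ suc k) →
            es i ∩ es j ≡ ∅))

CycleVs : ∀ {m} {a : Fin m} → Cycle a → Fin m → Set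
CycleVs C v = ∃ λ i → v ∈ Cycle.es C i

CycleEs : ∀ {m} {a : Fin m} → Cycle a → Subset m → Set
CycleEs C e = ∃ λ i → Cycle.es C i ≡ e

Realizes : ∀ {m} → MHG m → (Fin m → Set) → (Subset m → Set) → Set
Realizes D Vs Es = (∀ v → (v ∈ V D) ⇔ Vs v) × (∀ e → (E D e ≡ true) ⇔ Es e)

IsSnake : ∀ {m} → MHG m → Fin m → Set
IsSnake D x = ∃ λ y → y ∈ M D × Σ (Path x y) λ P → Realizes D (PathVs P) (PathEs P)

IsTadpole : ∀ {m} → MHG m → Fin m → Set
IsTadpole D a =
  ∃ λ b → Σ (Path₀ a b) λ P → Σ (Cycle b) λ C →
    (∀ v → Path₀Vs P v → CycleVs C v → v ≡ b) ×
    Realizes D (λ v → Path₀Vs P v ⊎ CycleVs C v) (λ e → Path₀Es P e ⊎ CycleEs C e)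

Fam : Set₁
Fam = ∀ {m} → MHG m → Fin m → Set

image : ∀ {n m} → (Fin n → Fin m) → Subset n → Subset m
image f e = tabulate (λ w → ⌊ any? (λ v → (v ∈? e) ×-dec (f v ≟ w)) ⌋)

record Iso {n m : ℕ} (X : MHG n) (x : Fin n) (D : MHG m) (y : Fin m) : Set where
  field
    f     : Fin n → Fin m
    g     : Fin m → Fin n
    f∈    : ∀ v → v ∈ V X → f v ∈ V D
    g∈    : ∀ w → w ∈ V D → g w ∈ V X
    gf    : ∀ v → v ∈ V X → g (f v) ≡ v
    fg    : ∀ w → w ∈ V D → f (g w) ≡ w
    marks : ∀ v → v ∈ V X → (v ∈ M X) ⇔ (f v ∈ M D)
    edges : ∀ e → e ⊆ V X → (E X e ≡ true) ⇔ (E D (image f e) ≡ true)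
    point : f x ≡ y

𝒮 : Fam
𝒮 D x = WF D × x ∈ V D × x ∉ M D × IsSnake D x × ∣ V D ∩ M D ∣ ≡ 1

𝒯 : Fam
𝒯 D x = WF D × x ∈ V D × x ∉ M D × IsTadpole D x × ∣ V D ∩ M D ∣ ≡ 0

𝒟₁ : Fam
𝒟₁ D x = 𝒮 D x ⊎ 𝒯 D x

_∈x_[_] : ∀ {n} → MHG n → Fin n → Fam × MHG n → Set
X ∈x x [ (𝓕 , H) ] =
  Sub X H × x ∈ V X ×
  ∃ λ m → Σ (MHG m) λ D → Σ (Fin m) λ y → 𝓕 D y × Iso X x D y

IntNonempty : ∀ {n} → Fam → MHG n → Fin n → Set
IntNonempty 𝓕 H x =
  ∃ λ v → v ∈ V (markV H x) × v ∉ M (markV H x) ×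
    (∀ X → X ∈x x [ (𝓕 , H) ] → v ∈ V X)

J₁ : ∀ {n} → Fam → MHG n → Set
J₁ 𝓕 H = ∀ x → x ∈ V H → x ∉ M H → IntNonempty 𝓕 H x

-- If J₁ fails, Maker marks a vertex x at which it fails. Whatever Breaker deletes misses a snake or a tadpole at x, and along it
-- every move of Maker forces the next reply of Breaker until some edge has a single vertex left.
--
-- Conversely, drop the marked vertices: an edge with one mark becomes a pair of the base B, and snakes become paths from B.
-- The invariant is that (J) every z has a vertex y ≠ z common to all base paths to z and all tadpoles at z, and that (fullness)
-- every vertex of an edge is reached from B. When Maker marks x, the edges at x join the base, and Breaker deletes a vertex s common to
-- the snakes and tadpoles at x: the last but one vertex of a base path to x if possible, and otherwise one that is farthest from B.
-- Condition J survives because two bases that are not joined by a path have a gate: a pair of vertices that lies on all paths from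
-- either of them to z. Fullness may be lost, but then the position can be enlarged in favour of Maker until it holds again.
{-# OPTIONS --safe #-}
module Submission where

open import Data.Empty using (⊥; ⊥-elim)
open import Data.List using (List; []; _∷_; _++_; length; filter; map; allFin)
open import Data.List.Membership.Propositional.Properties using (∈-++⁺ˡ; ∈-++⁺ʳ; ∈-++⁻; ∈-filter⁺; ∈-map⁻; ∈-allFin)
open import Data.List.Properties using (filter-notAll)
open import Data.List.Relation.Unary.Any as Any using (here; there)
open import Data.Maybe using (Maybe; just; nothing)
open import Data.Nat using (ℕ; zero; suc; _≤_; _<_; s≤s; z≤n)
open import Data.Nat.Properties using (≤-trans; ≤-refl; ≤-pred; n≮0; ≤-reflexive; <⇒≱; ≰⇒>; suc-injective; _<?_; _≤?_)
open import Data.Product using (Σ; ∃; _×_; _,_; proj₁; proj₂)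
open import Data.Sum using (_⊎_; inj₁; inj₂; [_,_]′; swap; map₂)
open import Data.Unit using (⊤; tt)
open import Function using (_∘_; id)
open import Function.Bundles using (_⇔_; mk⇔; Equivalence)
open import Relation.Nullary using (¬_; Dec; yes; no)
open import Relation.Nullary.Decidable using (⌊_⌋; _×-dec_; _⊎-dec_; ¬?; map′)
open import Relation.Binary.Definitions using (DecidableEquality)
open import Relation.Binary.PropositionalEquality using (_≡_; _≢_; refl; sym; trans; cong; subst; ≢-sym)

-- After Maker marks `x`, every path from `x` counts as a new snake, so the vertex `y` that served
-- `z` before may be missed by such a path. If `z` is still reached from `B` without `s`, or has no
-- tadpole, gates yield a replacement for `y`. The critical `z` is cut off from `B` by `s` and
-- carries a tadpole; there the choice of `s` matters. If `s` stands next to `x`, a base path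
-- through `s` and `x` continues to `z` and misses `y`, a contradiction. If `s` is farthest, a
-- vertex cut off by `s` that lies on all base paths to `x` lies on all base paths to `s` too. This
-- puts it beside `s` in one edge, and the edges at it act as a second base for `z`. Joining paths
-- is delicate because consecutive edges share exactly one vertex: two edges sharing a pair cannot
-- follow each other. This exception, two arms running into one pair, is the shape from which gates
-- arise. Fullness matters because the choice of `s` presupposes a base path to `x`. Existence of
-- paths is not decided here. A Breaker win is a negation, so its proof can stay under double
-- negation; the converse needs a decided game, since `J₁` asks for actual vertices.

infix 3 ¬¬_
¬¬_ : ∀ {a} → Set a → Set a
¬¬ A = ¬ ¬ A

em : ∀ {a} {A : Set a} → ¬¬ Dec A
em k = k (no λ a → k (yes a))

pure : ∀ {a} {A : Set a} → A → ¬¬ A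
pure a k = k a

infixl 1 _>>=_
_>>=_ : ∀ {a b} {A : Set a} {B : Set b} → ¬¬ A → (A → ¬¬ B) → ¬¬ B
(m >>= f) k = m λ a → f a k

data Side : Set where
  left right : Side

-- T holds of the orderings of the edges without marked vertex.
record HG (V : Set) : Set₁ where
  field
    T   : V → V → V → Set
    sw₁ : ∀ {a b c} → T a b c → T b a c
    sw₂ : ∀ {a b c} → T a b c → T a c b
    irr : ∀ {a b c} → T a b c → a ≢ b

-- R holds of the pairs left of the edges with one marked vertex.
record Base (V : Set) : Set₁ where
  field
    R    : V → V → Set
    symR : ∀ {a b} → R a b → R b a
    irrR : ∀ {a b} → R a b → a ≢ b

-- Paths, tadpoles and the shapes formed when they meet.

module Paths {V : Set} (_≟_ : DecidableEquality V) (H : HG V) where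
  open import Data.List.Membership.Propositional using (_∈_; _∉_)
  open HG H
  open Base

  Pred : Set₁
  Pred = V → Set

  infixr 6 _∪_
  _∪_ : Pred → Pred → Pred
  (X ∪ Y) u = X u ⊎ Y u

  _∈?_ : (u : V) (xs : List V) → Dec (u ∈ xs)
  u ∈? xs = Any.any? (u ≟_) xs

  Inside : List V → Pred → Set
  Inside xs X = ∀ {u} → u ∈ xs → X u

  Apart : List V → List V → Set
  Apart xs ys = ∀ {u} → u ∈ xs → u ∈ ys → ⊥

  irr₂ : ∀ {a b c} → T a b c → b ≢ c
  irr₂ t = irr (sw₂ (sw₁ t))
  irr₃ : ∀ {a b c} → T a b c → a ≢ c
  irr₃ t = irr (sw₂ t)

  Tb : V → Base V
  Tb c = record { R = T c ; symR = sw₂ ; irrR = irr₂ }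

  -- A path starts at a vertex, or with one of the pairs of a base.
  data Start : Set₁ where
    pt : V → Start
    pr : Base V → Start

  isPt : Start → V → Set
  isPt (pt z) u = u ≡ z
  isPt (pr _) _ = ⊥

  Nx : Start → Maybe V → V → V → Set
  Nx S (just t) w v = T t w v
  Nx (pt _) nothing _ _ = ⊥
  Nx (pr A) nothing w v = R A w v

  -- The vertices are listed from the end v backwards; an edge of the path adds its exit v and its other new vertex w.
  -- A path from a base is a snake without its marked vertex.
  mutual
    data Reach (S : Start) : List V → V → Set where
      stop : ∀ {z} → isPt S z → Reach S (z ∷ []) z
      go   : ∀ {xs e w v} → Arm S xs e → Nx S e w v → w ∉ xs → v ∉ xs → Reach S (v ∷ w ∷ xs) v

    data Arm (S : Start) : List V → Maybe V → Set where
      none : Arm S [] nothing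
      via  : ∀ {xs t} → Reach S xs t → Arm S xs (just t)

  nx-sym : ∀ S e {w v} → Nx S e w v → Nx S e v w
  nx-sym S (just t) p = sw₂ p
  nx-sym (pr A) nothing p = symR A p

  nx-irr : ∀ S e {w v} → Nx S e w v → w ≢ v
  nx-irr S (just t) p = irr₂ p
  nx-irr (pr A) nothing p = irrR A p

  end∈ : ∀ {S xs v} → Reach S xs v → v ∈ xs
  end∈ (stop _) = here refl
  end∈ (go _ _ _ _) = here refl

  start∈ : ∀ {z xs v} → Reach (pt z) xs v → z ∈ xs
  start∈ (stop refl) = here refl
  start∈ (go {e = just _} (via r) _ _ _) = there (there (start∈ r))

  Within : Start → Pred → V → Set
  Within S X v = ∃ λ xs → Reach S xs v × Inside xs X

  within-mono : ∀ {S X Y v} → (∀ {u} → X u → Y u) → Within S X v → Within S Y v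
  within-mono f (xs , r , i) = xs , r , λ m → f (i m)

  toWithin : ∀ {S xs v} → Reach S xs v → Within S (_∈ xs) v
  toWithin r = _ , r , id

  at : ∀ z → Within (pt z) (_≡ z) z
  at z = z ∷ [] , stop refl , λ { (here e) → e }

  -- The path is cut at the edge that introduces `h`. If `h` is the sibling there, sibling and exit
  -- swap roles.
  reach-any : ∀ {S xs v h} → Reach S xs v → h ∈ xs → Within S (_∈ xs) h
  reach-any (stop p) (here refl) = _ , stop p , id
  reach-any r@(go _ _ _ _) (here refl) = _ , r , id
  reach-any {S} (go {e = e} a n w∉ v∉) (there (here refl)) =
    _ , go a (nx-sym S e n) v∉ w∉ , λ { (here p) → there (here p) ; (there (here p)) → here p ; (there (there m)) → there (there m) }
  reach-any (go (via r) n w∉ v∉) (there (there m)) = within-mono (λ q → there (there q)) (reach-any r m)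

  snoc : ∀ {S X t w v} → Within S X t → T t w v → ¬ X w → ¬ X v → Within S (λ u → X u ⊎ u ≡ w ⊎ u ≡ v) v
  snoc (xs , r , i) t w∉ v∉ = _ , go (via r) t (w∉ ∘ i) (v∉ ∘ i) ,
    λ { (here p) → inj₂ (inj₂ p) ; (there (here p)) → inj₂ (inj₁ p) ; (there (there m)) → inj₁ (i m) }

  joinR : ∀ {S xs t ys v} → Reach S xs t → Reach (pt t) ys v → (∀ {u} → u ∈ xs → u ∈ ys → u ≡ t) →
          Within S ((_∈ xs) ∪ (_∈ ys)) v
  joinR r (stop refl) d = _ , r , inj₁
  joinR {xs = xs} {t} r (go {e = just _} {w = w} {v = v} (via q) n w∉ v∉) d
    with joinR r q (λ a b → d a (there (there b)))
  ... | zs , r' , i = v ∷ w ∷ zs ,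
        go (via r') n (λ m → f w∉ (there (here refl)) (i m)) (λ m → f v∉ (here refl) (i m)) ,
        λ { (here p) → inj₂ (here p) ; (there (here p)) → inj₂ (there (here p))
          ; (there (there m)) → [ inj₁ , (λ q → inj₂ (there (there q))) ]′ (i m) }
    where
      f : ∀ {u} → u ∉ _ → u ∈ (v ∷ w ∷ _) → (u ∈ xs) ⊎ (u ∈ _) → ⊥
      f u∉ _ (inj₂ b) = u∉ b
      f u∉ k (inj₁ a) with d a k
      ... | refl = u∉ (start∈ q)

  join : ∀ {S X t Y v} → Within S X t → Within (pt t) Y v → (∀ {u} → X u → Y u → u ≡ t) → Within S (X ∪ Y) v
  join (xs , r , i) (ys , q , j) d =
    within-mono [ inj₁ ∘ i , inj₂ ∘ j ]′ (joinR r q (λ a b → d (i a) (j b)))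

  edge : ∀ {t w v} → T t w v → Within (pt t) (λ u → u ≡ t ⊎ u ≡ w ⊎ u ≡ v) v
  edge t = snoc (at _) t (λ e → irr t (sym e)) (λ e → irr₃ t (sym e))

  reverse : ∀ {z xs v} → Reach (pt z) xs v → Within (pt v) (_∈ xs) z
  reverse (stop refl) = _ , stop refl , id
  reverse (go {xs} {e = just t} {w} {v} (via q) n w∉ v∉) =
    within-mono (λ { (inj₁ (inj₁ refl)) → here refl ; (inj₁ (inj₂ (inj₁ refl))) → there (here refl)
                   ; (inj₁ (inj₂ (inj₂ refl))) → there (there (end∈ q)) ; (inj₂ m) → there (there m) })
      (join (edge {v} {w} {t} (sw₁ (sw₂ (sw₁ n)))) (reverse q) d)
    where
      d : ∀ {u} → u ≡ v ⊎ u ≡ w ⊎ u ≡ t → u ∈ xs → u ≡ t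
      d (inj₁ refl) m = ⊥-elim (v∉ m)
      d (inj₂ (inj₁ refl)) m = ⊥-elim (w∉ m)
      d (inj₂ (inj₂ e)) m = e

  rev : ∀ {z X v} → Within (pt z) X v → Within (pt v) X z
  rev (xs , r , i) = within-mono i (reverse r)

  -- If `h` is the sibling in its edge, the edge is entered through `h` and the old articulation
  -- becomes the sibling.
  to-end : ∀ {z xs v h} → Reach (pt z) xs v → h ∈ xs → Within (pt h) (_∈ xs) v
  to-end r@(stop refl) (here refl) = _ , r , id
  to-end (go {e = just t} (via q) n w∉ v∉) (here refl) = within-mono (λ { refl → here refl }) (at _)
  to-end (go {e = just t} (via q) n w∉ v∉) (there (here refl)) =
    within-mono (λ { (inj₁ refl) → there (here refl) ; (inj₂ (inj₁ refl)) → there (there (end∈ q)) ; (inj₂ (inj₂ refl)) → here refl })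
      (edge (sw₁ n))
  to-end (go {e = just t} (via q) n w∉ v∉) (there (there m)) =
    within-mono (λ { (inj₁ k) → there (there k) ; (inj₂ (inj₁ refl)) → there (here refl) ; (inj₂ (inj₂ refl)) → here refl })
      (snoc (to-end q m) n w∉ v∉)

  -- Facing: the only way out of the pair along the path is towards its end.
  record Facing (S : Start) (X : Pred) (m : ℕ) (v h h' : V) : Set where
    constructor facing
    field
      {α}     : List V
      {e}     : Maybe V
      {g g'}  : V
      {σ}     : List V
      arm     : Arm S α e
      nx      : Nx S e g' g
      same    : (g ≡ h × g' ≡ h') ⊎ (g ≡ h' × g' ≡ h)
      stalk   : Reach (pt g) σ v
      α⊆      : Inside α X
      σ⊆      : Inside σ X
      g'∈     : X g'
      α#σ     : Apart α σ
      g'∉α    : g' ∉ α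
      g'∉σ    : g' ∉ σ
      shorter : length σ < m

  Split : Start → Pred → ℕ → V → V → V → Set
  Split S X m v h h' = Within S (λ u → X u × u ≢ h') h ⊎ Within S (λ u → X u × u ≢ h) h' ⊎ Facing S X m v h h'

  -- Of two vertices introduced by different edges, the earlier one is reached by cutting the path
  -- before the later one. Only the two new vertices of a single edge resist, and this is `Facing`.
  -- Its bound on the stalk is what later makes the search for gates terminate.
  split : ∀ {S xs v h h'} → Reach S xs v → h ∈ xs → h' ∈ xs → h ≢ h' → Split S (_∈ xs) (length xs) v h h'
  split (stop p) (here refl) (here refl) ne = ⊥-elim (ne refl)
  split {S} {h = h} {h'} (go {xs} {e} {w} {v} a n w∉ v∉) m m' ne = cases m m'
    where
      both : (v ≡ h × w ≡ h') ⊎ (v ≡ h' × w ≡ h) → Facing S (_∈ (v ∷ w ∷ xs)) (length (v ∷ w ∷ xs)) v h h'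
      both p = facing a n p (stop refl) (λ k → there (there k)) (λ { (here q) → here q }) (there (here refl))
                 (λ { k (here refl) → v∉ k }) w∉ (λ { (here q) → nx-irr S e n q }) (s≤s (s≤s z≤n))
      old : ∀ {k k'} → Arm S xs e → k ∈ xs → k' ∉ xs → Within S (λ u → u ∈ (v ∷ w ∷ xs) × u ≢ k') k
      old (via r) m no' = within-mono (λ q → there (there q) , λ { refl → no' q }) (reach-any r m)
      deep : Arm S xs e → Nx S e w v → h ∈ xs → h' ∈ xs → Split S (_∈ (v ∷ w ∷ xs)) (length (v ∷ w ∷ xs)) v h h'
      deep (via r) n m m' with split r m m' ne
      ... | inj₁ q = inj₁ (within-mono (λ { (p , q) → there (there p) , q }) q)
      ... | inj₂ (inj₁ q) = inj₂ (inj₁ (within-mono (λ { (p , q) → there (there p) , q }) q))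
      ... | inj₂ (inj₂ (facing {α} {e'} {g} {g'} {σ} a' n' s st α⊆ σ⊆ g'∈ d g'α g'σ lt)) =
        inj₂ (inj₂ (facing a' n' s (go (via st) n (w∉ ∘ σ⊆) (v∉ ∘ σ⊆)) (λ k → there (there (α⊆ k)))
          (λ { (here q) → here q ; (there (here q)) → there (here q) ; (there (there k)) → there (there (σ⊆ k)) })
          (there (there g'∈))
          (λ { k (here refl) → v∉ (α⊆ k) ; k (there (here refl)) → w∉ (α⊆ k) ; k (there (there l)) → d k l })
          g'α (λ { (here refl) → v∉ g'∈ ; (there (here refl)) → w∉ g'∈ ; (there (there l)) → g'σ l }) (s≤s (s≤s lt))))
      cases : h ∈ (v ∷ w ∷ xs) → h' ∈ (v ∷ w ∷ xs) → Split S (_∈ (v ∷ w ∷ xs)) (length (v ∷ w ∷ xs)) v h h'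
      cases (here refl) (here refl) = ⊥-elim (ne refl)
      cases (here refl) (there (here refl)) = inj₂ (inj₂ (both (inj₁ (refl , refl))))
      cases (there (here refl)) (here refl) = inj₂ (inj₂ (both (inj₂ (refl , refl))))
      cases (there (here refl)) (there (here refl)) = ⊥-elim (ne refl)
      cases (here refl) (there (there m)) = inj₂ (inj₁ (old a m v∉))
      cases (there (here refl)) (there (there m)) = inj₂ (inj₁ (old a m w∉))
      cases (there (there m)) (here refl) = inj₁ (old a m v∉)
      cases (there (there m)) (there (here refl)) = inj₁ (old a m w∉)
      cases (there (there m)) (there (there m')) = deep a n m m'

  -- First contact of a path with the set X; w is the sibling and u the exit of the first edge meeting X.
  record First (S : Start) (X : List V) (Y : Pred) (v : V) : Set where
    constructor first
    field
      {α}    : List V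
      {e}    : Maybe V
      {w u}  : V
      {ρ}    : List V
      arm    : Arm S α e
      nx     : Nx S e w u
      touch  : w ∈ X ⊎ u ∈ X
      α#X    : Apart α X
      rest   : Reach (pt u) ρ v
      α⊆     : Inside α Y
      ρ⊆     : Inside ρ Y
      w∈     : Y w
      α#ρ    : Apart α ρ
      w∉α    : w ∉ α
      w∉ρ    : w ∉ ρ

  meets : (xs X : List V) → (Σ V λ u → u ∈ xs × u ∈ X) ⊎ Apart xs X
  meets [] X = inj₂ λ ()
  meets (x ∷ xs) X with x ∈? X
  ... | yes m = inj₁ (x , here refl , m)
  ... | no m with meets xs X
  ...   | inj₁ (u , a , b) = inj₁ (u , there a , b)
  ...   | inj₂ d = inj₂ λ { (here refl) → m ; (there k) → d k }

  first-contact : ∀ {S xs v} X → Reach S xs v → (∀ {z} → isPt S z → z ∉ X) →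
                  First S X (_∈ xs) v ⊎ Apart xs X
  first-contact X (stop p) s = inj₂ λ { (here refl) → s p }
  first-contact {S} X (go {xs} {e} {w} {v} a n w∉ v∉) s = prev a n
    where
      Ret = First S X (_∈ (v ∷ w ∷ xs)) v ⊎ Apart (v ∷ w ∷ xs) X
      ret : Apart xs X → w ∈ X ⊎ v ∈ X → Ret
      ret d t = inj₁ (first a n t d (stop refl) (λ k → there (there k)) (λ { (here q) → here q }) (there (here refl))
                 (λ { k (here refl) → v∉ k }) w∉ (λ { (here q) → nx-irr S e n q }))
      new : Apart xs X → Ret
      new d with w ∈? X | v ∈? X
      ... | yes m | _ = ret d (inj₁ m)
      ... | no _ | yes m = ret d (inj₂ m)
      ... | no m | no m' = inj₂ λ { (here refl) → m' ; (there (here refl)) → m ; (there (there k)) → d k }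
      prev : Arm S xs e → Nx S e w v → Ret
      prev none _ = new λ ()
      prev (via r) n with first-contact X r s
      ... | inj₂ d = new d
      ... | inj₁ (first {α} {_} {w'} a' n' t d st α⊆ ρ⊆ w∈ αρ wα wρ) =
        inj₁ (first a' n' t d (go (via st) n (w∉ ∘ ρ⊆) (v∉ ∘ ρ⊆)) (λ k → there (there (α⊆ k)))
          (λ { (here q) → here q ; (there (here q)) → there (here q) ; (there (there k)) → there (there (ρ⊆ k)) })
          (there (there w∈))
          (λ { k (here refl) → v∉ (α⊆ k) ; k (there (here refl)) → w∉ (α⊆ k) ; k (there (there l)) → αρ k l })
          wα (λ { (here refl) → v∉ w∈ ; (there (here refl)) → w∉ w∈ ; (there (there l)) → wρ l }))

  -- A path between two starts, cut at a vertex `h`: since `Reach` has one start only, a path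
  -- joining two bases needs this two-sided form.
  record Meet (S S' : Start) (X : Pred) : Set where
    constructor meet
    field
      {h}     : V
      {xs ys} : List V
      r       : Reach S xs h
      r'      : Reach S' ys h
      only    : ∀ {u} → u ∈ xs → u ∈ ys → u ≡ h
      xs⊆     : Inside xs X
      ys⊆     : Inside ys X

  meet-mono : ∀ {S S' X Y} → (∀ {u} → X u → Y u) → Meet S S' X → Meet S S' Y
  meet-mono f (meet r r' o a b) = meet r r' o (f ∘ a) (f ∘ b)

  meet-sym : ∀ {S S' X} → Meet S S' X → Meet S' S X
  meet-sym (meet r r' o a b) = meet r' r (λ p q → o q p) b a

  meet-pt : ∀ {S z X} → Meet S (pt z) X → Within S X z
  meet-pt (meet r r' o a b) = within-mono [ a , b ]′ (join (toWithin r) (reverse r') o)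

  -- The obstruction to joining two paths. The last edges of both arms contain the pair of `g` and
  -- `g'`; as they share two vertices, neither can follow the other in a path, and only the common
  -- stalk leads on.
  record YShape (S S' : Start) (v : V) (X : Pred) : Set where
    constructor yshape
    field
      {α β}   : List V
      {e f}   : Maybe V
      {g g'}  : V
      {σ}     : List V
      arm     : Arm S α e
      arm'    : Arm S' β f
      nx      : Nx S e g' g
      nx'     : Nx S' f g' g
      stalk   : Reach (pt g) σ v
      α#β     : Apart α β
      α#σ     : Apart α σ
      β#σ     : Apart β σ
      g'∉α    : g' ∉ α
      g'∉β    : g' ∉ β
      g'∉σ    : g' ∉ σ
      α⊆      : Inside α X
      β⊆      : Inside β X
      σ⊆      : Inside σ X
      g'∈     : X g'

  y-mono : ∀ {S S' v X Y} → (∀ {u} → X u → Y u) → YShape S S' v X → YShape S S' v Y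
  y-mono f (yshape a b c d s p q r t u w i j k l) = yshape a b c d s p q r t u w (f ∘ i) (f ∘ j) (f ∘ k) (f l)

  private
    drop₂ : ∀ {xs : List V} {v w u : V} → u ∈ (v ∷ w ∷ xs) → u ≡ v ⊎ u ≡ w ⊎ u ∈ xs
    drop₂ (here p) = inj₁ p
    drop₂ (there (here p)) = inj₂ (inj₁ p)
    drop₂ (there (there m)) = inj₂ (inj₂ m)

  exit : ∀ {S α e h h'} → Arm S α e → Nx S e h' h → h' ∉ α → h ∉ α →
         Within S (λ u → u ≡ h ⊎ u ≡ h' ⊎ u ∈ α) h
  exit a n p q = _ , go a n p q , drop₂

  y-left : ∀ {S S' v X} → YShape S S' v X → Within S X v
  y-left {X = X} (yshape {g = g} {g'} {σ} a b n n' s ab as bs ga gb gs α⊆ β⊆ σ⊆ g'∈) =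
    within-mono (λ { (inj₁ (inj₁ refl)) → σ⊆ (start∈ s) ; (inj₁ (inj₂ (inj₁ refl))) → g'∈ ; (inj₁ (inj₂ (inj₂ m))) → α⊆ m ; (inj₂ m) → σ⊆ m })
      (join (exit a n ga (λ m → as m (start∈ s))) (toWithin s)
        λ { (inj₁ e) _ → e ; (inj₂ (inj₁ refl)) m → ⊥-elim (gs m) ; (inj₂ (inj₂ k)) m → ⊥-elim (as k m) })

  -- The first edge of one path that meets the other does so in one vertex or in two. One vertex, or
  -- two that `split` separates, joins the starts; two facing vertices form the Y. The extra
  -- components say that its second arm, stalk and `g'` come from the second path.
  contact⁺ : ∀ {S S' xs v qs r} → Reach S xs v → Reach S' qs r → (∀ {z} → isPt S z → z ∉ qs) →
             (Σ V λ u → u ∈ xs × u ∈ qs) →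
             Meet S S' ((_∈ xs) ∪ (_∈ qs)) ⊎
             (Σ (YShape S S' r ((_∈ xs) ∪ (_∈ qs))) λ y → Inside (YShape.β y) (_∈ qs) × Inside (YShape.σ y) (_∈ qs) × YShape.g' y ∈ qs)
  contact⁺ {S} {S'} {xs} {v} {qs} {r} p q st (u₀ , a , b) with first-contact qs p st
  ... | inj₂ d = ⊥-elim (d a b)
  ... | inj₁ (first {α} {e} {w} {u} arm nx touch α#q rest α⊆ ρ⊆ w∈ α#ρ w∉α w∉ρ) = cases (w ∈? qs) (u ∈? qs)
    where
      Ret = Meet S S' ((_∈ xs) ∪ (_∈ qs)) ⊎
            (Σ (YShape S S' r ((_∈ xs) ∪ (_∈ qs))) λ y → Inside (YShape.β y) (_∈ qs) × Inside (YShape.σ y) (_∈ qs) × YShape.g' y ∈ qs)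
      u∉α : u ∉ α
      u∉α m = α#ρ m (start∈ rest)
      u∈xs = ρ⊆ (start∈ rest)
      single : ∀ {h h'} → Nx S e h' h → h' ∉ α → h ∉ α → h ∈ xs → h' ∈ xs →
               Within S' (λ k → k ∈ qs × k ≢ h') h → Ret
      single {h} {h'} n a b c d (zs , z , i) =
        inj₁ (meet (go arm n a b) z
          (λ { (here p) _ → p ; (there (here refl)) m → ⊥-elim (proj₂ (i m) refl) ; (there (there k)) m → ⊥-elim (α#q k (proj₁ (i m))) })
          (λ { (here refl) → inj₁ c ; (there (here refl)) → inj₁ d ; (there (there k)) → inj₁ (α⊆ k) })
          (λ m → inj₂ (proj₁ (i m))))
      cases : Dec (w ∈ qs) → Dec (u ∈ qs) → Ret
      cases (no m) (no m') = ⊥-elim ([ m , m' ]′ touch)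
      cases (no m) (yes m') = single nx w∉α u∉α u∈xs w∈ (within-mono (λ k → k , λ { refl → m k }) (reach-any q m'))
      cases (yes m) (no m') = single (nx-sym S e nx) u∉α w∉α w∈ u∈xs (within-mono (λ k → k , λ { refl → m' k }) (reach-any q m))
      cases (yes m) (yes m') with split q m m' (nx-irr S e nx)
      ... | inj₁ z = single (nx-sym S e nx) u∉α w∉α w∈ u∈xs z
      ... | inj₂ (inj₁ z) = single nx w∉α u∉α u∈xs w∈ z
      ... | inj₂ (inj₂ (facing {β} {f} {g} {g'} {σ} arm' nx' same stalk β⊆ σ⊆ g'∈ βσ gβ gσ _)) =
        inj₂ (yshape arm arm' (n' same) nx' stalk (λ k l → α#q k (β⊆ l)) (λ k l → α#q k (σ⊆ l)) βσ
               (λ k → α#q k g'∈) gβ gσ (inj₁ ∘ α⊆) (inj₂ ∘ β⊆) (inj₂ ∘ σ⊆) (inj₂ g'∈) , β⊆ , σ⊆ , g'∈)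
        where n' : (g ≡ w × g' ≡ u) ⊎ (g ≡ u × g' ≡ w) → Nx S e g' g
              n' (inj₁ (refl , refl)) = nx-sym S e nx
              n' (inj₂ (refl , refl)) = nx

  contact : ∀ {S S' xs v qs r} → Reach S xs v → Reach S' qs r → (∀ {z} → isPt S z → z ∉ qs) →
            (Σ V λ u → u ∈ xs × u ∈ qs) →
            Meet S S' ((_∈ xs) ∪ (_∈ qs)) ⊎ YShape S S' r ((_∈ xs) ∪ (_∈ qs))
  contact p q st t = [ inj₁ , inj₂ ∘ proj₁ ]′ (contact⁺ p q st t)

  -- A cycle opened at `c`: its first edge at `c` is read as a pair of `Tb c`, the path goes on to
  -- `v` without `c`, and the edge of `c`, `v`, `w` closes it.
  record Cyc (c : V) (X : Pred) : Set where
    constructor cyc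
    field
      {ys}  : List V
      {v w} : V
      r     : Reach (pr (Tb c)) ys v
      cl    : T c v w
      w∉    : w ∉ ys
      ys⊆   : Inside ys X
      w∈    : X w

  cyc-mono : ∀ {c X Y} → (∀ {u} → X u → Y u) → Cyc c X → Cyc c Y
  cyc-mono f (cyc r cl w∉ ys⊆ w∈) = cyc r cl w∉ (f ∘ ys⊆) (f w∈)

  -- The z-tadpoles with vertices in X.
  record LassoW (z : V) (X : Pred) : Set where
    constructor lasso
    field
      {c}    : V
      {xs}   : List V
      tail   : Reach (pt c) xs z
      xs⊆    : Inside xs X
      cycle  : Cyc c (λ u → X u × u ∉ xs)

  -- The tail is read towards the cycle instead of away from it, so that a base can be its start.
  record FLassoW (S : Start) (X : Pred) : Set where
    constructor flasso
    field
      {c}    : V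
      {xs}   : List V
      tail   : Reach S xs c
      xs⊆    : Inside xs X
      cycle  : Cyc c (λ u → X u × u ∉ xs)

  lasso-mono : ∀ {z X Y} → (∀ {u} → X u → Y u) → LassoW z X → LassoW z Y
  lasso-mono f (lasso t i c) = lasso t (f ∘ i) (cyc-mono (λ { (a , b) → f a , b }) c)

  flasso-mono : ∀ {S X Y} → (∀ {u} → X u → Y u) → FLassoW S X → FLassoW S Y
  flasso-mono f (flasso t i c) = flasso t (f ∘ i) (cyc-mono (λ { (a , b) → f a , b }) c)

  mkFLasso : ∀ {S X Y c} → Within S X c → Cyc c Y → (∀ {u} → X u → Y u → ⊥) → FLassoW S (X ∪ Y)
  mkFLasso (xs , r , i) cy d = flasso r (inj₁ ∘ i) (cyc-mono (λ y → inj₂ y , λ m → d (i m) y) cy)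

  flasso→lasso : ∀ {z X} → FLassoW (pt z) X → LassoW z X
  flasso→lasso (flasso t i c) with reverse t
  ... | ys , r , j = lasso r (i ∘ j) (cyc-mono (λ { (a , b) → a , b ∘ j }) c)

  -- Two edges that share exactly two vertices are a cycle of length two at either of them.
  pinch : ∀ {g g' t k} → T t g' g → T k g' g → t ≢ k → Cyc g (λ u → u ≡ g' ⊎ u ≡ t ⊎ u ≡ k)
  pinch {g} {g'} {t} {k} p q ne =
    cyc {v = g'} {w = k} (go {w = t} {v = g'} none (sw₁ (sw₂ p)) (λ ()) (λ ())) (sw₁ (sw₂ (sw₁ q)))
      (λ { (here e) → irr q e ; (there (here e)) → ne (sym e) })
      (λ { (here e) → inj₁ e ; (there (here e)) → inj₂ (inj₁ e) }) (inj₂ (inj₂ refl))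

  -- Arms that start at vertices are nonempty, so the two edges at the pair have distinct third
  -- vertices and form a cycle at `g`; the stalk is its tail.
  y-lasso : ∀ {a b z X} → YShape (pt a) (pt b) z X → LassoW z X
  y-lasso (yshape {e = just t} {just k} {g} {g'} (via p) (via q) n n' s ab as bs ga gb gs α⊆ β⊆ σ⊆ g'∈) =
    lasso s σ⊆ (cyc-mono
      (λ { (inj₁ refl) → g'∈ , gs ; (inj₂ (inj₁ refl)) → α⊆ (end∈ p) , as (end∈ p) ; (inj₂ (inj₂ refl)) → β⊆ (end∈ q) , bs (end∈ q) })
      (pinch n n' (λ { refl → ab (end∈ p) (end∈ q) })))

  lift : ∀ {c ys v} → Reach (pr (Tb c)) ys v → c ∉ ys → Within (pt c) (λ u → u ≡ c ⊎ u ∈ ys) v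
  lift {c} (go {w = w} {v = v} none n _ _) c∉ =
    within-mono (λ { (inj₁ e) → inj₁ e ; (inj₂ (inj₁ e)) → inj₂ (there (here e)) ; (inj₂ (inj₂ e)) → inj₂ (here e) }) (edge n)
  lift {c} (go {e = just t} {w = w} {v = v} (via r) n w∉ v∉) c∉ =
    within-mono (λ { (inj₁ (inj₁ e)) → inj₁ e ; (inj₁ (inj₂ m)) → inj₂ (there (there m))
                   ; (inj₂ (inj₁ e)) → inj₂ (there (here e)) ; (inj₂ (inj₂ e)) → inj₂ (here e) })
      (snoc (lift r (λ m → c∉ (there (there m)))) n
        (λ { (inj₁ e) → c∉ (there (here (sym e))) ; (inj₂ m) → w∉ m })
        (λ { (inj₁ e) → c∉ (here (sym e)) ; (inj₂ m) → v∉ m }))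

  liftW : ∀ {c X v} → Within (pr (Tb c)) X v → ¬ X c → Within (pt c) (λ u → u ≡ c ⊎ X u) v
  liftW (ys , r , i) c∉ = within-mono (λ { (inj₁ e) → inj₁ e ; (inj₂ m) → inj₂ (i m) }) (lift r (c∉ ∘ i))

  lassoV : ∀ {z X} → LassoW z X → List V
  lassoV (lasso {xs = xs} _ _ (cyc {ys} {w = w} _ _ _ _ _)) = w ∷ xs ++ ys

  lassoV⊆ : ∀ {z X} (L : LassoW z X) → Inside (lassoV L) X
  lassoV⊆ (lasso _ i (cyc _ _ _ j k)) (here refl) = proj₁ k
  lassoV⊆ (lasso {xs = xs} _ i (cyc _ _ _ j k)) (there m) = [ i , proj₁ ∘ j ]′ (∈-++⁻ xs m)

  lasso-tip : ∀ {z X} (L : LassoW z X) → z ∈ lassoV L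
  lasso-tip (lasso t _ _) = there (∈-++⁺ˡ (end∈ t))

  -- From a contact on the cycle one can go round to `c` and out along the tail. From a contact on
  -- the tail one goes on to `z`, unless the contact edge has two vertices on the tail that do not
  -- face `z`; then the path turns back to `c`, with the whole cycle still ahead.
  enter-lasso : ∀ {S ps p z X} → Reach S ps p → (L : LassoW z X) → (∀ {u} → isPt S u → u ∉ lassoV L) →
        (Σ V λ u → u ∈ ps × u ∈ lassoV L) → Within S ((_∈ ps) ∪ X) z ⊎ FLassoW S ((_∈ ps) ∪ X)
  enter-lasso {S} {ps} {p} {z} {X} rp L@(lasso {c} {xs} tl xs⊆ (cyc {ys} {v} {w} cr cl w∉ ys⊆ w∈)) st (u₀ , a , b)
    with first-contact (lassoV L) rp st
  ... | inj₂ d = ⊥-elim (d a b)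
  ... | inj₁ (first {α} {e} {w'} {u'} arm nx touch α#L rest α⊆ ρ⊆ w'∈ α#ρ w'∉α w'∉ρ) = top
    where
      Y : Pred
      Y = (_∈ ps) ∪ X
      Ret = Within S Y z ⊎ FLassoW S Y
      α#xs : Apart α xs
      α#xs m k = α#L m (there (∈-++⁺ˡ k))
      α#ys : Apart α ys
      α#ys m k = α#L m (there (∈-++⁺ʳ xs k))
      w∉α : w ∉ α
      w∉α m = α#L m (here refl)
      c∉ys : c ∉ ys
      c∉ys m = proj₂ (ys⊆ m) (start∈ tl)
      u'∉α : u' ∉ α
      u'∉α m = α#ρ m (start∈ rest)
      fromC : ∀ {Z} → Within S Z c → (∀ {u} → Z u → Y u) → (∀ {u} → Z u → u ∈ xs → u ≡ c) → Ret
      fromC q f g = inj₁ (within-mono [ f , inj₂ ∘ xs⊆ ]′ (join q (toWithin tl) g))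
      module Pair {h h' : V} (n : Nx S e h' h) (h'∉α : h' ∉ α) (h∉α : h ∉ α) (h∈ : Y h) (h'∈ : Y h') where
        out = exit arm n h'∉α h∉α
        inY : ∀ {u} → u ≡ h ⊎ u ≡ h' ⊎ u ∈ α → Y u
        inY (inj₁ refl) = h∈
        inY (inj₂ (inj₁ refl)) = h'∈
        inY (inj₂ (inj₂ m)) = inj₁ (α⊆ m)
        tail-single : h ∈ xs → h' ∉ xs → Ret
        tail-single m m' = inj₁ (within-mono [ inY , inj₂ ∘ xs⊆ ]′ (join out (to-end tl m)
          λ { (inj₁ q) _ → q ; (inj₂ (inj₁ refl)) k → ⊥-elim (m' k) ; (inj₂ (inj₂ q)) k → ⊥-elim (α#xs q k) }))
        tail-back : h ∈ xs → h' ∈ xs → Within (pt c) (λ u → u ∈ xs × u ≢ h') h → Ret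
        tail-back m m' q = inj₂ (flasso-mono
            [ [ inY , (λ k → inj₂ (xs⊆ (proj₁ k))) ]′ , (λ { ((k , _) , _) → inj₂ k }) ]′
            (mkFLasso (join out (rev q)
              λ { (inj₁ q) _ → q ; (inj₂ (inj₁ refl)) k → ⊥-elim (proj₂ k refl) ; (inj₂ (inj₂ q)) k → ⊥-elim (α#xs q (proj₁ k)) })
              cy'
              λ { (inj₁ (inj₁ refl)) k → proj₂ (proj₁ k) m ; (inj₁ (inj₂ (inj₁ refl))) k → proj₂ (proj₁ k) m'
                ; (inj₁ (inj₂ (inj₂ q))) k → proj₂ k q ; (inj₂ q) k → proj₂ (proj₁ k) (proj₁ q) }))
          where cy' : Cyc c (λ u → (X u × u ∉ xs) × u ∉ α)
                cy' = cyc cr cl w∉ (λ k → ys⊆ k , λ q → α#ys q k) (w∈ , w∉α)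
        cyc-back : h ∉ xs → h' ∉ xs → Within (pr (Tb c)) (λ u → u ∈ ys × u ≢ h') h → Ret
        cyc-back m m' q = fromC
          (join out (rev (liftW q (c∉ys ∘ proj₁)))
            λ { (inj₁ q) _ → q ; (inj₂ (inj₁ refl)) (inj₁ refl) → ⊥-elim (m' (start∈ tl)) ; (inj₂ (inj₁ refl)) (inj₂ k) → ⊥-elim (proj₂ k refl)
              ; (inj₂ (inj₂ q)) (inj₁ refl) → ⊥-elim (α#xs q (start∈ tl)) ; (inj₂ (inj₂ q)) (inj₂ k) → ⊥-elim (α#ys q (proj₁ k)) })
          (λ { (inj₁ q) → inY q ; (inj₂ (inj₁ refl)) → inj₂ (xs⊆ (start∈ tl)) ; (inj₂ (inj₂ k)) → inj₂ (proj₁ (ys⊆ (proj₁ k))) })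
          (λ { (inj₁ (inj₁ refl)) k → ⊥-elim (m k) ; (inj₁ (inj₂ (inj₁ refl))) k → ⊥-elim (m' k) ; (inj₁ (inj₂ (inj₂ q))) k → ⊥-elim (α#xs q k)
             ; (inj₂ (inj₁ q)) _ → q ; (inj₂ (inj₂ q)) k → ⊥-elim (proj₂ (ys⊆ (proj₁ q)) k) })
        -- The pair faces the end `v` of the opened cycle, so the walk continues to `v` and takes
        -- the closing edge, with sibling `w`, to `c`.
        cyc-end : h ∉ xs → h' ∉ xs → h' ∈ ys → ∀ {σ} → Reach (pt h) σ v → Inside σ (_∈ ys) → h' ∉ σ → Ret
        cyc-end m m' k' {σ} s σ⊆ h'σ = fromC
          (snoc (join out (toWithin s)
              λ { (inj₁ q) _ → q ; (inj₂ (inj₁ refl)) k → ⊥-elim (h'σ k) ; (inj₂ (inj₂ q)) k → ⊥-elim (α#ys q (σ⊆ k)) })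
            (sw₂ (sw₁ cl))
            (λ { (inj₁ (inj₁ refl)) → w∉ (σ⊆ (start∈ s)) ; (inj₁ (inj₂ (inj₁ refl))) → w∉ k' ; (inj₁ (inj₂ (inj₂ q))) → w∉α q ; (inj₂ q) → w∉ (σ⊆ q) })
            (λ { (inj₁ (inj₁ refl)) → m (start∈ tl) ; (inj₁ (inj₂ (inj₁ refl))) → m' (start∈ tl) ; (inj₁ (inj₂ (inj₂ q))) → α#xs q (start∈ tl) ; (inj₂ q) → c∉ys (σ⊆ q) }))
          (λ { (inj₁ (inj₁ q)) → inY q ; (inj₁ (inj₂ q)) → inj₂ (proj₁ (ys⊆ (σ⊆ q))) ; (inj₂ (inj₁ refl)) → inj₂ (proj₁ w∈) ; (inj₂ (inj₂ refl)) → inj₂ (xs⊆ (start∈ tl)) })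
          (λ { (inj₁ (inj₁ (inj₁ refl))) k → ⊥-elim (m k) ; (inj₁ (inj₁ (inj₂ (inj₁ refl)))) k → ⊥-elim (m' k) ; (inj₁ (inj₁ (inj₂ (inj₂ q)))) k → ⊥-elim (α#xs q k)
             ; (inj₁ (inj₂ q)) k → ⊥-elim (proj₂ (ys⊆ (σ⊆ q)) k) ; (inj₂ (inj₁ refl)) k → ⊥-elim (proj₂ w∈ k) ; (inj₂ (inj₂ q)) _ → q })
        at-w : h ≡ w → h' ∉ xs → h' ∉ ys → Ret
        at-w refl m' k' = fromC
          (snoc out (sw₂ (sw₁ (sw₂ cl)))
            (λ { (inj₁ q) → w∉ (subst (_∈ ys) q (end∈ cr)) ; (inj₂ (inj₁ q)) → k' (subst (_∈ ys) q (end∈ cr)) ; (inj₂ (inj₂ q)) → α#ys q (end∈ cr) })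
            (λ { (inj₁ refl) → proj₂ w∈ (start∈ tl) ; (inj₂ (inj₁ refl)) → m' (start∈ tl) ; (inj₂ (inj₂ q)) → α#xs q (start∈ tl) }))
          (λ { (inj₁ q) → inY q ; (inj₂ (inj₁ refl)) → inj₂ (proj₁ (ys⊆ (end∈ cr))) ; (inj₂ (inj₂ refl)) → inj₂ (xs⊆ (start∈ tl)) })
          (λ { (inj₁ (inj₁ refl)) k → ⊥-elim (proj₂ w∈ k) ; (inj₁ (inj₂ (inj₁ refl))) k → ⊥-elim (m' k) ; (inj₁ (inj₂ (inj₂ q))) k → ⊥-elim (α#xs q k)
             ; (inj₂ (inj₁ refl)) k → ⊥-elim (proj₂ (ys⊆ (end∈ cr)) k) ; (inj₂ (inj₂ q)) _ → q })
      u'∈ : Y u'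
      u'∈ = inj₁ (ρ⊆ (start∈ rest))
      module U = Pair {u'} {w'} nx w'∉α u'∉α u'∈ (inj₁ w'∈)
      module W = Pair {w'} {u'} (nx-sym S e nx) u'∉α w'∉α (inj₁ w'∈) u'∈
      ne : w' ≢ u'
      ne = nx-irr S e nx
      inCyc : ∀ {k} → k ∈ lassoV L → k ∉ xs → k ∉ ys → k ≡ w
      inCyc (here e) _ _ = e
      inCyc (there m) a b = ⊥-elim ([ a , b ]′ (∈-++⁻ xs m))
      cycles : w' ∉ xs → u' ∉ xs → Ret
      cycles m m' with w' ∈? ys | u' ∈? ys
      ... | yes a | no b = W.cyc-back m m' (within-mono (λ k → k , λ { refl → b k }) (reach-any cr a))
      ... | no a | yes b = U.cyc-back m' m (within-mono (λ k → k , λ { refl → a k }) (reach-any cr b))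
      ... | no a | no b = [ (λ t → W.at-w (inCyc t m a) m' b) , (λ t → U.at-w (inCyc t m' b) m a) ]′ touch
      ... | yes a | yes b with split cr a b ne
      ...   | inj₁ q = W.cyc-back m m' q
      ...   | inj₂ (inj₁ q) = U.cyc-back m' m q
      ...   | inj₂ (inj₂ (facing _ _ (inj₁ (refl , refl)) s _ σ⊆ g'∈ _ _ g'σ _)) = W.cyc-end m m' g'∈ s σ⊆ g'σ
      ...   | inj₂ (inj₂ (facing _ _ (inj₂ (refl , refl)) s _ σ⊆ g'∈ _ _ g'σ _)) = U.cyc-end m' m g'∈ s σ⊆ g'σ
      top : Ret
      top with w' ∈? xs | u' ∈? xs
      ... | no a | no b = cycles a b
      ... | yes a | no b = W.tail-single a b
      ... | no a | yes b = U.tail-single b a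
      ... | yes a | yes b with split tl a b ne
      ...   | inj₁ q = W.tail-back a b q
      ...   | inj₂ (inj₁ q) = U.tail-back b a q
      ...   | inj₂ (inj₂ (facing _ _ same s _ σ⊆ g'∈ _ _ g'σ _)) = inj₁ (ends same s σ⊆ g'σ)
        where
          ends : ∀ {g g' σ} → (g ≡ w' × g' ≡ u') ⊎ (g ≡ u' × g' ≡ w') → Reach (pt g) σ z → Inside σ (_∈ xs) → g' ∉ σ → Within S Y z
          ends (inj₁ (refl , refl)) s σ⊆ g'σ = within-mono [ W.inY , inj₂ ∘ xs⊆ ∘ σ⊆ ]′ (join W.out (toWithin s)
            λ { (inj₁ q) _ → q ; (inj₂ (inj₁ refl)) k → ⊥-elim (g'σ k) ; (inj₂ (inj₂ q)) k → ⊥-elim (α#xs q (σ⊆ k)) })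
          ends (inj₂ (refl , refl)) s σ⊆ g'σ = within-mono [ U.inY , inj₂ ∘ xs⊆ ∘ σ⊆ ]′ (join U.out (toWithin s)
            λ { (inj₁ q) _ → q ; (inj₂ (inj₁ refl)) k → ⊥-elim (g'σ k) ; (inj₂ (inj₂ q)) k → ⊥-elim (α#xs q (σ⊆ k)) })


  -- Rerouting paths along two disjoint arms, and gates.

  Res : (A G : Base V) (α β : List V) (Z : Pred) (v : V) → Set
  Res A G α β Z v = Within (pr A) (λ u → Z u × u ∉ β) v ⊎ Within (pr G) (λ u → Z u × u ∉ α) v

  arm-any : ∀ {S α e u} → Arm S α e → u ∈ α → Within S (_∈ α) u
  arm-any (via r) m = reach-any r m

  meetAt : ∀ {S S' X Y h} (Ok : Pred) → Within S X h → Within S' Y h → (∀ {u} → X u → Y u → u ≡ h) →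
           (∀ {u} → X u → Ok u) → (∀ {u} → Y u → Ok u) → Meet S S' Ok
  meetAt Ok (xs , r , i) (ys , q , j) o f g = meet r q (λ a b → o (i a) (j b)) (f ∘ i) (g ∘ j)

  module Reroute (Ok : Pred) where

    -- The last edge touches the arm in its sibling `w`. With `t` off both arms, `t` and `w` swap
    -- roles; with `t` on the other arm the bases would be joined. With `t` on the same arm, `split`
    -- settles all but the facing case, where the path to `t` is rerouted again along the arm cut
    -- before the pair.
    hit : (A G : Base V) → ¬ Meet (pr A) (pr G) Ok → ∀ {α p β q Z} → (∀ {u} → Z u → Ok u) →
          Arm (pr A) α p → Arm (pr G) β q → Apart α β → Inside α Z → Inside β Z →
          ∀ {t w v} → T t w v → w ∈ α → v ∉ α → v ∉ β → Z t → Z v →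
          (∀ {α₁ e₁} → Arm (pr A) α₁ e₁ → Inside α₁ (λ u → Z u × u ≢ w × u ≢ v) → (∀ {u} → u ∈ α₁ → u ∈ α) →
             Res A G α₁ β (λ u → Z u × u ≢ w × u ≢ v) t) →
          Res A G α β Z v
    hit A G nc {α} {p} {β} {q} {Z} Z⊆ aα aβ α#β α⊆ β⊆ {t} {w} {v} tr w∈ v∉α v∉β Zt Zv rec with t ∈? α | t ∈? β
    ... | yes a | yes b = ⊥-elim (α#β a b)
    ... | no a | no b = inj₁ (within-mono
            (λ { (inj₁ m) → α⊆ m , α#β m ; (inj₂ (inj₁ refl)) → Zt , b ; (inj₂ (inj₂ refl)) → Zv , v∉β })
            (snoc (arm-any aα w∈) (sw₁ tr) a v∉α))
    ... | no a | yes b = ⊥-elim (nc (meetAt Ok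
            (snoc (arm-any aα w∈) (sw₂ (sw₁ tr)) v∉α a) (arm-any aβ b)
            (λ { (inj₁ m) k → ⊥-elim (α#β m k) ; (inj₂ (inj₁ refl)) k → ⊥-elim (v∉β k) ; (inj₂ (inj₂ e)) _ → e })
            (λ { (inj₁ m) → Z⊆ (α⊆ m) ; (inj₂ (inj₁ refl)) → Z⊆ Zv ; (inj₂ (inj₂ refl)) → Z⊆ Zt })
            (Z⊆ ∘ β⊆)))
    ... | yes a | no b with aα
    ...   | via r with split r a w∈ (irr tr)
    ...     | inj₁ s = inj₁ (within-mono
                (λ { (inj₁ (m , _)) → α⊆ m , α#β m ; (inj₂ (inj₁ refl)) → α⊆ w∈ , α#β w∈ ; (inj₂ (inj₂ refl)) → Zv , v∉β })
                (snoc s tr (λ k → proj₂ k refl) (λ k → v∉α (proj₁ k))))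
    ...     | inj₂ (inj₁ s) = inj₁ (within-mono
                (λ { (inj₁ (m , _)) → α⊆ m , α#β m ; (inj₂ (inj₁ refl)) → Zt , b ; (inj₂ (inj₂ refl)) → Zv , v∉β })
                (snoc s (sw₁ tr) (λ k → proj₂ k refl) (λ k → v∉α (proj₁ k))))
    ...     | inj₂ (inj₂ (facing {α₁} {e₁} {g} {g'} {σ} a₁ n₁ same st α₁⊆ σ⊆ g'∈ α₁#σ g'∉α₁ _ _)) = fin
      where
        g∉α₁ : g ∉ α₁
        g∉α₁ m = α₁#σ m (start∈ st)
        ends : (g ≡ t × g' ≡ w) ⊎ (g ≡ w × g' ≡ t) → t ∉ α₁ × w ∉ α₁ × Nx (pr A) e₁ w t
        ends (inj₁ (refl , refl)) = g∉α₁ , g'∉α₁ , n₁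
        ends (inj₂ (refl , refl)) = g'∉α₁ , g∉α₁ , nx-sym (pr A) e₁ n₁
        t∉ = proj₁ (ends same)
        w∉ = proj₁ (proj₂ (ends same))
        n = proj₂ (proj₂ (ends same))
        fin : Res A G α β Z v
        fin with rec a₁ (λ m → α⊆ (α₁⊆ m) , (λ { refl → w∉ m }) , (λ { refl → v∉α (α₁⊆ m) })) α₁⊆
        ... | inj₁ s = inj₁ (within-mono
              (λ { (inj₁ ((z , _) , k)) → z , k ; (inj₂ (inj₁ refl)) → α⊆ w∈ , α#β w∈ ; (inj₂ (inj₂ refl)) → Zv , v∉β })
              (snoc s tr (λ k → proj₁ (proj₂ (proj₁ k)) refl) (λ k → proj₂ (proj₂ (proj₁ k)) refl)))
        ... | inj₂ s = ⊥-elim (nc (meetAt Ok (exit a₁ n w∉ t∉) s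
              (λ { (inj₁ e) _ → e ; (inj₂ (inj₁ refl)) k → ⊥-elim (proj₁ (proj₂ (proj₁ k)) refl) ; (inj₂ (inj₂ m)) k → ⊥-elim (proj₂ k m) })
              (λ { (inj₁ refl) → Z⊆ Zt ; (inj₂ (inj₁ refl)) → Z⊆ (α⊆ w∈) ; (inj₂ (inj₂ m)) → Z⊆ (α⊆ (α₁⊆ m)) })
              (Z⊆ ∘ proj₁ ∘ proj₁)))

    module _ (A G : Base V) (nc : ¬ Meet (pr A) (pr G) Ok) where

      St : Side → Start
      St left  = pr A
      St right = pr G

      -- A vertex on an arm is reached along that arm, and an edge off the arms prolongs the
      -- rerouted path to its predecessor. Removing `w` and `v` from `Z` in the recursion keeps them
      -- fresh for this last edge.
      reroute : (i : Side) → ∀ {xs v α p β q Z} → Reach (St i) xs v → (∀ {u} → Z u → Ok u) →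
                Arm (pr A) α p → Arm (pr G) β q → Apart α β → Inside xs Z → Inside α Z → Inside β Z →
                Res A G α β Z v
      reroute left (stop ())
      reroute right (stop ())
      reroute i {α = α} {β = β} {Z = Z} (go {xs} {e} {w} {v} a n w∉ v∉) Z⊆ aα aβ α#β xs⊆ α⊆ β⊆ with v ∈? α | v ∈? β
      ... | yes m | _ = inj₁ (within-mono (λ k → α⊆ k , α#β k) (arm-any aα m))
      ... | no _ | yes m = inj₂ (within-mono (λ k → β⊆ k , λ l → α#β l k) (arm-any aβ m))
      ... | no v∉α | no v∉β with w ∈? α | w ∈? β
      ...   | yes m | yes m' = ⊥-elim (α#β m m')
      ...   | no w∉α | no w∉β = plain i a n
        where
          plain : (i : Side) → Arm (St i) xs e → Nx (St i) e w v → Res A G α β Z v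
          plain left none n = inj₁ (_ , go none n (λ ()) (λ ()) , λ { (here refl) → xs⊆ (here refl) , v∉β ; (there (here refl)) → xs⊆ (there (here refl)) , w∉β })
          plain right none n = inj₂ (_ , go none n (λ ()) (λ ()) , λ { (here refl) → xs⊆ (here refl) , v∉α ; (there (here refl)) → xs⊆ (there (here refl)) , w∉α })
          plain i (via r) n with reroute i {Z = λ u → Z u × u ≢ w × u ≢ v} r (λ k → Z⊆ (proj₁ k)) aα aβ α#β
                 (λ m → xs⊆ (there (there m)) , (λ { refl → w∉ m }) , λ { refl → v∉ m })
                 (λ m → α⊆ m , (λ { refl → w∉α m }) , λ { refl → v∉α m })
                 (λ m → β⊆ m , (λ { refl → w∉β m }) , λ { refl → v∉β m })
          ... | inj₁ s = inj₁ (within-mono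
                  (λ { (inj₁ ((z , _) , k)) → z , k ; (inj₂ (inj₁ refl)) → xs⊆ (there (here refl)) , w∉β ; (inj₂ (inj₂ refl)) → xs⊆ (here refl) , v∉β })
                  (snoc s n (λ k → proj₁ (proj₂ (proj₁ k)) refl) (λ k → proj₂ (proj₂ (proj₁ k)) refl)))
          ... | inj₂ s = inj₂ (within-mono
                  (λ { (inj₁ ((z , _) , k)) → z , k ; (inj₂ (inj₁ refl)) → xs⊆ (there (here refl)) , w∉α ; (inj₂ (inj₂ refl)) → xs⊆ (here refl) , v∉α })
                  (snoc s n (λ k → proj₁ (proj₂ (proj₁ k)) refl) (λ k → proj₂ (proj₂ (proj₁ k)) refl)))
      ...   | yes m | no w∉β = onα i a n
        where
          onα : (i : Side) → Arm (St i) xs e → Nx (St i) e w v → Res A G α β Z v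
          onα left none n = inj₁ (_ , go none n (λ ()) (λ ()) , λ { (here refl) → xs⊆ (here refl) , v∉β ; (there (here refl)) → xs⊆ (there (here refl)) , w∉β })
          onα right none n = ⊥-elim (nc (meetAt Ok (arm-any aα m) (exit none (symR G n) (λ ()) (λ ()))
            (λ { _ (inj₁ e) → e ; k (inj₂ (inj₁ refl)) → ⊥-elim (v∉α k) })
            (Z⊆ ∘ α⊆) (λ { (inj₁ refl) → Z⊆ (xs⊆ (there (here refl))) ; (inj₂ (inj₁ refl)) → Z⊆ (xs⊆ (here refl)) })))
          onα i (via r) n = hit A G nc Z⊆ aα aβ α#β α⊆ β⊆ n m v∉α v∉β (xs⊆ (there (there (end∈ r)))) (xs⊆ (here refl))
            λ a₁ i₁ s₁ → reroute i r (λ k → Z⊆ (proj₁ k)) a₁ aβ (λ x y → α#β (s₁ x) y)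
              (λ k → xs⊆ (there (there k)) , (λ { refl → w∉ k }) , λ { refl → v∉ k }) i₁
              (λ k → β⊆ k , (λ { refl → w∉β k }) , λ { refl → v∉β k })
      ...   | no w∉α | yes m = onβ i a n
        where
          onβ : (i : Side) → Arm (St i) xs e → Nx (St i) e w v → Res A G α β Z v
          onβ right none n = inj₂ (_ , go none n (λ ()) (λ ()) , λ { (here refl) → xs⊆ (here refl) , v∉α ; (there (here refl)) → xs⊆ (there (here refl)) , w∉α })
          onβ left none n = ⊥-elim (nc (meetAt Ok (exit none (symR A n) (λ ()) (λ ())) (arm-any aβ m)
            (λ { (inj₁ e) _ → e ; (inj₂ (inj₁ refl)) k → ⊥-elim (v∉β k) })
            (λ { (inj₁ refl) → Z⊆ (xs⊆ (there (here refl))) ; (inj₂ (inj₁ refl)) → Z⊆ (xs⊆ (here refl)) }) (Z⊆ ∘ β⊆)))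
          onβ i (via r) n = swap (hit G A (nc ∘ meet-sym) Z⊆ aβ aα (λ x y → α#β y x) β⊆ α⊆ n m v∉β v∉α (xs⊆ (there (there (end∈ r)))) (xs⊆ (here refl))
            λ a₁ i₁ s₁ → swap (reroute i r (λ k → Z⊆ (proj₁ k)) aα a₁ (λ x y → α#β x (s₁ y))
              (λ k → xs⊆ (there (there k)) , (λ { refl → w∉ k }) , λ { refl → v∉ k })
              (λ k → α⊆ k , (λ { refl → w∉α k }) , λ { refl → v∉α k }) i₁))

  y-sym : ∀ {S S' v X} → YShape S S' v X → YShape S' S v X
  y-sym (yshape a b n n' s ab as bs ga gb gs α⊆ β⊆ σ⊆ g'∈) =
    yshape b a n' n s (λ x y → ab y x) bs as gb ga gs β⊆ α⊆ σ⊆ g'∈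

  Shorter : (S S' : Start) (Ok : Pred) (z : V) (m : ℕ) → Set
  Shorter S S' Ok z m = Σ (YShape S S' z Ok) λ y → length (YShape.σ y) < m

  module Advance (Ok : Pred) (A G : Base V) (nc : ¬ Meet (pr A) (pr G) Ok) {z : V} (y : YShape (pr A) (pr G) z Ok) where
    open YShape y
    κ : List V
    κ = g' ∷ σ
    g∈σ : g ∈ σ
    g∈σ = start∈ stalk
    g∉β : g ∉ β
    g∉β m = β#σ m g∈σ

    -- The pair in question is the one of the Y. Either of its vertices can be made the exit of the
    -- edge after the second arm, so a path from `A` to one that misses the other and that arm joins
    -- the bases.
    close : ∀ {p p' X} → Nx (pr G) f p' p → p ∈ κ → p' ∈ κ → Within (pr A) X p → (∀ {u} → X u → Ok u × u ∉ β) → ¬ X p' → ⊥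
    close {p} {p'} n pκ p'κ q X⊆ p'∉ = nc (meetAt Ok q (exit arm' n (κ∉β p'κ) (κ∉β pκ))
      (λ { _ (inj₁ e) → e ; x (inj₂ (inj₁ refl)) → ⊥-elim (p'∉ x) ; x (inj₂ (inj₂ m)) → ⊥-elim (proj₂ (X⊆ x) m) })
      (proj₁ ∘ X⊆) (λ { (inj₁ refl) → κOk pκ ; (inj₂ (inj₁ refl)) → κOk p'κ ; (inj₂ (inj₂ m)) → β⊆ m }))
      where
        κ∉β : ∀ {u} → u ∈ κ → u ∉ β
        κ∉β (here refl) = g'∉β
        κ∉β (there m) k = β#σ k m
        κOk : ∀ {u} → u ∈ κ → Ok u
        κOk (here refl) = g'∈
        κOk (there m) = σ⊆ m

    back : ∀ {o X Y} → Within (pr A) X o → Within (pt g) Y o → (∀ {u} → X u → Ok u × u ∉ β) → (∀ {u} → Y u → u ∈ σ) →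
           (∀ {u} → X u → Y u → u ≡ o) → ¬ X g' → ⊥
    back q s X⊆ Y⊆ d ng' = close nx' (there g∈σ) (here refl) (join q (rev s) d)
      (λ { (inj₁ x) → X⊆ x ; (inj₂ k) → σ⊆ (Y⊆ k) , λ m → β#σ m (Y⊆ k) })
      (λ { (inj₁ x) → ng' x ; (inj₂ k) → g'∉σ (Y⊆ k) })

    single : ∀ {o} → o ∈ κ → Within (pr A) (λ u → (Ok u × (u ∈ κ → u ≡ o)) × u ∉ β) o → ⊥
    single (here refl) q = close (nx-sym (pr G) f nx') (here refl) (there g∈σ) q (λ { ((a , _) , b) → a , b })
      (λ { ((_ , e) , _) → g'∉σ (subst (_∈ σ) (e (there g∈σ)) g∈σ) })
    single (there m) q = back q (reach-any stalk m) (λ { ((a , _) , b) → a , b }) id (λ { ((_ , e) , _) k → e (there k) })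
      (λ { ((_ , e) , _) → g'∉σ (subst (_∈ σ) (sym (e (here refl))) m) })

    -- If the two contact vertices do not face `z` along the stalk, running back to `g` joins the
    -- bases. If they do, they are the pair of a new Y, whose second arm absorbs the old pair and
    -- the stalk passed so far.
    double : ∀ {ξ d w u} → Arm (pr A) ξ d → Nx (pr A) d w u → w ∉ ξ → u ∉ ξ → w ∈ κ → u ∈ κ →
             Inside ξ (λ k → (Ok k × k ∉ κ) × k ∉ β) → (g ≢ w × g ≢ u) ⊎ (g' ≢ w × g' ≢ u) →
             Shorter (pr A) (pr G) Ok z (length σ)
    double {ξ} {d} {w} {u} aξ n w∉ u∉ wκ uκ ξ⊆ av₀ = cases av₀ wκ uκ
      where
        X : V → V → Pred
        X p q k = k ≡ p ⊎ k ≡ q ⊎ k ∈ ξ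
        κβ : ∀ {k} → k ∈ κ → Ok k × k ∉ β
        κβ (here refl) = g'∈ , g'∉β
        κβ (there m) = σ⊆ m , λ l → β#σ l m
        X⊆ : ∀ {p q} → p ∈ κ → q ∈ κ → ∀ {k} → X p q k → Ok k × k ∉ β
        X⊆ a b (inj₁ refl) = κβ a
        X⊆ a b (inj₂ (inj₁ refl)) = κβ b
        X⊆ a b (inj₂ (inj₂ m)) = proj₁ (proj₁ (ξ⊆ m)) , proj₂ (ξ⊆ m)
        ξκ : ∀ {k} → k ∈ ξ → k ∉ κ
        ξκ m = proj₂ (proj₁ (ξ⊆ m))
        u-out = exit aξ n w∉ u∉
        w-out = exit aξ (nx-sym (pr A) d n) u∉ w∉
        gg' : g ≢ g'
        gg' e = g'∉σ (subst (_∈ σ) e g∈σ)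
        cases : (g ≢ w × g ≢ u) ⊎ (g' ≢ w × g' ≢ u) → w ∈ κ → u ∈ κ → Shorter (pr A) (pr G) Ok z (length σ)
        cases _ (here refl) (here refl) = ⊥-elim (nx-irr (pr A) d n refl)
        cases (inj₂ (a , _)) (here refl) (there m) = ⊥-elim (a refl)
        cases (inj₁ (_ , b)) (here refl) (there m) = ⊥-elim (close (nx-sym (pr G) f nx') (here refl) (there g∈σ) w-out (X⊆ wκ uκ)
              λ { (inj₁ e) → gg' e ; (inj₂ (inj₁ e)) → b e ; (inj₂ (inj₂ k)) → ξκ k (there g∈σ) })
        cases (inj₂ (_ , a)) (there m) (here refl) = ⊥-elim (a refl)
        cases (inj₁ (b , _)) (there m) (here refl) = ⊥-elim (close (nx-sym (pr G) f nx') (here refl) (there g∈σ) u-out (X⊆ uκ wκ)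
              λ { (inj₁ e) → gg' e ; (inj₂ (inj₁ e)) → b e ; (inj₂ (inj₂ k)) → ξκ k (there g∈σ) })
        cases _ (there m) (there m') with split stalk m m' (nx-irr (pr A) d n)
        ... | inj₁ s = ⊥-elim (back w-out s (X⊆ wκ uκ) proj₁
              (λ { (inj₁ e) _ → e ; (inj₂ (inj₁ refl)) k → ⊥-elim (proj₂ k refl) ; (inj₂ (inj₂ l)) k → ⊥-elim (ξκ l (there (proj₁ k))) })
              (λ { (inj₁ refl) → g'∉σ m ; (inj₂ (inj₁ refl)) → g'∉σ m' ; (inj₂ (inj₂ l)) → ξκ l (here refl) }))
        ... | inj₂ (inj₁ s) = ⊥-elim (back u-out s (X⊆ uκ wκ) proj₁
              (λ { (inj₁ e) _ → e ; (inj₂ (inj₁ refl)) k → ⊥-elim (proj₂ k refl) ; (inj₂ (inj₂ l)) k → ⊥-elim (ξκ l (there (proj₁ k))) })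
              (λ { (inj₁ refl) → g'∉σ m' ; (inj₂ (inj₁ refl)) → g'∉σ m ; (inj₂ (inj₂ l)) → ξκ l (here refl) }))
        ... | inj₂ (inj₂ (facing {σ₁} {just k} {p} {p'} {σ₂} (via r) n₁ same st σ₁⊆ σ₂⊆ p'∈ σ₁#σ₂ p'∉₁ p'∉₂ lt)) =
              yshape aξ (via (proj₁ (proj₂ ext))) (pp same) n₁ st
                (λ a b → ξext a (proj₂ (proj₂ ext) b)) (λ a b → ξκ a (there (σ₂⊆ b)))
                (λ a b → ext₂ (proj₂ (proj₂ ext) a) b) (λ a → ξκ a (there p'∈))
                (λ a → extp' (proj₂ (proj₂ ext) a)) p'∉₂ (proj₁ ∘ proj₁ ∘ ξ⊆)
                (λ a → extOk (proj₂ (proj₂ ext) a)) (σ⊆ ∘ σ₂⊆) (σ⊆ p'∈) , lt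
          where
            E : Pred
            E i = (i ≡ g ⊎ i ≡ g' ⊎ i ∈ β) ⊎ i ∈ σ₁
            ext : Within (pr G) E k
            ext = join (exit arm' nx' g'∉β g∉β) (toWithin r)
              λ { (inj₁ e) _ → e ; (inj₂ (inj₁ refl)) l → ⊥-elim (g'∉σ (σ₁⊆ l)) ; (inj₂ (inj₂ l)) l' → ⊥-elim (β#σ l (σ₁⊆ l')) }
            ξext : ∀ {i} → i ∈ ξ → E i → ⊥
            ξext a (inj₁ (inj₁ refl)) = ξκ a (there g∈σ)
            ξext a (inj₁ (inj₂ (inj₁ refl))) = ξκ a (here refl)
            ξext a (inj₁ (inj₂ (inj₂ b))) = proj₂ (ξ⊆ a) b
            ξext a (inj₂ b) = ξκ a (there (σ₁⊆ b))
            g∈σ₁ : g ∈ σ₁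
            g∈σ₁ = start∈ r
            ext₂ : ∀ {i} → E i → i ∈ σ₂ → ⊥
            ext₂ (inj₁ (inj₁ refl)) b = σ₁#σ₂ g∈σ₁ b
            ext₂ (inj₁ (inj₂ (inj₁ refl))) b = g'∉σ (σ₂⊆ b)
            ext₂ (inj₁ (inj₂ (inj₂ a))) b = β#σ a (σ₂⊆ b)
            ext₂ (inj₂ a) b = σ₁#σ₂ a b
            extp' : E p' → ⊥
            extp' (inj₁ (inj₁ e)) = p'∉₁ (subst (_∈ σ₁) (sym e) g∈σ₁)
            extp' (inj₁ (inj₂ (inj₁ e))) = g'∉σ (subst (_∈ σ) e p'∈)
            extp' (inj₁ (inj₂ (inj₂ a))) = β#σ a p'∈
            extp' (inj₂ a) = p'∉₁ a
            extOk : ∀ {i} → E i → Ok i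
            extOk (inj₁ (inj₁ refl)) = σ⊆ g∈σ
            extOk (inj₁ (inj₂ (inj₁ refl))) = g'∈
            extOk (inj₁ (inj₂ (inj₂ a))) = β⊆ a
            extOk (inj₂ a) = σ⊆ (σ₁⊆ a)
            pp : (p ≡ w × p' ≡ u) ⊎ (p ≡ u × p' ≡ w) → Nx (pr A) d p' p
            pp (inj₁ (refl , refl)) = nx-sym (pr A) d n
            pp (inj₂ (refl , refl)) = n

  -- If no path joins the bases A and G, the pair {g , g'} of a YShape with shortest stalk lies on all paths from A or G to z.
  module GateTheorem (Ok : Pred) (A G : Base V) (nc : ¬ Meet (pr A) (pr G) Ok) (z : V) where
    open Reroute Ok

    Viol : (g g' : V) → Set
    Viol g g' = Σ Side λ i → Σ (List V) λ xs → Reach (St A G nc i) xs z × Inside xs Ok × (g ∉ xs ⊎ g' ∉ xs)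

    -- The violating path is cut at its first contact with stalk and `g'`, and what precedes is
    -- rerouted off one arm. One contact vertex then contradicts `nc`; two give a Y with shorter
    -- stalk.
    smaller : (y : YShape (pr A) (pr G) z Ok) → Viol (YShape.g y) (YShape.g' y) → Shorter (pr A) (pr G) Ok z (length (YShape.σ y))
    smaller y (i , xs , r , xs⊆ , av) = main
      where
        open YShape y
        module L = Advance Ok A G nc y
        module R = Advance Ok G A (nc ∘ meet-sym) (y-sym y)
        κ = g' ∷ σ
        notPt : ∀ i {k} → isPt (St A G nc i) k → k ∉ κ
        notPt left ()
        notPt right ()
        main : Shorter (pr A) (pr G) Ok z (length σ)
        main with first-contact κ r (notPt i)
        ... | inj₂ d = ⊥-elim (d (end∈ r) (there (end∈ stalk)))
        ... | inj₁ (first {ξ} {d} {w} {u} aξ n touch ξ#κ rest ξ⊆ ρ⊆ w∈ ξ#ρ w∉ξ w∉ρ) = fin (w ∈? κ) (u ∈? κ)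
          where
            u∉ξ : u ∉ ξ
            u∉ξ m = ξ#ρ m (start∈ rest)
            u∈ : u ∈ xs
            u∈ = ρ⊆ (start∈ rest)
            S = St A G nc i
            α∉κ : ∀ {k} → k ∈ α → k ∉ κ
            α∉κ m (here refl) = g'∉α m
            α∉κ m (there l) = α#σ m l
            β∉κ : ∀ {k} → k ∈ β → k ∉ κ
            β∉κ m (here refl) = g'∉β m
            β∉κ m (there l) = β#σ m l
            av' : (g ≢ w × g ≢ u) ⊎ (g' ≢ w × g' ≢ u)
            av' = [ (λ m → inj₁ ((λ { refl → m w∈ }) , λ { refl → m u∈ })) , (λ m → inj₂ ((λ { refl → m w∈ }) , λ { refl → m u∈ })) ]′ av
            one : ∀ {o o'} → Nx S d o' o → o' ∉ ξ → o ∉ ξ → o ∈ κ → o' ∉ κ → o ∈ xs → o' ∈ xs → ⊥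
            one {o} {o'} n' a b oκ o'κ ox o'x
              -- Putting this into `Z` makes rerouting remember that `o` is the only contact with
              -- the stalk and `g'`.
              with reroute A G nc i {Z = λ k → Ok k × (k ∈ κ → k ≡ o)} (go aξ n' a b) proj₁ arm arm' α#β
                     (λ { (here refl) → xs⊆ ox , (λ _ → refl) ; (there (here refl)) → xs⊆ o'x , (λ k → ⊥-elim (o'κ k))
                        ; (there (there m)) → xs⊆ (ξ⊆ m) , λ k → ⊥-elim (ξ#κ m k) })
                     (λ m → α⊆ m , λ k → ⊥-elim (α∉κ m k)) (λ m → β⊆ m , λ k → ⊥-elim (β∉κ m k))
            ... | inj₁ q = L.single oκ q
            ... | inj₂ q = R.single oκ q
            two : ∀ i {d} → Arm (St A G nc i) ξ d → Nx (St A G nc i) d w u → w ∈ κ → u ∈ κ → Shorter (pr A) (pr G) Ok z (length σ)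
            two left none n a b = L.double none n (λ ()) (λ ()) a b (λ ()) av'
            two right none n a b with R.double none n (λ ()) (λ ()) a b (λ ()) av'
            ... | y' , lt = y-sym y' , lt
            two i (via q) n a b
              with reroute A G nc i {Z = λ k → Ok k × k ∉ κ} q proj₁ arm arm' α#β
                     (λ m → xs⊆ (ξ⊆ m) , ξ#κ m) (λ m → α⊆ m , α∉κ m) (λ m → β⊆ m , β∉κ m)
            ... | inj₁ (ζ , q' , j) = L.double (via q') n (λ m → proj₂ (proj₁ (j m)) a) (λ m → proj₂ (proj₁ (j m)) b) a b j av'
            ... | inj₂ (ζ , q' , j) with R.double (via q') n (λ m → proj₂ (proj₁ (j m)) a) (λ m → proj₂ (proj₁ (j m)) b) a b j av'
            ...   | y' , lt = y-sym y' , lt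
            fin : Dec (w ∈ κ) → Dec (u ∈ κ) → Shorter (pr A) (pr G) Ok z (length σ)
            fin (no a) (no b) = ⊥-elim ([ a , b ]′ touch)
            fin (no a) (yes b) = ⊥-elim (one n w∉ξ u∉ξ b a u∈ w∈)
            fin (yes a) (no b) = ⊥-elim (one (nx-sym S d n) u∉ξ w∉ξ a b w∈ u∈)
            fin (yes a) (yes b) = two i aξ n a b

    GateY : Set
    GateY = Σ (YShape (pr A) (pr G) z Ok) λ y → ¬ Viol (YShape.g y) (YShape.g' y)

    gate-from : ∀ k (y : YShape (pr A) (pr G) z Ok) → length (YShape.σ y) ≤ k → ¬¬ GateY
    gate-from k y le = em >>= λ
      { (no nv) → pure (y , nv)
      ; (yes vi) → next k y le (smaller y vi) }
      where
        next : ∀ k (y : YShape (pr A) (pr G) z Ok) → length (YShape.σ y) ≤ k → Shorter (pr A) (pr G) Ok z (length (YShape.σ y)) → ¬¬ GateY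
        next (suc k) y le (y' , lt) = gate-from k y' (≤-pred (≤-trans lt le))
        next zero y le (y' , lt) = ⊥-elim (absurd (≤-trans lt le))
          where absurd : ∀ {m} → suc m ≤ zero → ⊥
                absurd ()

    gates : Within (pr A) Ok z → Within (pr G) Ok z → ¬¬ GateY
    gates (xs , r , i) (ys , q , j) with contact r q (λ ()) (z , end∈ r , end∈ q)
    ... | inj₁ m = ⊥-elim (nc (meet-mono [ i , j ]′ m))
    ... | inj₂ y = gate-from _ (y-mono [ i , j ]′ y) ≤-refl


  -- Changing the base, and path surgery that controls the whole vertex list.

  infixl 7 _∖_
  _∖_ : Pred → V → Pred
  (X ∖ c) u = X u × u ≢ c

  _⊑_ : Base V → Base V → Set
  A ⊑ B = ∀ {u v} → R A u v → R B u v

  rebase : ∀ {A B} → A ⊑ B → ∀ {xs v} → Reach (pr A) xs v → Reach (pr B) xs v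
  rebase f (go none n a b) = go none (f n) a b
  rebase f (go {e = just _} (via r) n a b) = go (via (rebase f r)) n a b

  rebaseW : ∀ {A B X v} → A ⊑ B → Within (pr A) X v → Within (pr B) X v
  rebaseW f (xs , r , i) = xs , rebase f r , i

  -- Only the first pair of a path uses the base, so the rest is the same whichever part that pair
  -- belongs to.
  choose : ∀ {A B C} → (∀ {u v} → R C u v → R A u v ⊎ R B u v) → ∀ {xs v} → Reach (pr C) xs v → Reach (pr A) xs v ⊎ Reach (pr B) xs v
  choose f (go none n a b) = Data.Sum.map (λ k → go none k a b) (λ k → go none k a b) (f n)
  choose f (go {e = just _} (via r) n a b) = Data.Sum.map (λ k → go (via k) n a b) (λ k → go (via k) n a b) (choose f r)

  chooseW : ∀ {A B C X v} → (∀ {u v} → R C u v → R A u v ⊎ R B u v) → Within (pr C) X v → Within (pr A) X v ⊎ Within (pr B) X v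
  chooseW f (xs , r , i) = Data.Sum.map (λ k → xs , k , i) (λ k → xs , k , i) (choose f r)

  pair∈ : ∀ {A X v} → Within (pr A) X v → Σ V λ w → Σ V λ u → R A w u × X w × X u
  pair∈ {A} {X} (_ , r , i) = f r i
    where
      f : ∀ {xs v} → Reach (pr A) xs v → Inside xs X → Σ V λ w → Σ V λ u → R A w u × X w × X u
      f (go none n _ _) i = _ , _ , n , i (there (here refl)) , i (here refl)
      f (go (via r) n _ _) i = f r (λ k → i (there (there k)))

  record Opened (A : Base V) (xs : List V) (v : V) : Set where
    constructor opened
    field
      {w u} : V
      {ρ}   : List V
      front : R A w u
      rest  : Reach (pt u) ρ v
      w∉ρ   : w ∉ ρ
      w∈    : w ∈ xs
      ρ⊆    : Inside ρ (_∈ xs)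
      cover : ∀ {k} → k ∈ xs → k ≡ w ⊎ k ∈ ρ

  uncons : ∀ {A xs v} → Reach (pr A) xs v → Opened A xs v
  uncons {A} (go none n _ _) = opened n (stop refl) (λ { (here e) → irrR A n e }) (there (here refl)) (λ { (here e) → here e })
    (λ { (here e) → inj₂ (here e) ; (there (here e)) → inj₁ e })
  uncons (go {w = w} {v = v} (via r) n w∉ v∉) with uncons r
  ... | opened f q k i j c = opened f (go (via q) n (w∉ ∘ j) (v∉ ∘ j))
        (λ { (here refl) → v∉ i ; (there (here refl)) → w∉ i ; (there (there m)) → k m }) (there (there i))
        (λ { (here e) → here e ; (there (here e)) → there (here e) ; (there (there m)) → there (there (j m)) })
        (λ { (here e) → inj₂ (here e) ; (there (here e)) → inj₂ (there (here e)) ; (there (there m)) → map₂ (λ l → there (there l)) (c m) })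

  -- Without `x` the first edge becomes a pair of `Tb x`. The last component records that no other
  -- vertex is lost.
  drop⁺ : ∀ {x xs v} → Reach (pt x) xs v → v ≢ x →
          Σ (List V) λ ds → Reach (pr (Tb x)) ds v × Inside ds ((_∈ xs) ∖ x) × (∀ {u} → u ∈ xs → u ≢ x → u ∈ ds)
  drop⁺ (stop refl) ne = ⊥-elim (ne refl)
  drop⁺ {x} (go {e = just _} (via (stop refl)) n w∉ v∉) ne =
    _ , go none n (λ ()) (λ ()) , (λ { (here refl) → here refl , ne ; (there (here refl)) → there (here refl) , λ { refl → irr n refl } }) ,
    λ { (here e) _ → here e ; (there (here e)) _ → there (here e) ; (there (there (here e))) n → ⊥-elim (n e) }
  drop⁺ {x} (go {e = just _} (via r@(go (via r₀) _ _ v'∉)) n w∉ v∉) ne with drop⁺ r (λ { refl → v'∉ (start∈ r₀) })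
  ... | ys , q , i , c = _ , go (via q) n (w∉ ∘ proj₁ ∘ i) (v∉ ∘ proj₁ ∘ i) ,
        (λ { (here refl) → here refl , ne ; (there (here refl)) → there (here refl) , (λ { refl → w∉ (start∈ r) })
          ; (there (there m)) → there (there (proj₁ (i m))) , proj₂ (i m) }) ,
        λ { (here e) _ → here e ; (there (here e)) _ → there (here e) ; (there (there m)) n → there (there (c m n)) }

  drop-start : ∀ {x xs v} → Reach (pt x) xs v → v ≢ x → Within (pr (Tb x)) ((_∈ xs) ∖ x) v
  drop-start r ne with drop⁺ r ne
  ... | ds , q , i , _ = ds , q , i

  dropW : ∀ {x X v} → Within (pt x) X v → v ≢ x → Within (pr (Tb x)) (X ∖ x) v
  dropW (xs , r , i) ne = within-mono (λ { (a , b) → i a , b }) (drop-start r ne)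

  -- The list of the reversed path made explicit: `reverse` only says that no vertex is added, while
  -- some arguments need that none is lost.
  rv : List V → List V
  rv [] = []
  rv (v ∷ []) = v ∷ []
  rv (v ∷ w ∷ xs) = rv xs ++ w ∷ v ∷ []

  rv⁺ : ∀ {u} xs → u ∈ xs → u ∈ rv xs
  rv⁺ (v ∷ []) m = m
  rv⁺ (v ∷ w ∷ xs) (here e) = ∈-++⁺ʳ (rv xs) (there (here e))
  rv⁺ (v ∷ w ∷ xs) (there (here e)) = ∈-++⁺ʳ (rv xs) (here e)
  rv⁺ (v ∷ w ∷ xs) (there (there m)) = ∈-++⁺ˡ (rv⁺ xs m)

  rv⁻ : ∀ {u} xs → u ∈ rv xs → u ∈ xs
  rv⁻ (v ∷ []) m = m
  rv⁻ (v ∷ w ∷ xs) m with ∈-++⁻ (rv xs) m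
  ... | inj₁ k = there (there (rv⁻ xs k))
  ... | inj₂ (here e) = there (here e)
  ... | inj₂ (there (here e)) = here e

  consᵖ : ∀ {v w t ys z} → T v w t → Reach (pt t) ys z → v ∉ ys → w ∉ ys → Reach (pt v) (ys ++ w ∷ v ∷ []) z
  consᵖ {v} n (stop refl) a b = go (via (stop refl)) n (λ { (here refl) → irr n refl }) (λ { (here refl) → irr₃ n refl })
  consᵖ {v} {w} n (go {xs} {e = just _} {w'} {v'} (via r) m w∉ v∉) a b =
    go (via (consᵖ n r (λ k → a (there (there k))) (λ k → b (there (there k))))) m (f w∉ (there (here refl))) (f v∉ (here refl))
    where
      f : ∀ {u} → u ∉ xs → u ∈ (v' ∷ w' ∷ xs) → u ∉ (xs ++ w ∷ v ∷ [])
      f n k l with ∈-++⁻ xs l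
      ... | inj₁ p = n p
      ... | inj₂ (here refl) = b k
      ... | inj₂ (there (here refl)) = a k

  consᵇ : ∀ {A w t ys z} → R A w t → Reach (pt t) ys z → w ∉ ys → Reach (pr A) (ys ++ w ∷ []) z
  consᵇ {A} n (stop refl) b = go none n (λ ()) (λ ())
  consᵇ {A} {w} n (go {xs} {e = just _} {w'} {v'} (via r) m w∉ v∉) b =
    go (via (consᵇ n r (λ k → b (there (there k))))) m (f w∉ (there (here refl))) (f v∉ (here refl))
    where
      f : ∀ {u} → u ∉ xs → u ∈ (v' ∷ w' ∷ xs) → u ∉ (xs ++ w ∷ [])
      f n k l with ∈-++⁻ xs l
      ... | inj₁ p = n p
      ... | inj₂ (here refl) = b k

  liftᵖ : ∀ {c ys v} → Reach (pr (Tb c)) ys v → c ∉ ys → Reach (pt c) (ys ++ c ∷ []) v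
  liftᵖ (go none n _ _) c∉ = go (via (stop refl)) n (λ { (here e) → irr n (sym e) }) (λ { (here e) → irr₃ n (sym e) })
  liftᵖ {c} (go {xs} {e = just _} {w} {v} (via r) n w∉ v∉) c∉ =
    go (via (liftᵖ r (λ m → c∉ (there (there m))))) n (f w∉ (λ e → c∉ (there (here (sym e))))) (f v∉ (λ e → c∉ (here (sym e))))
    where
      f : ∀ {u} → u ∉ xs → u ≢ c → u ∉ (xs ++ c ∷ [])
      f n k l with ∈-++⁻ xs l
      ... | inj₁ p = n p
      ... | inj₂ (here e) = k e

  reverse⁺ : ∀ {z xs v} → Reach (pt z) xs v → Reach (pt v) (rv xs) z
  reverse⁺ (stop refl) = stop refl
  reverse⁺ (go {xs} {e = just _} (via r) n w∉ v∉) = consᵖ (sw₁ (sw₂ (sw₁ n))) (reverse⁺ r) (v∉ ∘ rv⁻ xs) (w∉ ∘ rv⁻ xs)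

  -- Where a path passes through b: as an articulation, or as the sibling of an exit.
  record Exit (S : Start) (xs : List V) (v b : V) : Set where
    constructor exitAt
    field
      {α ρ} : List V
      upto  : Reach S α b
      rest  : Reach (pt b) ρ v
      only  : ∀ {u} → u ∈ α → u ∈ ρ → u ≡ b
      α⊆    : Inside α (_∈ xs)
      ρ⊆    : Inside ρ (_∈ xs)

  record Sibling (S : Start) (xs : List V) (v b : V) : Set where
    constructor sibling
    field
      {α}   : List V
      {e}   : Maybe V
      {g}   : V
      {ρ}   : List V
      arm   : Arm S α e
      nx    : Nx S e b g
      rest  : Reach (pt g) ρ v
      α#ρ   : Apart α ρ
      b∉α   : b ∉ α
      b∉ρ   : b ∉ ρ
      α⊆    : Inside α (_∈ xs)
      ρ⊆    : Inside ρ (_∈ xs)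
      cover : ∀ {u} → u ∈ xs → u ≡ b ⊎ u ∈ α ⊎ u ∈ ρ

  locate : ∀ {S xs v b} → Reach S xs v → b ∈ xs → Exit S xs v b ⊎ Sibling S xs v b
  locate r@(stop p) (here refl) = inj₁ (exitAt r (stop refl) (λ _ → λ { (here e) → e }) id id)
  locate r@(go _ _ _ _) (here refl) = inj₁ (exitAt r (stop refl) (λ _ → λ { (here e) → e }) id (λ { (here e) → here e }))
  locate {S} (go {e = e} a n w∉ v∉) (there (here refl)) =
    inj₂ (sibling a n (stop refl) (λ { k (here refl) → v∉ k }) w∉ (λ { (here q) → nx-irr S e n q }) (λ k → there (there k)) (λ { (here q) → here q })
      λ { (here q) → inj₂ (inj₂ (here q)) ; (there (here q)) → inj₁ q ; (there (there k)) → inj₂ (inj₁ k) })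
  locate (go (via r) n w∉ v∉) (there (there m)) with locate r m
  ... | inj₁ (exitAt p q o i j) = inj₁ (exitAt p (go (via q) n (w∉ ∘ j) (v∉ ∘ j))
          (λ { k (here refl) → ⊥-elim (v∉ (i k)) ; k (there (here refl)) → ⊥-elim (w∉ (i k)) ; k (there (there l)) → o k l }) (λ k → there (there (i k)))
          λ { (here e) → here e ; (there (here e)) → there (here e) ; (there (there k)) → there (there (j k)) })
  ... | inj₂ (sibling a nx q d bα bρ i j c) = inj₂ (sibling a nx (go (via q) n (w∉ ∘ j) (v∉ ∘ j))
          (λ { k (here refl) → v∉ (i k) ; k (there (here refl)) → w∉ (i k) ; k (there (there l)) → d k l }) bα
          (λ { (here refl) → v∉ m ; (there (here refl)) → w∉ m ; (there (there l)) → bρ l }) (λ k → there (there (i k)))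
          (λ { (here e) → here e ; (there (here e)) → there (here e) ; (there (there k)) → there (there (j k)) })
          λ { (here e) → inj₂ (inj₂ (here e)) ; (there (here e)) → inj₂ (inj₂ (there (here e)))
            ; (there (there k)) → map₂ (map₂ (λ l → there (there l))) (c k) })

  -- Follow the first path to the meeting point and the second one back to its first pair: the edge
  -- of `x` behind that pair closes the cycle.
  cyc-of-meet : ∀ {x A G X} → A ⊑ Tb x → G ⊑ Tb x → Meet (pr A) (pr G) X → Cyc x X
  cyc-of-meet {x} {X = X} f g (meet {h} {xs} {ys} r r' o i j) with uncons r'
  ... | opened {w} {u} {ρ} n q w∉ρ w∈ ρ⊆ _ with join (toWithin (rebase f r)) (reverse q) (λ a b → o a (ρ⊆ b))
  ...   | zs , r'' , k = cyc r'' (sw₂ (g n)) (λ m → [ (λ a → w∉ρ (subst (_∈ ρ) (sym (o a w∈)) (end∈ q))) , w∉ρ ]′ (k m))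
            (λ m → [ i , j ∘ ρ⊆ ]′ (k m)) (j w∈)

  cyc→lasso : ∀ {x X} → Cyc x X → ¬ X x → LassoW x (λ u → X u ⊎ u ≡ x)
  cyc→lasso c n = lasso (stop refl) (λ { (here e) → inj₂ e }) (cyc-mono (λ k → inj₁ k , λ { (here refl) → n k }) c)

  lassoFrom : ∀ {z X Y c} → Within (pt z) X c → Cyc c Y → (∀ {u} → X u → Y u → ⊥) → LassoW z (X ∪ Y)
  lassoFrom q c d = flasso→lasso (mkFLasso q c d)

  flasso-base : ∀ {x A X} → A ⊑ Tb x → FLassoW (pr A) X → ¬ X x → LassoW x (λ u → X u ⊎ u ≡ x)
  flasso-base {x} {A} {X} f (flasso {c} {xs} t i cy) n =
    lasso-mono (λ { (inj₁ (inj₁ e)) → inj₂ e ; (inj₁ (inj₂ m)) → inj₁ (i m) ; (inj₂ k) → inj₁ (proj₁ k) })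
      (lassoFrom (lift (rebase f t) (n ∘ i)) cy λ { (inj₁ refl) k → n (proj₁ k) ; (inj₂ m) k → proj₂ k m })

  -- An empty arm means that the edge at the pair contains `x`, which then serves as its third
  -- vertex. Both arms cannot be empty, since the bases have no pair in common.
  y-lasso-base : ∀ {x A G z X} → A ⊑ Tb x → G ⊑ Tb x → (∀ {u v} → R A u v → R G u v → ⊥) → ¬ X x →
                 YShape (pr A) (pr G) z X → LassoW z (λ u → X u ⊎ u ≡ x)
  y-lasso-base f g d n (yshape none none nx nx' _ _ _ _ _ _ _ _ _ _ _) = ⊥-elim (d nx nx')
  y-lasso-base {x} f g d n (yshape {g = p} {p'} (via a) none nx nx' s ab as bs ga gb gs α⊆ β⊆ σ⊆ g'∈) =
    lasso s (inj₁ ∘ σ⊆) (cyc-mono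
      (λ { (inj₁ refl) → inj₁ g'∈ , gs ; (inj₂ (inj₁ refl)) → inj₁ (α⊆ (end∈ a)) , as (end∈ a) ; (inj₂ (inj₂ refl)) → inj₂ refl , n ∘ σ⊆ })
      (pinch nx (g nx') λ { refl → n (α⊆ (end∈ a)) }))
  y-lasso-base {x} f g d n (yshape {g = p} {p'} none (via b) nx nx' s ab as bs ga gb gs α⊆ β⊆ σ⊆ g'∈) =
    lasso s (inj₁ ∘ σ⊆) (cyc-mono
      (λ { (inj₁ refl) → inj₁ g'∈ , gs ; (inj₂ (inj₁ refl)) → inj₁ (β⊆ (end∈ b)) , bs (end∈ b) ; (inj₂ (inj₂ refl)) → inj₂ refl , n ∘ σ⊆ })
      (pinch nx' (f nx) λ { refl → n (β⊆ (end∈ b)) }))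
  y-lasso-base f g d n (yshape (via a) (via b) nx nx' s ab as bs ga gb gs α⊆ β⊆ σ⊆ g'∈) =
    lasso s (inj₁ ∘ σ⊆) (cyc-mono
      (λ { (inj₁ refl) → inj₁ g'∈ , gs ; (inj₂ (inj₁ refl)) → inj₁ (α⊆ (end∈ a)) , as (end∈ a) ; (inj₂ (inj₂ refl)) → inj₁ (β⊆ (end∈ b)) , bs (end∈ b) })
      (pinch nx nx' λ { refl → ab (end∈ a) (end∈ b) }))

  -- Separating one edge at `x` from the others turns paths from `x` with different first edges into
  -- paths from two bases, to which gates apply.
  module Split₂ (x v w : V) where
    Same : V → V → Set
    Same a b = (a ≡ v × b ≡ w) ⊎ (a ≡ w × b ≡ v)
    same? : ∀ a b → Dec (Same a b)
    same? a b = ((a ≟ v) ×-dec (b ≟ w)) ⊎-dec ((a ≟ w) ×-dec (b ≟ v))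
    flip : ∀ {a b} → Same a b → Same b a
    flip (inj₁ (p , q)) = inj₂ (q , p)
    flip (inj₂ (p , q)) = inj₁ (q , p)
    One Rest : Base V
    One = record { R = λ a b → T x a b × Same a b ; symR = λ { (t , e) → sw₂ t , flip e } ; irrR = irr₂ ∘ proj₁ }
    Rest = record { R = λ a b → T x a b × ¬ Same a b ; symR = λ { (t , e) → sw₂ t , e ∘ flip } ; irrR = irr₂ ∘ proj₁ }
    one⊑ : One ⊑ Tb x
    one⊑ = proj₁
    rest⊑ : Rest ⊑ Tb x
    rest⊑ = proj₁
    disj : ∀ {a b} → R One a b → R Rest a b → ⊥
    disj (_ , e) (_ , n) = n e
    decide : ∀ {a b} → T x a b → R One a b ⊎ R Rest a b
    decide {a} {b} t with same? a b
    ... | yes e = inj₁ (t , e)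
    ... | no n = inj₂ (t , n)
    one∋ : ∀ {X u} → Within (pr One) X u → X v × X w
    one∋ q with pair∈ q
    ... | _ , _ , (_ , inj₁ (refl , refl)) , a , b = a , b
    ... | _ , _ , (_ , inj₂ (refl , refl)) , a , b = b , a

  -- Vertices common to all paths and tadpoles.

  Hits : Start → Pred → V → V → Set
  Hits S X z c = ¬ Within S (X ∖ c) z

  -- Of the two gate vertices `g'` is taken because it lies off the stalk and so differs from `z`,
  -- while `g` may be `z` itself.
  gate-hits : ∀ Ok A G nc z (y : GateTheorem.GateY Ok A G nc z) → let g' = YShape.g' (proj₁ y) in
              g' ≢ z × Hits (pr A) Ok z g' × Hits (pr G) Ok z g'
  gate-hits _ _ _ _ _ (y , nv) = (λ { refl → YShape.g'∉σ y (end∈ (YShape.stalk y)) }) ,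
    (λ { (xs , r , i) → nv (left , xs , r , proj₁ ∘ i , inj₂ (λ m → proj₂ (i m) refl)) }) ,
    (λ { (xs , r , i) → nv (right , xs , r , proj₁ ∘ i , inj₂ (λ m → proj₂ (i m) refl)) })

  -- The gates are applied to one edge at x against all the others: two paths from x that meet would form a lasso at x.
  module _ {x z : V} {Ok : Pred} (x≢z : x ≢ z) (x∉ : ¬ Ok x) (free : ¬ LassoW x (λ u → Ok u ⊎ u ≡ x)) where
    no-meet : ∀ {A G} → A ⊑ Tb x → G ⊑ Tb x → ¬ Meet (pr A) (pr G) Ok
    no-meet f g m = free (cyc→lasso (cyc-of-meet f g m) x∉)

    common : ¬¬ (Σ V λ c → c ≢ z × Hits (pr (Tb x)) Ok z c)
    common = em >>= λ
      { (no n) → pure (x , x≢z , n ∘ within-mono proj₁)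
      ; (yes (xs , r , i)) → start (uncons r) i }
      where
        start : ∀ {xs} → Opened (Tb x) xs z → Inside xs Ok → ¬¬ (Σ V λ c → c ≢ z × Hits (pr (Tb x)) Ok z c)
        start (opened {w} {u} f q w∉ w∈ ρ⊆ _) i = em >>= λ
          { (no n) → pure (one n)
          ; (yes k) → GateTheorem.gates Ok S.One S.Rest (no-meet S.one⊑ S.rest⊑) z oneW k >>= λ gt → pure (two gt) }
          where
            module S = Split₂ x w u
            oneW : Within (pr S.One) Ok z
            oneW = within-mono (λ { (inj₁ (inj₁ refl)) → i (ρ⊆ (start∈ q)) ; (inj₁ (inj₂ (inj₁ refl))) → i w∈ ; (inj₂ m) → i (ρ⊆ m) })
              (join (exit none (f , inj₁ (refl , refl)) (λ ()) (λ ())) (toWithin q) λ { (inj₁ e) _ → e ; (inj₂ (inj₁ refl)) m → ⊥-elim (w∉ m) })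
            two : GateTheorem.GateY Ok S.One S.Rest (no-meet S.one⊑ S.rest⊑) z → Σ V λ c → c ≢ z × Hits (pr (Tb x)) Ok z c
            two gt with gate-hits Ok S.One S.Rest (no-meet S.one⊑ S.rest⊑) z gt
            ... | a , b , c = _ , a , λ p → [ b , c ]′ (chooseW S.decide p)
            -- Only the chosen edge leads to `z`, so either of its two vertices other than `z` is
            -- common to all paths.
            one : ¬ Within (pr S.Rest) Ok z → Σ V λ c → c ≢ z × Hits (pr (Tb x)) Ok z c
            one n with w ≟ z
            ... | no ne = w , ne , λ p → [ (λ k → proj₂ (proj₁ (S.one∋ k)) refl) , n ∘ within-mono proj₁ ]′ (chooseW S.decide p)
            ... | yes e = u , (λ e' → irr₂ f (trans e (sym e'))) , λ p → [ (λ k → proj₂ (proj₂ (S.one∋ k)) refl) , n ∘ within-mono proj₁ ]′ (chooseW S.decide p)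

  lasso∋ : ∀ {z X y} (L : LassoW z X) → ¬ LassoW z (X ∖ y) → y ∈ lassoV L
  lasso∋ {y = y} L@(lasso {xs = xs} t i (cyc {ys} {w = w} r cl w∉ ys⊆ w∈)) n with y ∈? lassoV L
  ... | yes m = m
  ... | no m = ⊥-elim (n (lasso t (λ k → i k , λ { refl → m (there (∈-++⁺ˡ k)) })
          (cyc r cl w∉ (λ k → (proj₁ (ys⊆ k) , λ { refl → m (there (∈-++⁺ʳ xs k)) }) , proj₂ (ys⊆ k)) ((proj₁ w∈ , λ { refl → m (here refl) }) , proj₂ w∈))))

  module _ {A G : Base V} {Ok : Pred} {z y : V} (nc : ¬ Meet (pr A) (pr G) Ok) (nl : ¬ FLassoW (pr A) Ok)
           (az : Within (pr A) Ok z) (y≢z : y ≢ z) (hy : Hits (pr A) Ok z y) (ly : ¬ LassoW z (Ok ∖ y)) where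
    -- If `G` does not reach `z`, `y` itself works; otherwise the gate vertex `g'` does, unless a
    -- tadpole misses it. In that case `y` works again: a path from `G` avoiding `y` combines with
    -- the first arm of the gate into a path from `A` avoiding `y`, or joins the bases.
    common₂ : ¬¬ (Σ V λ c → c ≢ z × Hits (pr A) Ok z c × Hits (pr G) Ok z c × ¬ LassoW z (Ok ∖ c))
    common₂ = em >>= λ
      { (no n) → pure (y , y≢z , hy , n ∘ within-mono proj₁ , ly)
      ; (yes gz) → GateTheorem.gates Ok A G nc z az gz >>= λ gt → em >>= λ
        { (no n) → let (a , b , c) = gate-hits Ok A G nc z gt in pure (_ , a , b , c , n)
        ; (yes L) → pure (y , y≢z , hy , other gt L , ly) } }
      where
        other : (gt : GateTheorem.GateY Ok A G nc z) → LassoW z (Ok ∖ YShape.g' (proj₁ gt)) → Hits (pr G) Ok z y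
        other gt@(ys , nv) L (qs , q , j) = clash (contact (go arm nx g'∉α (λ m → α#σ m (start∈ stalk))) q (λ ()) (g , here refl , g∈q))
          where
            open YShape ys
            y∈L : y ∈ lassoV L
            y∈L = lasso∋ L (ly ∘ lasso-mono (λ { ((a , _) , c) → a , c }))
            -- Every tadpole at `z` that misses `g'` contains `y`. An arm through `y` would enter it
            -- and either reach `z` without `g'` or hang a tadpole on `A`.
            y∉α : y ∉ α
            y∉α m = touch arm m
              where touch : ∀ {e} → Arm (pr A) α e → y ∈ α → ⊥
                    touch (via r) m with enter-lasso r L (λ ()) (y , m , y∈L)
                    ... | inj₁ w = proj₁ (proj₂ (gate-hits Ok A G nc z gt)) (within-mono [ (λ k → α⊆ k , λ { refl → g'∉α k }) , id ]′ w)
                    ... | inj₂ w = nl (flasso-mono [ α⊆ , proj₁ ]′ w)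
            g∈q : g ∈ qs
            g∈q with g ∈? qs
            ... | yes m = m
            ... | no m = ⊥-elim (nv (right , qs , q , proj₁ ∘ j , inj₁ m))
            g'∈q : g' ∈ qs
            g'∈q with g' ∈? qs
            ... | yes m = m
            ... | no m = ⊥-elim (nv (right , qs , q , proj₁ ∘ j , inj₂ m))
            inside : ∀ {u} → u ∈ (g ∷ g' ∷ α) ⊎ u ∈ qs → (Ok ∖ y) u
            inside (inj₁ (here refl)) = j g∈q
            inside (inj₁ (there (here refl))) = j g'∈q
            inside (inj₁ (there (there m))) = α⊆ m , λ { refl → y∉α m }
            inside (inj₂ m) = j m
            clash : Meet (pr A) (pr G) ((_∈ (g ∷ g' ∷ α)) ∪ (_∈ qs)) ⊎ YShape (pr A) (pr G) z ((_∈ (g ∷ g' ∷ α)) ∪ (_∈ qs)) → ⊥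
            clash (inj₁ m) = nc (meet-mono (proj₁ ∘ inside) m)
            clash (inj₂ s) = hy (within-mono inside (y-left s))

  lasso-any : ∀ {z X u} (L : LassoW z X) → u ∈ lassoV L → Within (pt z) X u
  lasso-any {z} {X} {u} (lasso {c} {xs} t i (cyc {ys} {v} {w} r cl w∉ ys⊆ w∈)) m = any m
    where
      tc : Within (pt z) (_∈ xs) c
      tc = reverse t
      any : u ∈ (w ∷ xs ++ ys) → Within (pt z) X u
      any (here refl) = within-mono
        (λ { (inj₁ k) → i k ; (inj₂ (inj₁ refl)) → proj₁ (ys⊆ (end∈ r)) ; (inj₂ (inj₂ refl)) → proj₁ w∈ })
        (snoc tc cl (proj₂ (ys⊆ (end∈ r))) (proj₂ w∈))
      any (there k) with ∈-++⁻ xs k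
      ... | inj₁ a = within-mono i (rev (to-end t a))
      ... | inj₂ b = within-mono (λ { (inj₁ k) → i k ; (inj₂ (inj₁ refl)) → i (start∈ t) ; (inj₂ (inj₂ k)) → proj₁ (ys⊆ k) })
              (join tc (liftW (reach-any r b) (λ k → proj₂ (ys⊆ k) (start∈ t))) λ { a (inj₁ e) → e ; a (inj₂ k) → ⊥-elim (proj₂ (ys⊆ k) a) })

  -- A vertex b without lassos is only ever hanging on the cycle of a lasso, so the rest of the lasso can be reached avoiding b.
  lasso-any-avoiding : ∀ {z X u b} (L : LassoW z X) → b ∈ lassoV L → ¬ LassoW b X → u ∈ lassoV L → u ≢ b → Within (pt z) (X ∖ b) u
  lasso-any-avoiding {z} {X} {u} {b} (lasso {c} {xs} t i (cyc {ys} {v} {w} r cl w∉ ys⊆ w∈)) b∈ nb u∈ ne = go-to u∈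
    where
      tc : Within (pt z) (_∈ xs) c
      tc = reverse t
      c∉ys : c ∉ ys
      c∉ys m = proj₂ (ys⊆ m) (start∈ t)
      b∉xs : b ∉ xs
      b∉xs m with reach-any t m
      ... | ls , q , k = nb (lasso q (i ∘ k) (cyc-mono (λ { (a , n) → a , n ∘ k }) (cyc r cl w∉ ys⊆ w∈)))
      atExit : ∀ {α ρ} → Reach (pr (Tb c)) α b → Reach (pt b) ρ v → (∀ {u} → u ∈ α → u ∈ ρ → u ≡ b) → Inside α (_∈ ys) → Inside ρ (_∈ ys) → ⊥
      atExit {α} {ρ} p q o α⊆ ρ⊆ = nb (lasso-mono [ proj₁ , (λ { refl → proj₁ (ys⊆ (α⊆ (end∈ p))) }) ]′ (cyc→lasso (cyc-of-meet id id
          (meetAt {h = c} (X ∖ b) (dropW one c≢b) (dropW two c≢b) one#two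
            (λ { (inj₁ k , n) → proj₁ (ys⊆ (ρ⊆ k)) , n ; (inj₂ (inj₁ refl) , n) → proj₁ w∈ , n ; (inj₂ (inj₂ refl) , n) → i (start∈ t) , n })
            (λ { (inj₁ refl , n) → i (start∈ t) , n ; (inj₂ k , n) → proj₁ (ys⊆ (α⊆ k)) , n }))) (λ k → proj₂ k refl)))
        where
          c≢b : c ≢ b
          c≢b refl = c∉ys (α⊆ (end∈ p))
          one : Within (pt b) (λ u → u ∈ ρ ⊎ u ≡ w ⊎ u ≡ c) c
          one = snoc (toWithin q) (sw₂ (sw₁ cl)) (w∉ ∘ ρ⊆) (c∉ys ∘ ρ⊆)
          two : Within (pt b) (λ u → u ≡ c ⊎ u ∈ α) c
          two = rev (lift p (c∉ys ∘ α⊆))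
          one#two : ∀ {u} → ((λ u → u ∈ ρ ⊎ u ≡ w ⊎ u ≡ c) ∖ b) u → ((λ u → u ≡ c ⊎ u ∈ α) ∖ b) u → u ≡ c
          one#two _ (inj₁ e , _) = e
          one#two (inj₁ k , n) (inj₂ l , _) = ⊥-elim (n (o l k))
          one#two (inj₂ (inj₁ refl) , _) (inj₂ l , _) = ⊥-elim (w∉ (α⊆ l))
          one#two (inj₂ (inj₂ e) , _) (inj₂ l , _) = e
      v≢b : v ≢ b
      v≢b refl = atExit r (stop refl) (λ _ → λ { (here e) → e }) id (λ { (here refl) → end∈ r })
      through : ∀ {Z} → Within (pt c) Z u → (∀ {k} → Z k → (k ≡ c ⊎ (X k × k ∉ xs)) × k ≢ b) → Within (pt z) (X ∖ b) u
      through q f = within-mono (λ { (inj₁ k) → i k , (λ { refl → b∉xs k }) ; (inj₂ k) → [ (λ { refl → i (start∈ t) }) , proj₁ ]′ (proj₁ (f k)) , proj₂ (f k) })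
        (join tc q λ { a k → [ id , (λ l → ⊥-elim (proj₂ l a)) ]′ (proj₁ (f k)) })
      onCycle : u ∈ ys → Within (pt z) (X ∖ b) u
      onCycle m with b ∈? ys
      ... | no n = through (liftW (reach-any r m) c∉ys)
              λ { (inj₁ refl) → inj₁ refl , (λ { refl → b∉xs (start∈ t) }) ; (inj₂ k) → inj₂ (ys⊆ k) , λ { refl → n k } }
      ... | yes k with locate r k
      ...   | inj₁ (exitAt p q o α⊆ ρ⊆) = ⊥-elim (atExit p q o α⊆ ρ⊆)
      ...   | inj₂ (sibling {α} {e} {g} {ρ} arm nx rest α#ρ b∉α b∉ρ α⊆ ρ⊆ cover) with cover m
      ...     | inj₁ e₁ = ⊥-elim (ne e₁)
      ...     | inj₂ (inj₁ l) = through (liftW (arm-any arm l) (c∉ys ∘ α⊆))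
                  λ { (inj₁ refl) → inj₁ refl , (λ { refl → b∉xs (start∈ t) }) ; (inj₂ k) → inj₂ (ys⊆ (α⊆ k)) , λ { refl → b∉α k } }
      ...     | inj₂ (inj₂ l) = through (join (edge (sw₂ cl)) (rev (to-end rest l))
                    λ { (inj₁ refl) k → ⊥-elim (c∉ys (ρ⊆ k)) ; (inj₂ (inj₁ refl)) k → ⊥-elim (w∉ (ρ⊆ k)) ; (inj₂ (inj₂ e₁)) _ → e₁ })
                  λ { (inj₁ (inj₁ refl)) → inj₁ refl , (λ { refl → b∉xs (start∈ t) }) ; (inj₁ (inj₂ (inj₁ refl))) → inj₂ w∈ , (λ { refl → w∉ k })
                    ; (inj₁ (inj₂ (inj₂ refl))) → inj₂ (ys⊆ (end∈ r)) , v≢b ; (inj₂ p) → inj₂ (ys⊆ (ρ⊆ p)) , λ { refl → b∉ρ p } }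
      go-to : u ∈ (w ∷ xs ++ ys) → Within (pt z) (X ∖ b) u
      go-to (here refl) = within-mono
        (λ { (inj₁ k) → i k , (λ { refl → b∉xs k }) ; (inj₂ (inj₁ refl)) → proj₁ (ys⊆ (end∈ r)) , v≢b ; (inj₂ (inj₂ refl)) → proj₁ w∈ , ne })
        (snoc tc cl (proj₂ (ys⊆ (end∈ r))) (proj₂ w∈))
      go-to (there k) with ∈-++⁻ xs k
      ... | inj₁ a = within-mono (λ l → i l , λ { refl → b∉xs l }) (rev (to-end t a))
      ... | inj₂ m = onCycle m


  attach : ∀ {S X z Y} → Within S X z → (L : LassoW z Y) → (∀ {u} → X u → u ∈ lassoV L → u ≡ z) → FLassoW S (X ∪ Y)
  attach {X = X} {z} {Y} q (lasso {c} {xs} t i (cyc {ys} {v} {w} r cl w∉ ys⊆ w∈)) d =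
    flasso-mono (λ { (inj₁ (inj₁ a)) → inj₁ a ; (inj₁ (inj₂ m)) → inj₂ (i m) ; (inj₂ (inj₁ m)) → inj₂ (proj₁ (ys⊆ m)) ; (inj₂ (inj₂ refl)) → inj₂ (proj₁ w∈) })
      (mkFLasso (join q (reverse t) (λ a m → d a (there (∈-++⁺ˡ m)))) (cyc {X = λ u → u ∈ ys ⊎ u ≡ w} r cl w∉ inj₁ (inj₂ refl))
        λ { (inj₁ a) (inj₁ m) → proj₂ (ys⊆ m) (subst (_∈ xs) (sym (d a (there (∈-++⁺ʳ xs m)))) (end∈ t))
          ; (inj₁ a) (inj₂ refl) → proj₂ w∈ (subst (_∈ xs) (sym (d a (here refl))) (end∈ t))
          ; (inj₂ k) (inj₁ m) → proj₂ (ys⊆ m) k ; (inj₂ k) (inj₂ refl) → proj₂ w∈ k })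

  edge-lasso : ∀ {a c d X F} → Within (pt a) X c → T a c d → ¬ X d → (∀ {u} → X u → F u) → F d → LassoW a F
  edge-lasso {a} {c} {d} {X} {F} p t n f fd with dropW p (λ { refl → irr t refl })
  ... | ls , q , i = lasso-mono [ [ f ∘ proj₁ , (λ { refl → fd }) ]′ , (λ { refl → f (proj₂ (proj₂ p) (start∈ (proj₁ (proj₂ p)))) }) ]′
        (cyc→lasso {X = (X ∖ a) ∪ (_≡ d)} (cyc q t (n ∘ proj₁ ∘ i) (inj₁ ∘ i) (inj₂ refl)) λ { (inj₁ k) → proj₂ k refl ; (inj₂ refl) → irr₃ t refl })

  -- Where the two paths meet they either join `a` to `a'` or form a Y, and the Y is a tadpole at
  -- `d`.
  merge : ∀ {a a' d X Y} → Within (pt a) X d → Within (pt a') Y d → ¬ Y a → Within (pt a) (X ∪ Y) a' ⊎ LassoW d (X ∪ Y)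
  merge (ps , p , i) (qs , q , k) n with contact p q (λ { refl m → n (k m) }) (_ , end∈ p , end∈ q)
  ... | inj₁ m = inj₁ (within-mono [ inj₁ ∘ i , inj₂ ∘ k ]′ (meet-pt m))
  ... | inj₂ y = inj₂ (lasso-mono [ inj₁ ∘ i , inj₂ ∘ k ]′ (y-lasso y))

  -- The exits of a path are its ends and the vertices joining consecutive edges.
  Exits : ∀ {x qs r} → Pred → Reach (pt x) qs r → Set
  Exits P (stop {z} _) = P z
  Exits P (go {e = just _} {v = v} (via r) _ _ _) = P v × Exits P r

  exits-map : ∀ {x qs r P Q} (q : Reach (pt x) qs r) → (∀ {u} → P u → Q u) → Exits P q → Exits Q q
  exits-map (stop _) f p = f p
  exits-map (go {e = just _} (via r) _ _ _) f (p , ps) = f p , exits-map r f ps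

  exits-zip : ∀ {x qs r P Q} (q : Reach (pt x) qs r) → Exits P q → Exits Q q → Exits (λ u → P u × Q u) q
  exits-zip (stop _) a b = a , b
  exits-zip (go {e = just _} (via r) _ _ _) (a , as) (b , bs) = (a , b) , exits-zip r as bs

  exits-in : ∀ {x qs r P} (q : Reach (pt x) qs r) → Inside qs P → Exits P q
  exits-in (stop _) i = i (here refl)
  exits-in (go {e = just _} (via r) _ _ _) i = i (here refl) , exits-in r (λ m → i (there (there m)))

  last-exit : ∀ {x qs r P} (q : Reach (pt x) qs r) → Exits P q → P r
  last-exit (stop _) p = p
  last-exit (go {e = just _} (via r) _ _ _) (p , _) = p

  find-exit : ∀ {x qs r P} z (q : Reach (pt x) qs r) → Exits P q → Exits (_≢ z) q ⊎ z ≡ x ⊎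
    (Σ (List V) λ ps → Σ V λ r' → Σ V λ h → Reach (pt x) ps r' × T r' h z × h ∉ ps × z ∉ ps × Inside (h ∷ ps) (_∈ qs) × P r')
  find-exit z (stop {v} refl) p with v ≟ z
  ... | yes refl = inj₂ (inj₁ refl)
  ... | no n = inj₁ n
  find-exit z (go {xs} {e = just t} {w} {v} (via r) n w∉ v∉) (p , ps) with v ≟ z
  ... | yes refl = inj₂ (inj₂ (xs , t , w , r , n , w∉ , v∉ , (λ { (here refl) → there (here refl) ; (there m) → there (there m) }) , last-exit r ps))
  ... | no ne with find-exit z r ps
  ...   | inj₁ a = inj₁ (ne , a)
  ...   | inj₂ (inj₁ a) = inj₂ (inj₁ a)
  ...   | inj₂ (inj₂ (ps , r' , h , a , b , c , d , e , f)) = inj₂ (inj₂ (ps , r' , h , a , b , c , d , (λ m → there (there (e m))) , f))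

  -- Cut vertices along a path whose exits carry no tadpoles.

  module Walk (F : Pred) (x z : V) (x-lf : ¬ LassoW x F) (z-lf : ¬ LassoW z F) where

    LF : V → Set
    LF r = ¬ LassoW r F

    -- If neither could be avoided, `t` and `w` would be the exit and sibling of the last edge of
    -- the path; this edge and that of `t'`, `w`, `t` would be a cycle of length two at `t`.
    avoid₂ : ∀ {a t t' w zs} → Reach (pt a) zs t → Inside zs F → T t' w t → F t' → t' ∉ zs → LF t →
             Within (pt a) (λ u → u ∈ zs × u ≢ w) t ⊎ Within (pt a) (λ u → u ∈ zs × u ≢ t) w
    avoid₂ {a} {t} {t'} {w} {zs} r i n Ft' t'∉ lf with w ∈? zs
    ... | no m = inj₁ (within-mono (λ k → k , λ { refl → m k }) (toWithin r))
    ... | yes m with split r m (end∈ r) (irr₂ n)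
    ...   | inj₁ q = inj₂ q
    ...   | inj₂ (inj₁ q) = inj₁ q
    ...   | inj₂ (inj₂ (facing _ _ (inj₁ (refl , refl)) st _ _ _ _ _ g'∉ _)) = ⊥-elim (g'∉ (end∈ st))
    ...   | inj₂ (inj₂ (facing {e = just k} (via q) nx (inj₂ (refl , refl)) st α⊆ _ _ α#σ _ _ _)) =
            ⊥-elim (lf (lasso-mono [ (λ { (inj₁ refl) → i m ; (inj₂ (inj₁ refl)) → i (α⊆ (end∈ q)) ; (inj₂ (inj₂ refl)) → Ft' }) , (λ { refl → i (end∈ r) }) ]′
              (cyc→lasso (pinch nx n λ { refl → t'∉ (α⊆ (end∈ q)) })
                 λ { (inj₁ e) → irr₂ n (sym e) ; (inj₂ (inj₁ refl)) → irr₃ nx refl ; (inj₂ (inj₂ e)) → irr₃ n (sym e) })))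

    -- Such a path, run back to `x` and merged with the given one to `t'`, is either a tadpole at
    -- `x` or a path from `t'` to `t` or `w`, which the edge of `t'`, `w`, `t` closes into a cycle
    -- at `t'`.
    previous : ∀ {t t' w qs} → Reach (pt x) qs t' → Inside qs F → T t' w t → F w → F t → w ∉ qs → t ∉ qs → LF t' → LF t →
               ¬ Within (pt x) (F ∖ t') t
    previous {t} {t'} {w} {qs} q q⊆ n Fw Ft w∉ t∉ lf' lf (zs , r , i) with avoid₂ r (proj₁ ∘ i) n (q⊆ (end∈ q)) (λ m → proj₂ (i m) refl) lf
    ... | inj₁ p with merge (rev p) (reverse q) t∉
    ...   | inj₁ m = lf' (edge-lasso (rev m) (sw₂ n) (λ { (inj₁ k) → proj₂ k refl ; (inj₂ k) → w∉ k }) [ proj₁ ∘ i ∘ proj₁ , q⊆ ]′ Fw)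
    ...   | inj₂ l = x-lf (lasso-mono [ proj₁ ∘ i ∘ proj₁ , q⊆ ]′ l)
    previous {t} {t'} {w} {qs} q q⊆ n Fw Ft w∉ t∉ lf' lf (zs , r , i) | inj₂ p with merge (rev p) (reverse q) w∉
    ...   | inj₁ m = lf' (edge-lasso (rev m) n (λ { (inj₁ k) → proj₂ k refl ; (inj₂ k) → t∉ k }) [ proj₁ ∘ i ∘ proj₁ , q⊆ ]′ Ft)
    ...   | inj₂ l = x-lf (lasso-mono [ proj₁ ∘ i ∘ proj₁ , q⊆ ]′ l)

    On : V → V → Set
    On r c = ¬ Within (pt x) (F ∖ c) r

    on-exits : ∀ {qs r} (q : Reach (pt x) qs r) → Inside qs F → Exits LF q → Exits (On r) q
    on-exits (stop refl) i _ = λ { (ls , r , k) → proj₂ (k (end∈ r)) refl }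
    on-exits {r = r} (go {e = just t} (via q) n w∉ v∉) i (lf , lfs) = (λ { (ls , r , k) → proj₂ (k (end∈ r)) refl }) ,
      exits-map q (λ on p → on (earlier p)) (on-exits q (λ m → i (there (there m))) lfs)
      where
        earlier : ∀ {c} → Within (pt x) (F ∖ c) r → Within (pt x) (F ∖ c) t
        earlier (ls , p , k) with t ∈? ls
        ... | yes m = within-mono k (reach-any p m)
        ... | no m = ⊥-elim (previous q (λ m → i (there (there m))) n (i (there (here refl))) (i (here refl)) w∉ v∉ (last-exit q lfs) lf
                       (ls , p , λ l → proj₁ (k l) , λ { refl → m l }))

    -- z hangs off the spine at a single exit.
    walk : ∀ {qs r} (q : Reach (pt x) qs r) → Inside qs F → Exits LF q → Exits (_≢ z) q →
           ¬¬ (Σ V λ c → c ∈ qs × c ≢ z × ¬ Within (pt x) (F ∖ c) z × ¬ Within (pt r) (F ∖ c) z × On r c)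
    walk (stop refl) i _ ne = pure (x , here refl , ne , no-start , no-start , λ { (ls , r , k) → proj₂ (k (end∈ r)) refl })
      where no-start : ∀ {r v} → ¬ Within (pt r) (F ∖ r) v
            no-start (ls , r , k) = proj₂ (k (start∈ r)) refl
    walk {r = t} q'@(go {qs} {e = just t'} {w} (via q) n w∉ t∉) i (lf , lfs) (t≢z , nes) =
      walk q (λ m → i (there (there m))) lfs nes >>= λ { (c , c∈ , c≢z , hx , ht' , on) → em >>= λ
        { (no m) → pure (c , there (there c∈) , c≢z , hx , m , λ p → on (earlier p))
        -- If the new end `t` reaches `z` without the old cut vertex, that vertex must be the
        -- previous exit `t'`, and `t` takes its place.
        ; (yes y) → pure (next c∈ hx ht' y (c ≟ t')) } }
      where
        F' : Inside qs F
        F' m = i (there (there m))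
        Fw = i (there (here refl))
        Ft = i (here refl)
        lf' : LF t'
        lf' = last-exit q lfs
        no-start : ∀ {r v} → ¬ Within (pt r) (F ∖ r) v
        no-start (ls , r , k) = proj₂ (k (start∈ r)) refl
        earlier : ∀ {c} → Within (pt x) (F ∖ c) t → Within (pt x) (F ∖ c) t'
        earlier (ls , p , k) with t' ∈? ls
        ... | yes m = within-mono k (reach-any p m)
        ... | no m = ⊥-elim (previous q F' n Fw Ft w∉ t∉ lf' lf (ls , p , λ l → proj₁ (k l) , λ { refl → m l }))
        Ret = Σ V λ c → c ∈ (t ∷ w ∷ qs) × c ≢ z × ¬ Within (pt x) (F ∖ c) z × ¬ Within (pt t) (F ∖ c) z × On t c
        cut : ∀ {c} → Within (pt t) (F ∖ c) z → ¬ Within (pt t') (F ∖ c) z ⊎ c ≡ t' →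
              Within (pt t) (λ u → (F u × u ≢ c × u ≢ t') × u ≢ w) z ⊎ Within (pt w) (λ u → (F u × u ≢ c × u ≢ t') × u ≢ t) z
        cut {c} (ls , p , k) h = [ (λ a → inj₁ (rev (within-mono f a))) , (λ a → inj₂ (rev (within-mono f a))) ]′
            (avoid₂ (reverse⁺ p) (proj₁ ∘ k ∘ rv⁻ ls) n (F' (end∈ q)) (t'∉ ∘ rv⁻ ls) lf)
          where
            t'∉ : t' ∉ ls
            t'∉ m = [ (λ h → h (within-mono k (to-end p m))) , (λ { refl → proj₂ (k m) refl }) ]′ h
            f : ∀ {u v} → u ∈ rv ls × u ≢ v → (F u × u ≢ c × u ≢ t') × u ≢ v
            f (m , ne) = (proj₁ (k (rv⁻ ls m)) , proj₂ (k (rv⁻ ls m)) , λ { refl → t'∉ (rv⁻ ls m) }) , ne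
        next : ∀ {c} → c ∈ qs → ¬ Within (pt x) (F ∖ c) z → ¬ Within (pt t') (F ∖ c) z → Within (pt t) (F ∖ c) z → Dec (c ≡ t') → Ret
        next {c} c∈ hx ht' y (no ne) = ⊥-elim (absurd (cut y (inj₁ ht')))
          where
            absurd : Within (pt t) (λ u → (F u × u ≢ c × u ≢ t') × u ≢ w) z ⊎ Within (pt w) (λ u → (F u × u ≢ c × u ≢ t') × u ≢ t) z → ⊥
            absurd (inj₁ p) = ht' (within-mono
              (λ { (inj₁ (inj₁ refl)) → F' (end∈ q) , ≢-sym ne ; (inj₁ (inj₂ (inj₁ refl))) → Fw , (λ { refl → w∉ c∈ }) ; (inj₁ (inj₂ (inj₂ refl))) → Ft , (λ { refl → t∉ c∈ })
                 ; (inj₂ ((a , b , _) , _)) → a , b })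
              (join (edge n) p λ { (inj₁ refl) k → ⊥-elim (proj₂ (proj₂ (proj₁ k)) refl) ; (inj₂ (inj₁ refl)) k → ⊥-elim (proj₂ k refl) ; (inj₂ (inj₂ e)) _ → e }))
            absurd (inj₂ p) = ht' (within-mono
              (λ { (inj₁ (inj₁ refl)) → F' (end∈ q) , ≢-sym ne ; (inj₁ (inj₂ (inj₂ refl))) → Fw , (λ { refl → w∉ c∈ }) ; (inj₁ (inj₂ (inj₁ refl))) → Ft , (λ { refl → t∉ c∈ })
                 ; (inj₂ ((a , b , _) , _)) → a , b })
              (join (edge (sw₂ n)) p λ { (inj₁ refl) k → ⊥-elim (proj₂ (proj₂ (proj₁ k)) refl) ; (inj₂ (inj₁ refl)) k → ⊥-elim (proj₂ k refl) ; (inj₂ (inj₂ e)) _ → e }))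
        next {c} c∈ hx ht' y (yes refl) = t , here refl , t≢z , through , no-start , λ { (ls , r , k) → proj₂ (k (end∈ r)) refl }
          where
            Y = cut y (inj₂ refl)
            fF : ∀ {u v} → (F u × u ≢ t' × u ≢ t') × u ≢ v → F u
            fF = proj₁ ∘ proj₁
            direct : Within (pt t') (λ u → (F u × u ≢ t) × u ≢ w) z → ⊥
            direct p with Y
            ... | inj₁ a with merge a p (λ k → proj₂ (proj₁ k) refl)
            ...   | inj₁ m = lf' (edge-lasso (rev m) (sw₂ n) [ (λ k → proj₂ k refl) , (λ k → proj₂ k refl) ]′ [ fF , proj₁ ∘ proj₁ ]′ Fw)
            ...   | inj₂ l = z-lf (lasso-mono [ fF , proj₁ ∘ proj₁ ]′ l)
            direct p | inj₂ a with merge a p (λ k → proj₂ k refl)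
            ...   | inj₁ m = lf' (edge-lasso (rev m) n [ (λ k → proj₂ k refl) , (λ k → proj₂ (proj₁ k) refl) ]′ [ fF , proj₁ ∘ proj₁ ]′ Ft)
            ...   | inj₂ l = z-lf (lasso-mono [ fF , proj₁ ∘ proj₁ ]′ l)
            aside : Within (pt w) (λ u → (F u × u ≢ t) × u ≢ t') z → ⊥
            aside p with merge y p (λ k → proj₂ (proj₁ k) refl)
            ... | inj₁ m = lf (edge-lasso m (sw₂ (sw₁ (sw₂ n))) [ (λ k → proj₂ k refl) , (λ k → proj₂ k refl) ]′ [ proj₁ , proj₁ ∘ proj₁ ]′ (F' (end∈ q)))
            ... | inj₂ l = z-lf (lasso-mono [ proj₁ , proj₁ ∘ proj₁ ]′ l)
            through : ¬ Within (pt x) (F ∖ t) z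
            through (ls , p , k) with t' ∈? ls
            ... | no m = hx (ls , p , λ l → proj₁ (k l) , λ { refl → m l })
            ... | yes m with to-end p m
            ...   | (ms , r , o) with avoid₂ (reverse⁺ r) (λ l → proj₁ (k (o (rv⁻ ms l)))) (sw₁ (sw₂ (sw₁ n))) Ft (λ l → proj₂ (k (o (rv⁻ ms l))) refl) lf'
            ...     | inj₁ a = direct (rev (within-mono (λ { (l , ne) → k (o (rv⁻ ms l)) , ne }) a))
            ...     | inj₂ a = aside (rev (within-mono (λ { (l , ne) → k (o (rv⁻ ms l)) , ne }) a))

-- Positions and first consequences of the condition `J`.

module Positions {V : Set} (_≟_ : DecidableEquality V) (H : HG V) (B : Base V) where
  open import Data.List.Membership.Propositional using (_∈_; _∉_)
  open HG H
  open Base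
  open Paths _≟_ H public

  -- y lies on every snake and every tadpole at z: the condition J₁ on the position (H , B).
  Int : V → V → Set
  Int z y = y ≢ z × ¬ Within (pr B) (_≢ y) z × ¬ LassoW z (_≢ y)

  J : Set
  J = ∀ z → ¬¬ (Σ V λ y → Int z y)

  last-edge : ∀ {g σ x} → Reach (pt g) σ x → (g ≡ x × (∀ {u} → u ∈ σ → u ≡ x)) ⊎
    (Σ V λ t → Σ V λ w → Σ (List V) λ σ' → Reach (pt g) σ' t × T t w x × w ∉ σ' × x ∉ σ' × (∀ {u} → u ∈ σ → u ≡ x ⊎ u ≡ w ⊎ u ∈ σ') × Inside σ' (_∈ σ) × w ∈ σ)
  last-edge (stop refl) = inj₁ (refl , λ { (here e) → e })
  last-edge (go {e = just t} (via r) n w∉ v∉) = inj₂ (t , _ , _ , r , n , w∉ , v∉ ,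
    (λ { (here e) → inj₁ e ; (there (here e)) → inj₂ (inj₁ e) ; (there (there m)) → inj₂ (inj₂ m) }) , (λ m → there (there m)) , there (here refl))

  -- w and x are the two last vertices of a path from B.
  Adj : V → V → Set
  Adj x w = Σ (List V) λ α → Σ (Maybe V) λ e → Arm (pr B) α e × Nx (pr B) e w x × w ∉ α × x ∉ α

  module _ (j : J) where
    -- The pair is itself a path to `u` whose only other vertex is `w`, so the vertex that `J` gives
    -- for `u` can only be `w`.
    int-base : ∀ {w u} → R B w u → Int u w
    int-base {w} {u} b = irrR B b ,
      (λ p → j u λ { (y , ne , h , _) → h (within-mono (λ k e → k (trans e (sym (is y ne h)))) p) }) ,
      (λ p → j u λ { (y , ne , h , l) → l (lasso-mono (λ k e → k (trans e (sym (is y ne h)))) p) })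
      where
        is : ∀ y → y ≢ u → ¬ Within (pr B) (_≢ y) u → w ≡ y
        is y ne h with w ≟ y
        ... | yes e = e
        ... | no n = ⊥-elim (h (_ , go none b (λ ()) (λ ()) , λ { (here refl) → ≢-sym ne ; (there (here refl)) → n }))

    -- Dropping `w` from the first pair of the tail leaves a tadpole at `u` that misses `w`, against
    -- `int-base`.
    no-base-lasso : ∀ {X} → ¬ FLassoW (pr B) X
    no-base-lasso (flasso t i cy) with uncons t
    ... | opened f q w∉ w∈ ρ⊆ _ = proj₂ (proj₂ (int-base f))
          (lasso-mono (λ { (inj₁ k) refl → w∉ k ; (inj₂ (_ , n)) refl → n w∈ }) (lassoFrom (toWithin q) cy λ a b → proj₂ b (ρ⊆ a)))

  Off : V → V → Pred
  Off x s u = u ≢ s × u ≢ x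

  -- The condition Int for z after Maker has marked x, turning the edges at x into pairs, and Breaker has deleted s.
  Good : V → V → V → Set
  Good x s z = Σ V λ c → c ≢ z × Hits (pr B) (Off x s) z c × Hits (pr (Tb x)) (Off x s) z c × ¬ LassoW z (Off x s ∖ c)

-- The reply of Breaker to a marked vertex.

module Rounds {V : Set} (_≟_ : DecidableEquality V) (H : HG V) (B : Base V) where
  open import Data.List.Membership.Propositional using (_∈_; _∉_)
  open HG H
  open Base
  open Positions _≟_ H B

  -- y is a candidate for the reply to x beyond s, as seen from B.
  Restart : V → V → V → Set
  Restart x s y = Int x y × Within (pr B) (_≢ y) s × ¬ Within (pr B) (_≢ s) y

  -- The second alternative keeps what the argument uses of a farthest `s`: no admissible vertex is
  -- adjacent to `x`, and none lies behind `s` as seen from `B`.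
  Mode : V → V → Set
  Mode x s = Adj x s ⊎ ((∀ w → Int x w → ¬ Adj x w) × (∀ y → ¬ Restart x s y))

  module Reply (j : J) (x s : V) (ix : Int x s) where
    s≢x : s ≢ x
    s≢x = proj₁ ix

    Ok : Pred
    Ok = Off x s

    Near : V → Set
    Near = Within (pr B) (_≢ s)

    x-far : ¬ Near x
    x-far = proj₁ (proj₂ ix)

    x-free : ¬ LassoW x (_≢ s)
    x-free = proj₂ (proj₂ ix)

    unok : ∀ {u} → Ok u ⊎ u ≡ x → u ≢ s
    unok (inj₁ k) = proj₁ k
    unok (inj₂ refl) = ≢-sym s≢x

    near-ok : ∀ {u} → Near u → Within (pr B) Ok u
    near-ok (ps , p , i) = ps , p , λ m → i m , λ { refl → x-far (within-mono i (reach-any p m)) }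

    arm-near : ∀ {μ e} → Arm (pr B) μ e → s ∉ μ → ∀ {u} → u ∈ μ → Near u
    arm-near a n m = within-mono (λ k → λ { refl → n k }) (arm-any a m)

    no-meet-x : ¬ Meet (pr B) (pr (Tb x)) Ok
    no-meet-x (meet r r' o i k) = x-far (within-mono
      (λ { (inj₁ m) → proj₁ (i m) ; (inj₂ (inj₁ refl)) → ≢-sym s≢x ; (inj₂ (inj₂ m)) → proj₁ (k m) })
      (join (toWithin r) (rev (lift r' (λ m → proj₂ (k m) refl))) λ { a (inj₁ refl) → ⊥-elim (proj₂ (i a) refl) ; a (inj₂ b) → o a b }))

    -- A path joining `B` to the edges at `x` would reach `x` without `s`. So these are two separate
    -- bases, and the vertex of `J` for `z` can be exchanged for one that serves both.
    good-near : ∀ {z} → Near z → ¬¬ Good x s z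
    good-near {z} n = j z >>= λ { (y , ne , h , l) →
      common₂ no-meet-x (no-base-lasso j) (near-ok n) ne (h ∘ within-mono proj₂) (l ∘ lasso-mono proj₂) }

    -- With neither base paths nor tadpoles left at `z`, only paths from `x` count, and `x` has no
    -- tadpole avoiding `s`.
    good-tree : ∀ {z} → z ≢ x → ¬ Near z → ¬ LassoW z Ok → ¬¬ Good x s z
    good-tree {z} ne n l = common {x} {z} {Ok} (≢-sym ne) (λ k → proj₂ k refl) (x-free ∘ lasso-mono unok) >>= λ { (c , a , b) →
      pure (c , a , n ∘ within-mono (proj₁ ∘ proj₁) , b , l ∘ lasso-mono proj₁) }

    -- A base path avoiding `s` that meets the path from `x` can be led to `x` or, through a Y, to
    -- `d`; neither is near.
    far-path : ∀ {ws d u} → Reach (pt x) ws d → Inside ws (_≢ s) → ¬ Near d → u ∈ ws → ¬ Near u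
    far-path w i nd m (ps , p , k) with contact p w (λ ()) (_ , end∈ p , m)
    ... | inj₁ q = x-far (within-mono [ k , i ]′ (meet-pt q))
    ... | inj₂ y = nd (within-mono [ k , i ]′ (y-left y))

    far-lasso : ∀ {z u} (L : LassoW z (_≢ s)) → ¬ Near z → u ∈ lassoV L → ¬ Near u
    far-lasso L nz m (ps , p , k) with enter-lasso p L (λ ()) (_ , end∈ p , m)
    ... | inj₁ q = nz (within-mono [ k , id ]′ q)
    ... | inj₂ q = no-base-lasso j q

    -- A base path ending in the edge of `s` and `x` is continued by the path from `x` to `z`. Its
    -- part before `s` is near and `y` is not, so the whole path misses `y`.
    adj-clash : ∀ {z y} → ¬ Near z → Int z y → ¬ Near y → y ≢ s → y ≢ x → Adj x s → ¬ Within (pr (Tb x)) (Ok ∖ y) z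
    adj-clash {z} {y} nz (_ , h , _) ny y≢s y≢x (α , e , a , n , s∉ , x∉) (xs , r , i) with lift r (λ m → proj₂ (proj₁ (i m)) refl)
    ... | ws , w , k = h (within-mono
            (λ { (inj₁ (inj₁ refl)) → ≢-sym y≢x ; (inj₁ (inj₂ (inj₁ refl))) → ≢-sym y≢s ; (inj₁ (inj₂ (inj₂ m))) refl → ny (arm-near a s∉ m)
               ; (inj₂ m) → [ (λ { refl → ≢-sym y≢x }) , (λ l → proj₂ (i l)) ]′ (k m) })
            (join (exit a n s∉ x∉) (toWithin w)
              λ { (inj₁ e₁) _ → e₁ ; (inj₂ (inj₁ refl)) m → ⊥-elim (ws≢s m refl)
                ; (inj₂ (inj₂ m)) l → ⊥-elim (far-path w ws≢s nz l (arm-near a s∉ m)) }))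
      where
        ws≢s : Inside ws (_≢ s)
        ws≢s m = [ (λ { refl → ≢-sym s≢x }) , (λ l → proj₁ (proj₁ (i l))) ]′ (k m)

    module Free (noAdj : ∀ w → Int x w → ¬ Adj x w) where

      -- Otherwise `w` would be an admissible vertex adjacent to `x`. Indeed a tadpole at `x`
      -- missing `w` contains `s`, so the path through `s` enters it and reaches `x` without `w`, or
      -- hangs a tadpole on the base.
      avoid-last : ∀ {zs t w} → Reach (pr B) zs t → T t w x → w ∉ zs → x ∉ zs → s ∈ zs → ¬¬ Within (pr B) (_≢ w) x
      avoid-last {zs} {t} {w} r n w∉ x∉ s∈ k = em λ
        { (no l) → noAdj w (irr₂ n , k , l) (zs , just t , via r , n , w∉ , x∉)
        ; (yes L) → case (enter-lasso r L (λ ()) (s , s∈ , lasso∋ L (x-free ∘ lasso-mono proj₂))) }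
        where
          case : Within (pr B) ((_∈ zs) ∪ (_≢ w)) x ⊎ FLassoW (pr B) ((_∈ zs) ∪ (_≢ w)) → ⊥
          case (inj₁ q) = k (within-mono [ (λ m → λ { refl → w∉ m }) , id ]′ q)
          case (inj₂ q) = no-base-lasso j q

      module Single (v₀ w₀ : V) where
        module S = Split₂ x v₀ w₀

        Rests : V → Set
        Rests = Within (pr S.Rest) Ok

        one∋pair : ∀ {a b X u} → R S.One a b → Within (pr S.One) X u → X a × X b
        one∋pair (_ , inj₁ (refl , refl)) q = S.one∋ q
        one∋pair (_ , inj₂ (refl , refl)) q = proj₂ (S.one∋ q) , proj₁ (S.one∋ q)

        -- Carries a block from `a` over to `x`: a base path to `x` missing `y` either continues
        -- along `W` to `a`, or comes through `s` into a pair of `W` facing `x`, which `Core`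
        -- excludes. It is applied to `z` and later to the exits of a path from `x` towards `b`.
        module Blocked {a y : V} {ws : List V} (W : Reach (pt a) ws x) (ws≢s : Inside ws (_≢ s)) (y∉ws : y ∉ ws) (y≢s : y ≢ s)
                 (a-hit : ¬ Within (pr B) (_≢ y) a) (far-W : ∀ {u} → u ∈ ws → ¬ Near u) (far-y : ¬ Near y)
                 (rest-W : ∀ {u} → Rests u → u ∉ ws) (rest-y : ¬ Rests y) where

          x∈ws : x ∈ ws
          x∈ws = end∈ W

          back : ∀ {X} → Within (pr B) X x → (∀ {u} → X u → u ∈ ws → u ≡ x) → (∀ {u} → X u → u ≢ y) → ⊥
          back q d f = a-hit (within-mono [ f , (λ m → λ { refl → y∉ws m }) ]′ (join q (rev (toWithin W)) d))

          -- Read backwards from `x`, the path cannot begin with the single edge, which contains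
          -- `w`; so `u` is reached through the other edges at `x`.
          off : ∀ {e ξ u w} → Reach (pt e) ξ x → Inside ξ (λ k → k ≢ w × k ≢ s) → (∀ {X k} → Within (pr S.One) X k → X w) →
                u ∈ ξ → u ≢ x → u ∉ ws × u ≢ y
          off r i p m ne with chooseW S.decide (dropW (rev (to-end r m)) ne)
          ... | inj₁ q = ⊥-elim (proj₁ (i (proj₁ (p q))) refl)
          ... | inj₂ q = rest-W q' , λ { refl → rest-y q' }
            where q' = within-mono (λ { (k , n) → proj₂ (i k) , n }) q

          -- The configuration to be excluded: a base path to `s`, followed by an edge that shares
          -- with an edge of `W` the pair of `g` and `g'`, from which `W` leads on to `x`.
          module Core {β g g' k σ} (rβ : Reach (pr B) β s) (sg : T s g' g) (kg : T k g' g) (k∈ : k ∈ ws) (stalk : Reach (pt g) σ x)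
                      (σ⊆ : Inside σ (_∈ ws)) (g'∈ : g' ∈ ws) (β#σ : Apart β σ) (g'∉β : g' ∉ β) (g'∉σ : g' ∉ σ) where
            g'≢x : g' ≢ x
            g'≢x refl = g'∉σ (end∈ stalk)

            ok : ∀ {u} → u ∈ ws → u ≢ x → Ok u
            ok m ne = ws≢s m , ne

            -- `w` belongs to the only edge at `x` that `W` can use, and `p1` is a base path to `x`
            -- that does without it. As `x` is not near, `p1` passes `s`, and the way it does so
            -- decides.
            module Last {w : V} (p∋w : ∀ {X u} → Within (pr S.One) X u → X w) (p1 : Within (pr B) (_≢ w) x)
                        (w-g' : g ≡ x → g' ≡ w) (σ-case : ∀ {u} → u ∈ σ → u ≢ x → u ≢ w → Within (pt g) ((_∈ σ) ∖ x) u) where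

              -- Here `p1` leaves `s` by a further edge, that of `τ` and `f`. Now two edges at `s`
              -- lead towards `x`, which closes a cycle at `s`; with the base path to `s` as tail
              -- this is a forbidden tadpole.
              module Second {μ e τ₁ τ f ξ} (arm : Arm (pr B) μ e) (n₁ : Nx (pr B) e τ₁ s) (τ₁∉ : τ₁ ∉ μ) (s∉ : s ∉ μ)
                            (sf : T s τ f) (rξ : Reach (pt f) ξ x) (τ∉ξ : τ ∉ ξ) (ξ≢ : Inside ξ (λ k → k ≢ w × k ≢ s)) (τ≢w : τ ≢ w)
                            (apart : Apart (s ∷ τ₁ ∷ μ) (τ ∷ ξ)) where
                tl : List V
                tl = s ∷ τ₁ ∷ μ
                tl-ws : Apart tl ws
                tl-ws (here refl) m = ws≢s m refl
                tl-ws (there (there k)) m = far-W m (arm-near arm s∉ k)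
                tl-ws (there (here refl)) m = a-hit (within-mono
                    (λ { (inj₁ (inj₁ refl)) → λ { refl → y∉ws m } ; (inj₁ (inj₂ (inj₁ refl))) → ≢-sym y≢s ; (inj₁ (inj₂ (inj₂ k))) → (λ { refl → far-y (arm-near arm s∉ k) })
                       ; (inj₂ k) → λ { refl → y∉ws k } })
                    (join (exit arm (nx-sym (pr B) e n₁) s∉ τ₁∉) (rev (reach-any W m))
                      λ { (inj₁ q) _ → q ; (inj₂ (inj₁ refl)) k → ⊥-elim (ws≢s k refl) ; (inj₂ (inj₂ k)) l → ⊥-elim (far-W l (arm-near arm s∉ k)) }))
                ξ-off : ∀ {u} → u ∈ ξ → u ≢ x → u ∉ ws
                ξ-off m ne = proj₁ (off rξ ξ≢ p∋w m ne)
                f∈ : f ∈ ξ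
                f∈ = start∈ rξ
                close : ∀ {X v w} → Within (pr (Tb s)) X v → T s v w → ¬ X w → (∀ {u} → X u → u ∉ tl) → w ∉ tl → ⊥
                close (ls , q , i) t nw d dw = no-base-lasso j {λ _ → ⊤} (flasso (go arm n₁ τ₁∉ s∉) (λ _ → tt) (cyc q t (nw ∘ i) (λ m → tt , d (i m)) (tt , dw)))
                out : Within (pr (Tb s)) (λ u → u ≡ g ⊎ u ≡ g' ⊎ u ∈ []) g
                out = exit none sg (λ ()) (λ ())
                g∉tl : ∀ {u} → u ≡ g ⊎ u ≡ g' ⊎ u ∈ [] → u ∉ tl
                g∉tl (inj₁ refl) m = tl-ws m (σ⊆ (start∈ stalk))
                g∉tl (inj₂ (inj₁ refl)) m = tl-ws m g'∈
                clash : ⊥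
                -- If `τ` is `g'`, the two edges at `s` form a cycle of length two. If `τ` lies on
                -- the stalk, the cycle closes there; otherwise it runs along the stalk to `x` and
                -- back along `ξ`.
                clash with τ ≟ g' | τ ∈? σ
                ... | yes refl | _ = close {v = g'} {w = f} (exit none (sw₂ sg) (λ ()) (λ ())) sf
                      (λ { (inj₁ e₁) → irr₂ sf (sym e₁) ; (inj₂ (inj₁ e₁)) → f≢g e₁ })
                      (λ { (inj₁ refl) m → tl-ws m g'∈ ; (inj₂ (inj₁ refl)) m → tl-ws m (σ⊆ (start∈ stalk)) }) (λ m → apart m (there f∈))
                  where f≢g : f ≢ g
                        f≢g refl with g ≟ x
                        ... | yes e₁ = τ≢w (w-g' e₁)
                        ... | no ne = ξ-off f∈ ne (σ⊆ (start∈ stalk))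
                ... | no ne | no τ∉σ = close {v = f} {w = τ} (join (join out (toWithin stalk) d₁) (rev (toWithin rξ)) d₂) (sw₂ sf)
                      (λ { (inj₁ (inj₁ (inj₁ refl))) → τ∉σ (start∈ stalk) ; (inj₁ (inj₁ (inj₂ (inj₁ e₁)))) → ne e₁ ; (inj₁ (inj₂ m)) → τ∉σ m ; (inj₂ m) → τ∉ξ m })
                      (λ { (inj₁ (inj₁ m)) → g∉tl m ; (inj₁ (inj₂ m)) l → tl-ws l (σ⊆ m) ; (inj₂ m) l → apart l (there m) }) (λ m → apart m (here refl))
                  where
                    d₁ : ∀ {u} → u ≡ g ⊎ u ≡ g' ⊎ u ∈ [] → u ∈ σ → u ≡ g
                    d₁ (inj₁ e₁) _ = e₁
                    d₁ (inj₂ (inj₁ refl)) m = ⊥-elim (g'∉σ m)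
                    onW : ∀ {u} → (u ≡ g ⊎ u ≡ g' ⊎ u ∈ []) ⊎ u ∈ σ → u ∈ ws
                    onW (inj₁ (inj₁ refl)) = σ⊆ (start∈ stalk)
                    onW (inj₁ (inj₂ (inj₁ refl))) = g'∈
                    onW (inj₂ m) = σ⊆ m
                    d₂ : ∀ {u} → (u ≡ g ⊎ u ≡ g' ⊎ u ∈ []) ⊎ u ∈ σ → u ∈ ξ → u ≡ x
                    d₂ {u} p m with u ≟ x
                    ... | yes e₁ = e₁
                    ... | no n = ⊥-elim (ξ-off m n (onW p))
                ... | no ne | yes τ∈σ = close {v = τ} {w = f} (join out (σ-case τ∈σ (λ { refl → τ∉ξ (end∈ rξ) }) τ≢w) d₁) sf
                      (λ { (inj₁ (inj₁ refl)) → f-off x-f (σ⊆ (start∈ stalk)) ; (inj₁ (inj₂ (inj₁ refl))) → f-off g'≢x g'∈ ; (inj₂ (m , n)) → f-off n (σ⊆ m) })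
                      (λ { (inj₁ m) → g∉tl m ; (inj₂ m) l → tl-ws l (σ⊆ (proj₁ m)) }) (λ m → apart m (there f∈))
                  where
                    d₁ : ∀ {u} → u ≡ g ⊎ u ≡ g' ⊎ u ∈ [] → ((_∈ σ) ∖ x) u → u ≡ g
                    d₁ (inj₁ e₁) _ = e₁
                    d₁ (inj₂ (inj₁ refl)) m = ⊥-elim (g'∉σ (proj₁ m))
                    f-off : f ≢ x → f ∉ ws
                    f-off n m = ξ-off f∈ n m
                    x-f : g ≢ x
                    x-f refl = proj₂ (proj₂ (proj₂ (σ-case τ∈σ (λ { refl → τ∉ξ (end∈ rξ) }) τ≢w)) (start∈ (proj₁ (proj₂ (σ-case τ∈σ (λ { refl → τ∉ξ (end∈ rξ) }) τ≢w))))) refl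

              -- When `p1` has `s` only as a sibling, it meets `W` in `x` alone and misses `y`, so
              -- continuing along `W` reaches `a` without `y`.
              first-kind : ∀ {μ e f ξ} → Arm (pr B) μ e → Nx (pr B) e s f → s ∉ μ → Reach (pt f) ξ x → Inside ξ (λ k → k ≢ w × k ≢ s) → Apart μ ξ → ⊥
              first-kind {μ} {e} {f} {ξ} arm n s∉ rξ ξ≢ d = back (join (exit arm n s∉ (λ m → d m (start∈ rξ))) (toWithin rξ)
                  λ { (inj₁ q) _ → q ; (inj₂ (inj₁ refl)) m → ⊥-elim (proj₂ (ξ≢ m) refl) ; (inj₂ (inj₂ m)) l → ⊥-elim (d m l) })
                (λ { (inj₁ (inj₁ refl)) m → onξ (start∈ rξ) m ; (inj₁ (inj₂ (inj₁ refl))) m → ⊥-elim (ws≢s m refl)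
                   ; (inj₁ (inj₂ (inj₂ k))) m → ⊥-elim (far-W m (arm-near arm s∉ k)) ; (inj₂ k) m → onξ k m })
                (λ { (inj₁ (inj₁ refl)) → ξ-y (start∈ rξ) ; (inj₁ (inj₂ (inj₁ refl))) → ≢-sym y≢s
                   ; (inj₁ (inj₂ (inj₂ k))) → (λ { refl → far-y (arm-near arm s∉ k) }) ; (inj₂ k) → ξ-y k })
                where
                  onξ : ∀ {u} → u ∈ ξ → u ∈ ws → u ≡ x
                  onξ {u} m l with u ≟ x
                  ... | yes q = q
                  ... | no ne = ⊥-elim (proj₁ (off rξ ξ≢ p∋w m ne) l)
                  ξ-y : ∀ {u} → u ∈ ξ → u ≢ y
                  ξ-y {u} m with u ≟ x
                  ... | yes refl = λ { refl → y∉ws x∈ws }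
                  ... | no ne = proj₂ (off rξ ξ≢ p∋w m ne)

              last : ⊥
              last = from p1
               where
               from : Within (pr B) (_≢ w) x → ⊥
               from (_ , go none n w∉ v∉ , i) = noAdj _ (int-base j n) ([] , nothing , none , n , (λ ()) , (λ ()))
               from (_ , P@(go {zs} {_} {w₁} (via {t = t₁} r) n w∉ v∉) , i) = at-s s∈
                where
                  s∈ : s ∈ (x ∷ w₁ ∷ zs)
                  s∈ with s ∈? (x ∷ w₁ ∷ zs)
                  ... | yes m = m
                  ... | no m = ⊥-elim (x-far (_ , P , λ k → λ { refl → m k }))
                  at-s : s ∈ (x ∷ w₁ ∷ zs) → ⊥
                  at-s (here e) = s≢x e
                  at-s (there (here refl)) = noAdj s ix (zs , just t₁ , via r , n , w∉ , v∉)
                  at-s (there (there m)) with locate r m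
                  ... | inj₂ (sibling arm nx rest α#ρ b∉α b∉ρ α⊆ ρ⊆ cover) =
                        first-kind arm nx b∉α (go (via rest) n (w∉ ∘ ρ⊆) (v∉ ∘ ρ⊆))
                          (λ { (here refl) → i (here refl) , ≢-sym s≢x ; (there (here refl)) → i (there (here refl)) , (λ { refl → w∉ m })
                             ; (there (there k)) → i (there (there (ρ⊆ k))) , λ { refl → b∉ρ k } })
                          λ { k (here refl) → v∉ (α⊆ k) ; k (there (here refl)) → w∉ (α⊆ k) ; k (there (there l)) → α#ρ k l }
                  ... | inj₁ (exitAt {α} {ρ} upto rest only α⊆ ρ⊆) = second upto (λ k → α⊆ k) only
                    where
                      full : Reach (pt s) (x ∷ w₁ ∷ ρ) x
                      full = go (via rest) n (w∉ ∘ ρ⊆) (v∉ ∘ ρ⊆)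
                      fullW = drop-start full (≢-sym s≢x)
                      in-full : ∀ {k} → k ∈ (x ∷ w₁ ∷ ρ) → k ≢ w
                      in-full (here refl) = i (here refl)
                      in-full (there (here refl)) = i (there (here refl))
                      in-full (there (there k)) = i (there (there (ρ⊆ k)))
                      second : ∀ {α} → Reach (pr B) α s → Inside α (_∈ zs) → (∀ {u} → u ∈ α → u ∈ ρ → u ≡ s) → ⊥
                      second (go arm n₁ τ₁∉ s∉) α⊆ o with uncons (proj₁ (proj₂ fullW))
                      ... | opened f q τ∉ τ∈ ξ⊆ _ = Second.clash arm n₁ τ₁∉ s∉ f q τ∉
                              (λ m → in-full (proj₁ (proj₂ (proj₂ fullW) (ξ⊆ m))) , proj₂ (proj₂ (proj₂ fullW) (ξ⊆ m))) (in-full (proj₁ (proj₂ (proj₂ fullW) τ∈)))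
                              (λ { k (here refl) → ap k (proj₂ (proj₂ fullW) τ∈) ; k (there l) → ap k (proj₂ (proj₂ fullW) (ξ⊆ l)) })
                        where
                          ap : ∀ {u} → u ∈ _ → ((_∈ (x ∷ w₁ ∷ ρ)) ∖ s) u → ⊥
                          ap k (here refl , _) = v∉ (α⊆ k)
                          ap k (there (here refl) , _) = w∉ (α⊆ k)
                          ap k (there (there l) , ne) = ne (o k l)

            pick : ∀ {a b} → T x a b → a ∈ ws → b ∈ ws → a ≢ x → b ≢ x → R S.One a b
            pick t m m' n n' with S.decide t
            ... | inj₁ o = o
            ... | inj₂ q = ⊥-elim (rest-W (_ , go none q (λ ()) (λ ()) , λ { (here refl) → ok m' n' ; (there (here refl)) → ok m n }) m')

            core : ⊥
            core with last-edge stalk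
            ... | inj₁ (refl , triv) = avoid-last rβ sg g'∉β (λ m → β#σ m (end∈ stalk)) (end∈ rβ) λ p1 →
                  Last.last (λ q → proj₂ (one∋pair (pick (sw₁ (sw₂ kg)) k∈ g'∈ (irr₃ kg) g'≢x) q)) p1 (λ _ → refl)
                    (λ m ne _ → ⊥-elim (ne (triv m)))
            ... | inj₂ (t , w , σ' , r , n , w∉ , x∉ , cov , sub , w∈) =
                  avoid-last (proj₁ (proj₂ zs)) n (λ m → w∉zs (proj₂ (proj₂ zs) m)) (λ m → x∉zs (proj₂ (proj₂ zs) m)) (s∈zs (proj₁ zs) (proj₁ (proj₂ zs))) λ p1 →
                  Last.last (λ q → proj₂ (one∋pair (pick (sw₁ (sw₂ n)) (σ⊆ (sub (end∈ r))) (σ⊆ w∈) (irr₃ n) (irr₂ n)) q)) p1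
                    (λ { refl → ⊥-elim (x∉ (start∈ r)) })
                    (λ m ne nw → [ (λ e → ⊥-elim (ne e)) , [ (λ e → ⊥-elim (nw e)) , (λ k → within-mono (λ l → sub l , λ { refl → x∉ l }) (reach-any r k)) ]′ ]′ (cov m))
              where
                zs = join (exit (via rβ) sg g'∉β (λ m → β#σ m (start∈ stalk))) (toWithin r)
                       λ { (inj₁ e) _ → e ; (inj₂ (inj₁ refl)) m → ⊥-elim (g'∉σ (sub m)) ; (inj₂ (inj₂ k)) m → ⊥-elim (β#σ k (sub m)) }
                w∉zs : ¬ ((w ≡ g ⊎ w ≡ g' ⊎ w ∈ β) ⊎ w ∈ σ')
                w∉zs (inj₁ (inj₁ refl)) = w∉ (start∈ r)
                w∉zs (inj₁ (inj₂ (inj₁ refl))) = g'∉σ w∈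
                w∉zs (inj₁ (inj₂ (inj₂ k))) = β#σ k w∈
                w∉zs (inj₂ k) = w∉ k
                x∉zs : ¬ ((x ≡ g ⊎ x ≡ g' ⊎ x ∈ β) ⊎ x ∈ σ')
                x∉zs (inj₁ (inj₁ refl)) = x∉ (start∈ r)
                x∉zs (inj₁ (inj₂ (inj₁ refl))) = g'≢x refl
                x∉zs (inj₁ (inj₂ (inj₂ k))) = β#σ k (end∈ stalk)
                x∉zs (inj₂ k) = x∉ k
                s∈zs : ∀ ls → Reach (pr B) ls t → s ∈ ls
                s∈zs ls q with s ∈? ls
                ... | yes m = m
                ... | no m = ⊥-elim (far-W (σ⊆ (sub (end∈ r))) (ls , q , λ k → λ { refl → m k }))

          no-path : ¬ Within (pr B) (_≢ y) x
          no-path (ps , P , ip) with contact⁺ P W (λ ()) (x , end∈ P , x∈ws)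
          ... | inj₁ m = a-hit (within-mono [ ip , (λ k → λ { refl → y∉ws k }) ]′ (meet-pt m))
          ... | inj₂ (yshape none arm' nx nx' stalk α#β α#σ β#σ g'∉α g'∉β g'∉σ α⊆ β⊆ σ⊆ _ , β⊆W , σ⊆W , g'∈) =
                far-W (σ⊆W (start∈ stalk)) (_ , go none nx (λ ()) (λ ()) , λ { (here refl) → ws≢s (σ⊆W (start∈ stalk)) ; (there (here refl)) → ws≢s g'∈ })
          ... | inj₂ (yshape {α} {e = just e} {g = g} {g'} (via rβ) (via q) nx nx' stalk α#β α#σ β#σ g'∉α g'∉β g'∉σ α⊆ β⊆ σ⊆ _ , β⊆W , σ⊆W , g'∈) with s ∈? α | e ≟ s
          ...   | no m | _ = far-W (σ⊆W (start∈ stalk)) (within-mono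
                    (λ { (inj₁ refl) → ws≢s (σ⊆W (start∈ stalk)) ; (inj₂ (inj₁ refl)) → ws≢s g'∈ ; (inj₂ (inj₂ k)) → λ { refl → m k } })
                    (exit (via rβ) nx g'∉α (λ m → α#σ m (start∈ stalk))))
          -- The arm passes `s` but does not end there, so both edges of the Y with the stalk are a
          -- tadpole at `x` missing `s`.
          ...   | yes _ | no ne = x-free (lasso stalk (ws≢s ∘ σ⊆W) (cyc-mono
                    (λ { (inj₁ refl) → ws≢s g'∈ , g'∉σ ; (inj₂ (inj₁ refl)) → ne , α#σ (end∈ rβ) ; (inj₂ (inj₂ refl)) → ws≢s (β⊆W (end∈ q)) , β#σ (end∈ q) })
                    (pinch nx nx' λ { refl → α#β (end∈ rβ) (end∈ q) })))
          ...   | yes _ | yes refl = Core.core rβ nx nx' (β⊆W (end∈ q)) stalk σ⊆W g'∈ α#σ g'∉α g'∉σ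

        -- The critical case: `z` is cut off by `s`, carries a tadpole, and is reached through
        -- exactly one edge at `x`, by a path missing the vertex `b` that `J` gave. A substitute for
        -- `b` has to hit the paths from `x` and the tadpoles at `z`.
        module Endgame (nr : ∀ y → Int x y → Within (pr B) (_≢ y) s → ¬ Within (pr B) (_≢ s) y → ⊥)
                       (reached : Within (pr B) (λ _ → ⊤) x) {z b : V} (z≢x : z ≢ x) (nz : ¬ Near z) (L₀ : LassoW z Ok) (ib : Int z b)
                       (X₀ : Within (pr S.One) (Ok ∖ b) z) (ng : ¬ Rests z) where

          x∉Ok : ¬ Ok x
          x∉Ok k = proj₂ k refl

          ok-free : ¬ LassoW x (λ u → Ok u ⊎ u ≡ x)
          ok-free = x-free ∘ lasso-mono unok

          b∈L₀ : b ∈ lassoV L₀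
          b∈L₀ = lasso∋ L₀ (proj₂ (proj₂ ib) ∘ lasso-mono proj₂)

          b-ok : Ok b
          b-ok = lassoV⊆ L₀ b∈L₀

          b≢z : b ≢ z
          b≢z = proj₁ ib

          L-s : LassoW z (_≢ s)
          L-s = lasso-mono proj₁ L₀

          far-b : ¬ Near b
          far-b = far-lasso L-s nz b∈L₀

          rest-lasso : ∀ {u} → Rests u → u ∉ lassoV L₀
          rest-lasso (ps , p , i) m with enter-lasso p L₀ (λ ()) (_ , end∈ p , m)
          ... | inj₁ q = ng (within-mono [ i , id ]′ q)
          ... | inj₂ q = ok-free (flasso-base S.rest⊑ (flasso-mono [ i , id ]′ q) x∉Ok)

          rest-one : ∀ {ds d u} → Reach (pr S.One) ds d → Inside ds Ok → ¬ Rests d → u ∈ ds → ¬ Rests u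
          rest-one r i nd m (ps , p , k) with contact p r (λ ()) (_ , end∈ p , m)
          ... | inj₁ q = no-meet {x} {z} (≢-sym z≢x) x∉Ok ok-free S.rest⊑ S.one⊑ (meet-mono [ k , i ]′ q)
          ... | inj₂ y = nd (within-mono [ k , i ]′ (y-left y))

          rest-ok : ∀ {u} → Rests u → u ≢ x
          rest-ok (ps , p , k) = proj₂ (k (end∈ p))

          all-x : ¬ Within (pr B) (_≢ b) x
          all-x = from X₀
           where
           from : Within (pr S.One) (Ok ∖ b) z → ¬ Within (pr B) (_≢ b) x
           from (xs , r , i) with lift (rebase S.one⊑ r) (λ m → proj₂ (proj₁ (i m)) refl)
           ... | ws , w , k = Blocked.no-path (reverse⁺ w) (f ∘ k ∘ rv⁻ ws) (λ m → g (k (rv⁻ ws m))) (proj₁ b-ok) (proj₁ (proj₂ ib))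
                    (λ m → far-path w (f ∘ k) nz (rv⁻ ws m)) far-b
                    (λ q m → [ rest-ok q , (λ l → rest-one r (proj₁ ∘ i) ng l q) ]′ (k (rv⁻ ws m))) (λ q → rest-lasso q b∈L₀)
            where
              f : ∀ {u} → u ≡ x ⊎ u ∈ xs → u ≢ s
              f (inj₁ refl) = ≢-sym s≢x
              f (inj₂ m) = proj₁ (proj₁ (i m))
              g : b ≡ x ⊎ b ∈ xs → ⊥
              g (inj₁ e) = proj₂ b-ok e
              g (inj₂ m) = proj₂ (i m) refl

          -- Otherwise `y` would be a candidate beyond `s`. It is admissible: a tadpole at `x`
          -- missing `y` contains `s`, so a base path to `s` missing `y` would enter it and reach
          -- `x`, or hang a tadpole on the base.
          forced : ∀ {y} → y ≢ x → ¬ Within (pr B) (_≢ y) x → ¬ Near y → ¬ Within (pr B) (_≢ y) s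
          forced {y} ne h ny q@(ps , p , i) = nr y (ne , h , no-l) q ny
            where
              no-l : ¬ LassoW x (_≢ y)
              no-l L with enter-lasso p L (λ ()) (s , end∈ p , lasso∋ L (x-free ∘ lasso-mono proj₂))
              ... | inj₁ k = h (within-mono [ i , id ]′ k)
              ... | inj₂ k = no-base-lasso j k

          all-s : ¬ Within (pr B) (_≢ b) s
          all-s = forced (proj₂ b-ok) all-x far-b

          record Root : Set where
            constructor root
            field
              {μ}  : List V
              {e}  : Maybe V
              arm  : Arm (pr B) μ e
              nx   : Nx (pr B) e s b
              s∉μ  : s ∉ μ
              b∉μ  : b ∉ μ

          -- Base paths to `s` contain `b`, and those to `b` contain `s`. So `split` cannot separate
          -- them: they are the two new vertices of one edge.
          theRoot : Root
          theRoot = from reached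
           where
           from : Within (pr B) (λ _ → ⊤) x → Root
           from (ps , p , _) with s ∈? ps
           ...   | no m = ⊥-elim (x-far (ps , p , λ k → λ { refl → m k }))
           ...   | yes m with reach-any p m
           ...     | ss , q , _ with b ∈? ss
           ...       | no n = ⊥-elim (all-s (ss , q , λ k → λ { refl → n k }))
           ...       | yes n with split q (end∈ q) n (≢-sym (proj₁ b-ok))
           ...         | inj₁ w = ⊥-elim (all-s (within-mono proj₂ w))
           ...         | inj₂ (inj₁ w) = ⊥-elim (far-b (within-mono proj₂ w))
           ...         | inj₂ (inj₂ (facing {e = e} arm nx (inj₁ (refl , refl)) st _ _ _ α#σ g'∉α _ _)) =
                          root arm (nx-sym (pr B) e nx) (λ k → α#σ k (start∈ st)) g'∉α
           ...         | inj₂ (inj₂ (facing arm nx (inj₂ (refl , refl)) st _ _ _ α#σ g'∉α _ _)) =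
                          root arm nx g'∉α (λ k → α#σ k (start∈ st))

          open Root theRoot using (μ; e; arm; nx; s∉μ; b∉μ)

          -- If the tadpole meets `μ`, it can be entered without `s`, making `b` near or giving a
          -- base tadpole. If not, the root edge attaches it to the base.
          b-free : ¬ LassoW b (_≢ s)
          b-free L with meets μ (lassoV L)
          ... | inj₁ (u , m , k) with arm-any arm m
          ...   | ps , p , i with enter-lasso p L (λ ()) (u , end∈ p , k)
          ...     | inj₁ q = far-b (within-mono [ (λ l → λ { refl → s∉μ (i l) }) , id ]′ q)
          ...     | inj₂ q = no-base-lasso j q
          b-free L | inj₂ d = no-base-lasso j (attach (exit arm nx s∉μ b∉μ) L
                        λ { (inj₁ e₁) _ → e₁ ; (inj₂ (inj₁ refl)) m → ⊥-elim (lassoV⊆ L m refl) ; (inj₂ (inj₂ m)) k → ⊥-elim (d m k) })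

          F : Pred
          F u = u ≢ s × u ≢ b

          z-lf : ¬ LassoW z F
          z-lf = proj₂ (proj₂ ib) ∘ lasso-mono proj₂

          x-lf : ¬ LassoW x F
          x-lf = x-free ∘ lasso-mono proj₁

          b-lf : ¬ LassoW b (λ u → F u ⊎ u ≡ b)
          b-lf = b-free ∘ lasso-mono [ proj₁ , (λ { refl → proj₁ b-ok }) ]′

          -- All tadpoles at `z` contain `b`, hence a vertex that hits all paths from `b` to `z`
          -- hits all these tadpoles. This replaces tadpoles by a second base.
          through-b : ∀ {Y} → LassoW z Y → Within (pr (Tb b)) (Y ∖ b) z
          through-b L = dropW (rev (lasso-any L (lasso∋ L (proj₂ (proj₂ ib) ∘ lasso-mono proj₂)))) (≢-sym b≢z)

          -- A path from `x` to `z` must use the single edge. As `X₀` misses `b`, that edge does not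
          -- contain `b`, and what follows `b` on the path starts at `b`.
          after-b : ∀ {ps} → Reach (pr (Tb x)) ps z → Inside ps Ok → b ∈ ps → Within (pr (Tb b)) ((_∈ ps) ∖ b) z
          after-b {ps} p i m with choose {S.One} {S.Rest} {Tb x} S.decide p
          ... | inj₂ q = ⊥-elim (ng (ps , q , i))
          ... | inj₁ q with uncons q
          ...   | opened {w} {u} {ρ} f r w∉ w∈ ρ⊆ cover = dropW (within-mono ρ⊆ (to-end r b∈ρ)) (≢-sym b≢z)
            where
              b≢w : b ≢ w
              b≢w refl = proj₂ (proj₁ (one∋pair f X₀)) refl
              b∈ρ : b ∈ ρ
              b∈ρ = [ (λ e₁ → ⊥-elim (b≢w e₁)) , id ]′ (cover m)

          good-of : ∀ c → c ≢ z → ¬ LassoW z (Ok ∖ c) → (∀ {ps} → Reach (pr (Tb x)) ps z → Inside ps (Ok ∖ c) → b ∈ ps → ⊥) →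
                    ¬ Within (pr (Tb x)) ((Ok ∖ c) ∖ b) z → Good x s z
          good-of c ne l rb xb = c , ne , nz ∘ within-mono (proj₁ ∘ proj₁) , hit , l
            where
              hit : Hits (pr (Tb x)) Ok z c
              hit (ps , p , i) with b ∈? ps
              ... | yes m = rb p i m
              ... | no m = xb (ps , p , λ k → i k , λ { refl → m k })

          -- A path joining the edges at `x` and at `b` would lead from `x` to `b`. So they are
          -- separate bases, and their gate at `z` serves.
          detached : ¬ Within (pt x) (_≢ s) b → ¬¬ Good x s z
          detached nq = GateTheorem.gates (Ok ∖ b) (Tb x) (Tb b) nc z (rebaseW S.one⊑ X₀) (through-b L₀) >>= λ gt → pure (good gt)
            where
              nc : ¬ Meet (pr (Tb x)) (pr (Tb b)) (Ok ∖ b)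
              nc (meet r r' o i k) = nq (within-mono
                (λ { (inj₁ (inj₁ refl)) → ≢-sym s≢x ; (inj₁ (inj₂ m)) → proj₁ (proj₁ (i m)) ; (inj₂ (inj₁ refl)) → proj₁ b-ok ; (inj₂ (inj₂ m)) → proj₁ (proj₁ (k m)) })
                (join (lift r (λ m → proj₂ (proj₁ (i m)) refl)) (rev (lift r' (λ m → proj₂ (k m) refl)))
                  λ { (inj₁ refl) (inj₁ e₁) → ⊥-elim (proj₂ b-ok (sym e₁)) ; (inj₁ refl) (inj₂ m) → ⊥-elim (proj₂ (proj₁ (k m)) refl)
                    ; (inj₂ m) (inj₁ refl) → ⊥-elim (proj₂ (i m) refl) ; (inj₂ m) (inj₂ l) → o m l }))
              good : GateTheorem.GateY (Ok ∖ b) (Tb x) (Tb b) nc z → Good x s z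
              good gt with gate-hits (Ok ∖ b) (Tb x) (Tb b) nc z gt
              ... | ne , hx , hb = good-of _ ne (λ L → hb (within-mono (λ { ((a , c) , d) → (a , d) , c }) (through-b L)))
                    (λ p i m → hb (within-mono (λ { (l , d) → (proj₁ (i l) , d) , proj₂ (i l) }) (after-b p (proj₁ ∘ i) m)))
                    (λ w → hx (within-mono (λ { ((a , c) , d) → (a , d) , c }) w))

          record QData : Set where
            constructor qdata
            field
              {t w} : V
              {qs}  : List V
              spine : Reach (pt x) qs t
              n     : T t w b
              w∉    : w ∉ qs
              b∉    : b ∉ qs
              qs≢s  : Inside qs (_≢ s)
              w≢s   : w ≢ s

          qdata-of : Within (pt x) (_≢ s) b → QData
          qdata-of (ls , q , i) with last-edge q
          ... | inj₁ (e₁ , _) = ⊥-elim (proj₂ b-ok (sym e₁))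
          ... | inj₂ (t , w , qs , r , n , w∉ , b∉ , _ , sub , w∈) = qdata r n w∉ b∉ (i ∘ sub) (i w∈)

          -- Now `x` and `b` are joined by a path ending in the edge of `t`, `w`, `b`, while `c`,
          -- common to the paths from `b` to `z`, is missed by one from `x`. The substitute is
          -- sought among the exits of the path from `x` to `t`, the spine.
          module Attached (c : V) (c≢x : c ≢ x) (hc : Hits (pr (Tb b)) F z c) (X₁ : Within (pr (Tb x)) ((Ok ∖ c) ∖ b) z) (qd : QData) where
            open QData qd
            module SB = Split₂ b t w
            ls : List V
            ls = b ∷ w ∷ qs
            Q : Reach (pt x) ls b
            Q = go (via spine) n w∉ b∉
            ls≢s : Inside ls (_≢ s)
            ls≢s (here refl) = proj₁ b-ok
            ls≢s (there (here refl)) = w≢s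
            ls≢s (there (there m)) = qs≢s m
            qs⊆F : Inside qs F
            qs⊆F m = qs≢s m , λ { refl → b∉ m }
            w-F : F w
            w-F = w≢s , irr₂ n
            far-Q : ∀ {u} → u ∈ ls → ¬ Near u
            far-Q = far-path Q ls≢s far-b

            Qb : Reach (pr SB.One) (rv qs ++ w ∷ []) x
            Qb = consᵇ {SB.One} (sw₂ (sw₁ (sw₂ n)) , inj₂ (refl , refl)) (reverse⁺ spine) (w∉ ∘ rv⁻ qs)
            Qb⊆ : Inside (rv qs ++ w ∷ []) F
            Qb⊆ m with ∈-++⁻ (rv qs) m
            ... | inj₁ k = qs⊆F (rv⁻ qs k)
            ... | inj₂ (here refl) = w-F
            Qb∋ : ∀ {u} → u ∈ (w ∷ qs) → u ∈ (rv qs ++ w ∷ [])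
            Qb∋ (here refl) = ∈-++⁺ʳ (rv qs) (here refl)
            Qb∋ (there m) = ∈-++⁺ˡ (rv⁺ qs m)

            -- A path from `b` by another edge that meets `w` or the spine would close a cycle at
            -- `b`, or form a Y and with it a tadpole at `x`.
            clash : ∀ {u} → Within (pr (Tb b)) (F ∖ t) u → u ∈ (w ∷ qs) → ⊥
            clash p m with chooseW {SB.One} {SB.Rest} {Tb b} SB.decide p
            ... | inj₁ k = proj₂ (proj₁ (SB.one∋ k)) refl
            ... | inj₂ (ps , k , i) with contact k Qb (λ ()) (_ , end∈ k , Qb∋ m)
            ...   | inj₁ q = no-meet {b} {z} {F} b≢z (λ k → proj₂ k refl) b-lf SB.rest⊑ SB.one⊑ (meet-mono [ proj₁ ∘ i , Qb⊆ ]′ q)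
            ...   | inj₂ y = x-free (lasso-mono [ [ proj₁ ∘ proj₁ ∘ i , proj₁ ∘ Qb⊆ ]′ , (λ { refl → proj₁ b-ok }) ]′
                      (y-lasso-base {b} SB.rest⊑ SB.one⊑ (λ p q → SB.disj q p) [ (λ m → proj₂ (proj₁ (i m)) refl) , (λ m → proj₂ (Qb⊆ m) refl) ]′ y))

            -- Otherwise `Q` back to `x` followed by `X₁` yields a path from `b` to `z` missing `c`,
            -- or a tadpole at `x`.
            c∈ : c ∈ (w ∷ qs)
            c∈ with c ∈? (w ∷ qs)
            ... | yes m = m
            ... | no m = ⊥-elim (from X₁)
              where
                from : ¬ Within (pr (Tb x)) ((Ok ∖ c) ∖ b) z
                from (ps , p , i) with merge (rev (toWithin Q)) (rev (lift p (λ m → proj₂ (proj₁ (proj₁ (i m))) refl)))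
                                         [ proj₂ b-ok , (λ k → proj₂ (i k) refl) ]′
                ... | inj₁ q = hc (within-mono (λ { (inj₁ (here refl) , ne) → ⊥-elim (ne refl) ; (inj₁ (there k) , ne) → (ls≢s (there k) , ne) , (λ { refl → m k })
                                    ; (inj₂ (inj₁ refl) , ne) → (≢-sym s≢x , ne) , ≢-sym c≢x ; (inj₂ (inj₂ k) , ne) → (proj₁ (proj₁ (proj₁ (i k))) , ne) , proj₂ (proj₁ (i k)) })
                                  (dropW q (≢-sym b≢z)))
                ... | inj₂ l = x-free (lasso-mono [ ls≢s , [ (λ { refl → ≢-sym s≢x }) , (λ k → proj₁ (proj₁ (proj₁ (i k)))) ]′ ]′ l)

            all-t : ¬ Within (pr (Tb b)) (F ∖ t) z
            all-t (ps , p , i) with c ∈? ps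
            ... | yes m = clash (within-mono i (reach-any p m)) c∈
            ... | no m = hc (ps , p , λ k → proj₁ (i k) , λ { refl → m k })

            all-Q : ¬ Within (pt x) (λ u → u ≢ s × u ≢ t) b
            all-Q p = clash (within-mono (λ { ((a , d) , e₁) → (a , e₁) , d }) (dropW (rev p) (≢-sym (proj₂ b-ok)))) (there (start∈ spine))

            rest-Q : ∀ {u} → u ∈ ls → ¬ Rests u
            rest-Q {u} m q with drop⁺ Q (proj₂ b-ok)
            ... | ds , r , i , cov with choose {S.One} {S.Rest} {Tb x} S.decide r
            ...   | inj₁ o = rest-one o ok (λ k → rest-lasso k b∈L₀) (cov m (rest-ok q)) q
              where ok : Inside ds Ok
                    ok k = ls≢s (proj₁ (i k)) , proj₂ (i k)
            ...   | inj₂ o = rest-lasso (ds , o , λ k → ls≢s (proj₁ (i k)) , proj₂ (i k)) b∈L₀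

            open Walk F x z x-lf z-lf

            -- Suppose `r` carries a tadpole and let `y` be its vertex from `J`. On `μ`, `y` would
            -- let a base path enter the tadpole without `s`. Off both `μ` and `ms`, `y` is missed
            -- by the base path through the root edge and `ms`. On `ms`, `y` blocks `x` and so `s`,
            -- but the root edge reaches `s` without it.
            key : ∀ {qs' r ms} → Reach (pt x) qs' r → Inside qs' (_∈ qs) → Reach (pt b) ms r → Inside ms (_∈ ls) →
                  (∀ {u} → u ∈ qs' → u ∈ ms → u ≡ r) → LF r
            key {qs'} {r} {ms} p p⊆ q q⊆ o L = j r λ { (y , ne , h , l) → pointed y ne h l }
              where
                r∈ : r ∈ ls
                r∈ = q⊆ (end∈ q)
                pointed : ∀ y → y ≢ r → ¬ Within (pr B) (_≢ y) r → ¬ LassoW r (_≢ y) → ⊥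
                pointed y ne h l = cases (y ∈? μ) (y ∈? ms)
                  where
                    y∈L : y ∈ lassoV L
                    y∈L = lasso∋ L (l ∘ lasso-mono proj₂)
                    y-F : F y
                    y-F = lassoV⊆ L y∈L
                    cases : Dec (y ∈ μ) → Dec (y ∈ ms) → ⊥
                    cases (yes m) _ with arm-any arm m
                    ... | ps , a , i with enter-lasso a L (λ ()) (y , end∈ a , y∈L)
                    ...   | inj₁ k = far-Q r∈ (within-mono [ (λ l → λ { refl → s∉μ (i l) }) , proj₁ ]′ k)
                    ...   | inj₂ k = no-base-lasso j k
                    cases (no m) (no m') = h (within-mono
                        (λ { (inj₁ (inj₁ refl)) → ≢-sym (proj₂ y-F) ; (inj₁ (inj₂ (inj₁ refl))) → ≢-sym (proj₁ y-F) ; (inj₁ (inj₂ (inj₂ k))) → (λ { refl → m k }) ; (inj₂ k) → λ { refl → m' k } })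
                        (join (exit arm nx s∉μ b∉μ) (toWithin q)
                          λ { (inj₁ e₁) _ → e₁ ; (inj₂ (inj₁ refl)) k → ⊥-elim (ls≢s (q⊆ k) refl) ; (inj₂ (inj₂ k)) k' → ⊥-elim (far-Q (q⊆ k') (arm-near arm s∉μ k)) }))
                    cases (no m) (yes m') = forced (λ { refl → y∉ (start∈ p) }) nopath (far-Q (q⊆ m'))
                        (within-mono (λ { (inj₁ refl) → ≢-sym (proj₁ y-F) ; (inj₂ (inj₁ refl)) → ≢-sym (proj₂ y-F) ; (inj₂ (inj₂ k)) → λ { refl → m k } })
                          (exit arm (nx-sym (pr B) e nx) b∉μ s∉μ))
                      where
                        y∉ : y ∉ qs'
                        y∉ k = ne (o k m')
                        nopath : ¬ Within (pr B) (_≢ y) x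
                        nopath = Blocked.no-path (reverse⁺ p) (qs≢s ∘ p⊆ ∘ rv⁻ qs') (y∉ ∘ rv⁻ qs') (proj₁ y-F) h
                          (λ k → far-Q (there (there (p⊆ (rv⁻ qs' k))))) (far-Q (q⊆ m')) (λ w k → rest-Q (there (there (p⊆ (rv⁻ qs' k)))) w) (rest-Q (q⊆ m'))

            -- Going down the spine, the path `ms` from `b` grows by each edge passed, so that `key`
            -- applies at every exit.
            keys : ∀ {qs' r ms} (p : Reach (pt x) qs' r) → Inside qs' (_∈ qs) → Reach (pt b) ms r → Inside ms (_∈ ls) →
                   (∀ {u} → u ∈ qs' → u ∈ ms → u ≡ r) → Exits LF p
            keys p@(stop refl) p⊆ q q⊆ o = key p p⊆ q q⊆ o
            keys p@(go {xs} {e = just t'} {w'} {v'} (via r) n' w'∉ v'∉) p⊆ q q⊆ o = key p p⊆ q q⊆ o ,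
              keys r (λ m → p⊆ (there (there m)))
                (go (via q) (sw₁ (sw₂ (sw₁ n'))) (λ m → irr₂ n' (o (there (here refl)) m)) (λ m → v'∉ (subst (_∈ xs) (o (there (there (end∈ r))) m) (end∈ r))))
                (λ { (here refl) → there (there (p⊆ (there (there (end∈ r))))) ; (there (here refl)) → there (there (p⊆ (there (here refl)))) ; (there (there m)) → q⊆ m })
                (λ { m (here e₁) → e₁ ; m (there (here refl)) → ⊥-elim (w'∉ m) ; m (there (there k)) → ⊥-elim (v'∉ (subst (_∈ xs) (o (there (there m)) k) m)) })

            lfs : Exits LF spine
            lfs = keys spine id (go (via (stop refl)) (sw₂ (sw₁ (sw₂ n))) (λ { (here e₁) → irr₂ n e₁ }) (λ { (here e₁) → irr₃ n e₁ }))
                    (λ { (here refl) → there (there (end∈ spine)) ; (there (here refl)) → there (here refl) ; (there (there (here refl))) → here refl })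
                    (λ { m (here e₁) → e₁ ; m (there (here refl)) → ⊥-elim (w∉ m) ; m (there (there (here refl))) → ⊥-elim (b∉ m) })

            lasso-t : ∀ {Y} (L : LassoW z Y) → (∀ {u} → Y u → u ≢ s) → t ∈ lassoV L
            lasso-t L f = lasso∋ L λ L' → all-t (within-mono (λ { ((a , d) , e₁) → (f a , e₁) , d }) (through-b L'))

            lasso-b : ∀ {Y} (L : LassoW z Y) → b ∈ lassoV L
            lasso-b L = lasso∋ L (proj₂ (proj₂ ib) ∘ lasso-mono proj₂)

            module _ {d : V} (on : On t d) (d≢x : d ≢ x)
                     (turn : ∀ {k α σ} → Reach (pt x) α k → T k b t → Reach (pt t) σ z → Apart α σ → Inside α F → Inside σ F → t ∉ α → d ∉ α → d ∉ σ → ⊥) where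
              -- A path through `b` must also contain `t`. Reaching `t` before `b` contradicts `on`,
              -- reaching `b` before `t` contradicts `all-Q`; if they share an edge with exit `b`,
              -- the rest from `b` misses `t`. What remains is exit `t` with sibling `b`, left to
              -- `turn`.
              through : ∀ {ps} → Reach (pr (Tb x)) ps z → Inside ps (Ok ∖ d) → b ∈ ps → ⊥
              through {ps} p i m with t ∈? ps
              ... | no t∉ = all-t (within-mono (λ { (k , ne) → (proj₁ (proj₁ (i k)) , ne) , λ { refl → t∉ k } }) (after-b p (proj₁ ∘ i) m))
              ... | yes t∈ = turning (split (liftᵖ p (λ k → proj₂ (proj₁ (i k)) refl)) (∈-++⁺ˡ t∈) (∈-++⁺ˡ m) (irr₃ n))
                where
                  rs = ps ++ x ∷ []
                  rs-s : ∀ {u} → u ∈ rs → u ≢ s × u ≢ d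
                  rs-s l with ∈-++⁻ ps l
                  ... | inj₁ q = proj₁ (proj₁ (i q)) , proj₂ (i q)
                  ... | inj₂ (here refl) = ≢-sym s≢x , ≢-sym d≢x
                  turning : Split (pt x) (_∈ rs) (length rs) z t b → ⊥
                  turning (inj₁ q) = on (within-mono (λ { (l , ne) → (proj₁ (rs-s l) , ne) , proj₂ (rs-s l) }) q)
                  turning (inj₂ (inj₁ q)) = all-Q (within-mono (λ { (l , ne) → proj₁ (rs-s l) , ne }) q)
                  turning (inj₂ (inj₂ (facing {e = just k} (via q) nx' (inj₁ (refl , refl)) st α⊆ σ⊆ g'∈ α#σ g'∉α g'∉σ _))) =
                    turn q nx' st α#σ (λ l → proj₁ (rs-s (α⊆ l)) , λ { refl → g'∉α l }) (λ l → proj₁ (rs-s (σ⊆ l)) , λ { refl → g'∉σ l })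
                      (λ l → α#σ l (start∈ st)) (λ l → proj₂ (rs-s (α⊆ l)) refl) (λ l → proj₂ (rs-s (σ⊆ l)) refl)
                  turning (inj₂ (inj₂ (facing _ _ (inj₂ (refl , refl)) st α⊆ σ⊆ g'∈ α#σ g'∉α g'∉σ _))) =
                    all-t (within-mono (λ { (l , ne) → (proj₁ (rs-s (σ⊆ l)) , ne) , λ { refl → g'∉σ l } }) (drop-start st (≢-sym b≢z)))

            good-spine : Exits (_≢ z) spine → ¬¬ Good x s z
            good-spine ne = walk spine qs⊆F lfs ne >>= λ { (d , d∈ , d≢z , hx , ht , on) → pure (good d d≢z hx ht on) }
              where
                tz : ∀ {Y} → LassoW z Y → (∀ {u} → Y u → u ≢ s) → Within (pt t) (Y ∖ b) z
                tz L f = rev (lasso-any-avoiding L (lasso-b L) (b-free ∘ lasso-mono f) (lasso-t L f) (irr₃ n))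
                good : ∀ d → d ≢ z → ¬ Within (pt x) (F ∖ d) z → ¬ Within (pt t) (F ∖ d) z → On t d → Good x s z
                good d d≢z hx ht on = good-of d d≢z
                    (λ L → ht (within-mono (λ { ((a , e₁) , e₂) → (proj₁ a , e₂) , e₁ }) (tz L (proj₁ ∘ proj₁))))
                    (through on d≢x (λ _ _ st _ _ σF _ _ d∉ → ht (_ , st , λ l → σF l , λ { refl → d∉ l })))
                    (λ { (ps , p , i) → hx (within-mono (λ { (inj₁ refl) → (≢-sym s≢x , ≢-sym (proj₂ b-ok)) , ≢-sym d≢x
                                                         ; (inj₂ l) → (proj₁ (proj₁ (proj₁ (i l))) , proj₂ (i l)) , proj₂ (proj₁ (i l)) })
                                         (lift p (λ m → proj₂ (proj₁ (proj₁ (i m))) refl))) })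
                  where
                    d≢x : d ≢ x
                    d≢x refl = ht (within-mono (λ { ((a , e₁) , e₂) → (a , e₂) , e₁ }) (tz L₀ proj₁))

            -- If `z` is itself an exit, the exit `r` before it serves. A tadpole at `z` missing `r`
            -- but not `h` gives one missing `b`, through the edge of `r`, `h`, `z`; one missing
            -- both hangs on the spine and gives a tadpole at `x`.
            bad-spine : (∀ (q : QData) → ¬ Exits (_≢ z) (QData.spine q)) → Good x s z
            bad-spine ng' with find-exit z spine (exits-zip spine lfs (on-exits spine qs⊆F lfs))
            ... | inj₁ e₁ = ⊥-elim (ng' qd e₁)
            ... | inj₂ (inj₁ e₁) = ⊥-elim (z≢x e₁)
            ... | inj₂ (inj₂ (ps , r , h , p , rhz , h∉ , z∉ , sub , lf , on)) =
                  good-of r (irr₃ rhz) no-l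
                    -- Such a turn would provide a spine ending before the edge of `k`, `t`, `b`
                    -- without `z` among its exits.
                    (through on r≢x λ {k} q nx' st α#σ αF _ t∉ _ _ → ng' (qdata q (sw₂ nx') t∉ (λ l → proj₂ (αF l) refl) (proj₁ ∘ αF) (qs≢s (end∈ spine)))
                       (exits-in q (λ l → λ { refl → α#σ l (end∈ st) })))
                    (λ { (ps' , p' , i) → hx (within-mono (λ { (inj₁ refl) → (≢-sym s≢x , ≢-sym (proj₂ b-ok)) , ≢-sym r≢x
                                                         ; (inj₂ l) → (proj₁ (proj₁ (proj₁ (i l))) , proj₂ (i l)) , proj₂ (proj₁ (i l)) })
                                         (lift p' (λ m → proj₂ (proj₁ (proj₁ (i m))) refl))) })
              where
                psF : Inside ps F
                psF m = qs⊆F (sub (there m))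
                hF : F h
                hF = qs⊆F (sub (here refl))
                hx : ¬ Within (pt x) (F ∖ r) z
                hx = previous p psF rhz hF (zF , ≢-sym b≢z) h∉ z∉ lf z-lf
                  where zF : z ≢ s
                        zF refl = proj₁ (lassoV⊆ L₀ (lasso-tip L₀)) refl
                no-l : ¬ LassoW z (Ok ∖ r)
                no-l L = em λ
                  { (yes L') → avoiding L'
                  ; (no n') → z-lf (edge-lasso (lasso-any-avoiding L (lasso-b L) (b-free ∘ lasso-mono (proj₁ ∘ proj₁)) (lasso∋ L n') (proj₂ hF))
                       (sw₂ (sw₁ (sw₂ rhz))) (λ k → proj₂ (proj₁ k) refl) (λ k → proj₁ (proj₁ (proj₁ k)) , proj₂ k) (psF (end∈ p))) }
                  where
                    avoiding : ¬ LassoW z ((Ok ∖ r) ∖ h)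
                    avoiding L' = x-free (lasso-mono
                        (λ { (inj₁ (inj₁ m)) → proj₁ (psF m) ; (inj₁ (inj₂ (inj₁ refl))) → proj₁ hF ; (inj₁ (inj₂ (inj₂ refl))) → λ { refl → proj₁ (lassoV⊆ L' (lasso-tip L')) .proj₁ .proj₁ refl }
                           ; (inj₂ k) → proj₁ (proj₁ (proj₁ k)) })
                        (flasso→lasso (attach (snoc (toWithin p) rhz h∉ z∉) L'
                          λ { (inj₁ m) k → ⊥-elim (apart m k) ; (inj₂ (inj₁ refl)) k → ⊥-elim (proj₂ (lassoV⊆ L' k) refl) ; (inj₂ (inj₂ e₁)) _ → e₁ })))
                      where
                        apart : ∀ {u} → u ∈ ps → u ∈ lassoV L' → ⊥
                        apart {u} m k with lasso-any-avoiding L' (lasso-b L') (b-free ∘ lasso-mono (proj₁ ∘ proj₁ ∘ proj₁)) k (proj₂ (psF m))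
                        ... | us , y , i with contact y (reverse⁺ p) (λ { refl l → z∉ (rv⁻ ps l) }) (u , end∈ y , rv⁺ ps m)
                        ...   | inj₁ q = lf (edge-lasso (rev (meet-pt q)) (sw₂ rhz)
                                  [ (λ l → proj₂ (proj₁ (i l)) refl) , (λ l → h∉ (rv⁻ ps l)) ]′
                                  [ (λ l → proj₁ (proj₁ (proj₁ (proj₁ (i l)))) , proj₂ (i l)) , (λ l → psF (rv⁻ ps l)) ]′ hF)
                        ...   | inj₂ q = x-lf (lasso-mono [ (λ l → proj₁ (proj₁ (proj₁ (proj₁ (i l)))) , proj₂ (i l)) , (λ l → psF (rv⁻ ps l)) ]′ (y-lasso q))
                r≢x : r ≢ x
                r≢x refl = no-l (lasso-mono (λ k → k , proj₂ k) L₀)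

          endgame : ¬¬ Good x s z
          endgame = common {b} {z} {F} b≢z (λ k → proj₂ k refl) b-lf >>= λ { (c , c≢z , hc) → em >>= λ
            { (no m) → pure (good-of c c≢z (λ L → hc (within-mono (λ { ((a , e₁) , e₂) → (proj₁ a , e₂) , e₁ }) (through-b L)))
                         (λ p i k → hc (within-mono (λ { (l , e₁) → (proj₁ (proj₁ (i l)) , e₁) , proj₂ (i l) }) (after-b p (proj₁ ∘ i) k))) m)
            ; (yes X₁) → em >>= λ
              { (no nq) → detached nq
              ; (yes q) → em {A = Σ QData λ qd → Exits (_≢ z) (QData.spine qd)} >>= λ
                { (yes (qd , good)) → Attached.good-spine c (c≢x hc) hc X₁ qd good
                ; (no bad) → pure (Attached.bad-spine c (c≢x hc) hc X₁ (qdata-of q) λ qd ex → bad (qd , ex)) } } } }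
            where
              c≢x : ∀ {c} → Hits (pr (Tb b)) F z c → c ≢ x
              c≢x hc refl = hc (within-mono (λ { (a , e₁) → (proj₁ a , e₁) , proj₂ a }) (through-b L₀))

    answer : Within (pr B) (λ _ → ⊤) x → Mode x s → ∀ z → z ≢ x → ¬¬ Good x s z
    answer reached mode z z≢x = em >>= λ
      { (yes n) → good-near n
      ; (no nz) → em >>= λ
        { (no nl) → good-tree z≢x nz nl
        ; (yes L) → j z >>= λ { (y , iy@(y≢z , hy , ly)) → em >>= λ
          { (no h) → pure (y , y≢z , nz ∘ within-mono (proj₁ ∘ proj₁) , h , ly ∘ lasso-mono proj₂)
          ; (yes (xs , r , i)) → missed nz L iy (uncons r) i mode } } } }
      where
        missed : ∀ {y xs} → ¬ Near z → LassoW z Ok → Int z y → Opened (Tb x) xs z → Inside xs (Ok ∖ y) → Mode x s → ¬¬ Good x s z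
        missed {y} nz L iy o@(opened {w} {u} {ρ} f r w∉ w∈ ρ⊆ _) i mode = by mode
          where
            module S = Split₂ x w u
            y∈L : y ∈ lassoV L
            y∈L = lasso∋ L (proj₂ (proj₂ iy) ∘ lasso-mono proj₂)
            X : Within (pr S.One) (Ok ∖ y) z
            X = _ , consᵇ {S.One} (f , inj₁ (refl , refl)) r w∉ , λ m → [ (λ k → i (ρ⊆ k)) , (λ { (here refl) → i w∈ }) ]′ (∈-++⁻ ρ m)
            x∉Ok : ¬ Ok x
            x∉Ok k = proj₂ k refl
            ok-free : ¬ LassoW x (λ u → Ok u ⊎ u ≡ x)
            ok-free = x-free ∘ lasso-mono unok
            nc : ∀ {A G} → A ⊑ Tb x → G ⊑ Tb x → ¬ Meet (pr A) (pr G) Ok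
            nc = no-meet {x} {z} (≢-sym z≢x) x∉Ok ok-free
            two : Within (pr S.Rest) Ok z → ¬¬ Good x s z
            two az = em >>= λ
              { (no h) → common₂ {S.Rest} {S.One} (nc S.rest⊑ S.one⊑) (λ l → ok-free (flasso-base S.rest⊑ l x∉Ok)) az (proj₁ iy) h (proj₂ (proj₂ iy) ∘ lasso-mono proj₂) >>=
                  λ { (c , ne , hr , ho , hl) → pure (c , ne , nz ∘ within-mono (proj₁ ∘ proj₁) , (λ p → [ ho , hr ]′ (chooseW S.decide p)) , hl) }
              -- Two paths missing `y` that leave `x` by different edges form a Y at `z`, hence a
              -- tadpole missing `y`.
              ; (yes Y) → ⊥-elim (both X Y) }
              where
                both : Within (pr S.One) (Ok ∖ y) z → Within (pr S.Rest) (Ok ∖ y) z → ⊥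
                both (ps , p , i) (qs , q , k) with contact p q (λ ()) (z , end∈ p , end∈ q)
                ... | inj₁ m = nc S.one⊑ S.rest⊑ (meet-mono [ proj₁ ∘ i , proj₁ ∘ k ]′ m)
                ... | inj₂ l = proj₂ (proj₂ iy) (lasso-mono [ [ proj₂ ∘ i , proj₂ ∘ k ]′ , (λ { refl → λ { refl → proj₂ (lassoV⊆ L y∈L) refl } }) ]′
                      (y-lasso-base {x} S.one⊑ S.rest⊑ S.disj [ (λ m → proj₂ (proj₁ (i m)) refl) , (λ m → proj₂ (proj₁ (k m)) refl) ]′ l))
            by : Mode x s → ¬¬ Good x s z
            by (inj₁ adj) = ⊥-elim (adj-clash nz iy (far-lasso (lasso-mono proj₁ L) nz y∈L') (proj₁ (lassoV⊆ L y∈L)) (proj₂ (lassoV⊆ L y∈L)) adj (rebaseW S.one⊑ X))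
              where y∈L' : y ∈ lassoV (lasso-mono proj₁ L)
                    y∈L' = lasso∋ (lasso-mono proj₁ L) (proj₂ (proj₂ iy) ∘ lasso-mono proj₂)
            by (inj₂ (na , nr)) = em >>= λ
              { (yes az) → two az
              ; (no ng) → Free.Single.Endgame.endgame na w u (λ y a b c → nr y (a , b , c)) reached z≢x nz L iy X ng }


  module _ (j : J) (x : V) (reached : Within (pr B) (λ _ → ⊤) x) (all : List V) (all∋ : ∀ v → v ∈ all) where
    Reply-to : Set
    Reply-to = Σ V λ s → Σ (Int x s) λ ix → ∀ z → z ≢ x → ¬¬ Good x s z

    -- `L` holds the vertices not known to be reached without the current `s`. Passing on to `y`
    -- removes `s` from it; a vertex reached without `s` stays reached without `y`, for otherwise
    -- `y` would be reached without `s`.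
    search : (∀ w → Int x w → ¬ Adj x w) → ∀ k L → length L ≤ k → ∀ s → Int x s → (∀ v → v ∈ L ⊎ Within (pr B) (_≢ s) v) → ¬¬ Reply-to
    search na k L le s ix inv = em {A = Σ V (Restart x s)} >>= λ
      { (no n) → pure (s , ix , Reply.answer j x s ix reached (inj₂ (na , λ y r → n (y , r))))
      ; (yes (y , iy , sy , ny)) → again k le y iy sy ny }
      where
        not-s? = λ v → ¬? (v ≟ s)
        s∈ : s ∈ L
        s∈ = [ id , (λ { (ps , p , i) → ⊥-elim (i (end∈ p) refl) }) ]′ (inv s)
        shorter : length (filter not-s? L) < length L
        shorter = filter-notAll not-s? L (Any.map (λ { refl n → n refl }) s∈)
        again : ∀ k → length L ≤ k → ∀ y → Int x y → Within (pr B) (_≢ y) s → ¬ Within (pr B) (_≢ s) y → ¬¬ Reply-to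
        again zero le y _ _ _ = ⊥-elim (n≮0 (≤-trans shorter le))
        again (suc k) le y iy sy ny = search na k (filter not-s? L) (≤-pred (≤-trans shorter le)) y iy inv'
          where
            inv' : ∀ v → v ∈ filter not-s? L ⊎ Within (pr B) (_≢ y) v
            inv' v with v ≟ s | inv v
            ... | yes refl | _ = inj₂ sy
            ... | no n | inj₁ m = inj₁ (∈-filter⁺ not-s? m n)
            ... | no n | inj₂ (ps , p , i) = inj₂ (ps , p , λ m → λ { refl → ny (within-mono i (reach-any p m)) })

    reply : ¬¬ Reply-to
    reply = em {A = Σ V λ s → Int x s × Adj x s} >>= λ
      { (yes (s , ix , adj)) → pure (s , ix , Reply.answer j x s ix reached (inj₁ adj))
      ; (no n) → j x >>= λ { (s , ix) → search (λ w i a → n (w , i , a)) _ all ≤-refl s ix (λ v → inj₁ (all∋ v)) } }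

-- Moving paths and tadpoles between a hypergraph and its restrictions.

module Transfer {V : Set} (_≟_ : DecidableEquality V) (H' H : HG V) (K : V → Set)
                (f : ∀ {a b c} → HG.T H' a b c → HG.T H a b c × K a × K b × K c) where
  open import Data.List.Membership.Propositional using (_∈_; _∉_)
  open Base
  open Paths using (pt; pr; stop; go; none; via; cyc) renaming (lasso to lasso-of)
  Reach' = Paths.Reach _≟_ H'
  Reach = Paths.Reach _≟_ H

  reach-pt : ∀ {z xs v} → Reach' (pt z) xs v → Reach (pt z) xs v
  reach-pt (stop e) = stop e
  reach-pt (go {e = just _} (via r) n a b) = go (via (reach-pt r)) (proj₁ (f n)) a b

  reach-pr : ∀ {A' A} → (∀ {u v} → R A' u v → R A u v) → ∀ {xs v} → Reach' (pr A') xs v → Reach (pr A) xs v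
  reach-pr g (go none n a b) = go none (g n) a b
  reach-pr g (go {e = just _} (via r) n a b) = go (via (reach-pr g r)) (proj₁ (f n)) a b

  kept-pt : ∀ {z xs v u} → Reach' (pt z) xs v → K z → u ∈ xs → K u
  kept-pt (stop refl) k (here refl) = k
  kept-pt (go {e = just _} (via r) n _ _) k (here refl) = proj₂ (proj₂ (proj₂ (f n)))
  kept-pt (go {e = just _} (via r) n _ _) k (there (here refl)) = proj₁ (proj₂ (proj₂ (f n)))
  kept-pt (go {e = just _} (via r) n _ _) k (there (there m)) = kept-pt r k m

  kept-pr : ∀ {A' xs v u} → (∀ {u v} → R A' u v → K u × K v) → Reach' (pr A') xs v → u ∈ xs → K u
  kept-pr g (go none n _ _) (here refl) = proj₂ (g n)
  kept-pr g (go none n _ _) (there (here refl)) = proj₁ (g n)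
  kept-pr g (go {e = just _} (via r) n _ _) (here refl) = proj₂ (proj₂ (proj₂ (f n)))
  kept-pr g (go {e = just _} (via r) n _ _) (there (here refl)) = proj₁ (proj₂ (proj₂ (f n)))
  kept-pr g (go {e = just _} (via r) n _ _) (there (there m)) = kept-pr g r m

  within : ∀ {A' A} {X : V → Set} {v} → (∀ {u v} → R A' u v → R A u v × K u × K v) →
           Paths.Within _≟_ H' (pr A') X v → Paths.Within _≟_ H (pr A) (λ u → X u × K u) v
  within g (xs , r , i) = xs , reach-pr (proj₁ ∘ g) r , λ m → i m , kept-pr (proj₂ ∘ g) r m

  lasso : ∀ {z} {X : V → Set} → Paths.LassoW _≟_ H' z X → Paths.LassoW _≟_ H z (λ u → X u × K u)
  lasso (lasso-of {c} {xs} t i (cyc {ys} r cl w∉ ys⊆ w∈)) =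
    lasso-of (reach-pt t) (λ m → i m , kept-pt t (proj₁ (proj₂ (f cl))) m)
      (cyc (reach-pr (proj₁ ∘ f) r) (proj₁ (f cl)) w∉
        (λ m → (proj₁ (ys⊆ m) , kept-pr (λ n → proj₂ (proj₂ (f n))) r m) , proj₂ (ys⊆ m))
        ((proj₁ w∈ , proj₂ (proj₂ (proj₂ (f cl)))) , proj₂ w∈))

  back : (∀ {a b c} → HG.T H a b c → K a → K b → K c → HG.T H' a b c) →
         ∀ {A' A} → (∀ {u v} → R A u v → K u → K v → R A' u v) → ∀ {xs v} → Reach (pr A) xs v → (∀ {u} → u ∈ xs → K u) → Reach' (pr A') xs v
  back f⁻ g (go none n a b) i = go none (g n (i (there (here refl))) (i (here refl))) a b
  back f⁻ g (go {e = just _} (via r) n a b) i =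
    go (via (back f⁻ g r (λ m → i (there (there m))))) (f⁻ n (i (there (there (Paths.end∈ _≟_ H r)))) (i (there (here refl))) (i (here refl))) a b

-- Restoring fullness after a round.

module Devices {V : Set} (_≟_ : DecidableEquality V) where
  open import Data.List.Membership.Propositional using (_∈_; _∉_)
  open Base

  -- Every vertex of an edge lies on a snake.
  Full : HG V → Base V → Set
  Full H B = ∀ {u v w} → HG.T H u v w → ¬¬ (Paths.Within _≟_ H (Paths.pr B) (λ _ → ⊤) u)

  -- Each edge of (H , B) contains an edge of (H' , B'), so the second position is at least as good for Maker.
  record Cover (H : HG V) (B : Base V) (H' : HG V) (B' : Base V) : Set₁ where
    field
      tri  : ∀ {a b c} → HG.T H a b c → HG.T H' a b c ⊎ R B' a b ⊎ R B' a c ⊎ R B' b c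
      prs  : ∀ {a b} → R B a b → R B' a b
      keep : ∀ {K : V → Set} → (∀ {a b c} → HG.T H a b c → K a) → (∀ {a b} → R B a b → K a) →
             (∀ {a b c} → HG.T H' a b c → K a) × (∀ {a b} → R B' a b → K a)

  cover-refl : ∀ {H B} → Cover H B H B
  cover-refl = record { tri = inj₁ ; prs = id ; keep = λ f g → f , g }

  cover-trans : ∀ {H B H' B' H'' B''} → Cover H B H' B' → Cover H' B' H'' B'' → Cover H B H'' B''
  cover-trans c d = record
    { tri = λ t → [ tri d , inj₂ ∘ Data.Sum.map (prs d) (Data.Sum.map (prs d) (prs d)) ]′ (tri c t)
    ; prs = prs d ∘ prs c
    ; keep = λ f g → let (f' , g') = keep c f g in keep d f' g' }
    where open Cover

  union : Base V → Base V → Base V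
  union A G = record { R = λ u v → R A u v ⊎ R G u v ; symR = Data.Sum.map (symR A) (symR G) ; irrR = [ irrR A , irrR G ]′ }

  restrict : HG V → (V → Set) → HG V
  restrict H K = record
    { T = λ a b c → HG.T H a b c × K a × K b × K c
    ; sw₁ = λ { (t , a , b , c) → HG.sw₁ H t , b , a , c }
    ; sw₂ = λ { (t , a , b , c) → HG.sw₂ H t , a , c , b }
    ; irr = HG.irr H ∘ proj₁ }

  restrictB : Base V → (V → Set) → Base V
  restrictB A K = record
    { R = λ a b → R A a b × K a × K b ; symR = λ { (r , a , b) → symR A r , b , a } ; irrR = irrR A ∘ proj₁ }

  record Settled (H : HG V) (B : Base V) : Set₁ where
    field
      H'    : HG V
      B'    : Base V
      j'    : Positions.J _≟_ H' B'
      full' : Full H' B'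
      cover : Cover H B H' B'

  -- The full position before the round. Its condition `J` is consulted at vertices that the current
  -- base no longer reaches.
  module Ambient (H₀ : HG V) (B₀ : Base V) (j₀ : Positions.J _≟_ H₀ B₀) (full₀ : Full H₀ B₀) where
    module A = Positions _≟_ H₀ B₀

    module Current (H : HG V) (B : Base V) (sub : ∀ {a b c} → HG.T H a b c → HG.T H₀ a b c) (j : Positions.J _≟_ H B) where
      open HG H
      open Positions _≟_ H B
      module Up = Transfer _≟_ H H₀ (λ _ → ⊤) (λ t → sub t , tt , tt , tt)

      Occ : V → Set
      Occ u = Σ V λ v → Σ V λ w → T u v w

      Reached : V → Set
      Reached = Within (pr B) (λ _ → ⊤)

      Lost : V → Set
      Lost u = Occ u × ¬ Reached u

      -- A base path meeting the tadpole would continue to `z` or hang the tadpole on the base, so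
      -- all of it is lost together with `z`.
      lost-lasso : ∀ {z X u} (L : LassoW z X) → ¬ Reached z → u ∈ lassoV L → Lost u
      lost-lasso {z} {X} {u} L@(lasso {c} {xs} t i (cyc {ys} {v} {w} r cl w∉ ys⊆ w∈)) nz m = occ m , λ { (ps , p , _) → hit (enter-lasso p L (λ ()) (u , end∈ p , m)) }
        where
          hit : ∀ {ps} → Within (pr B) ((_∈ ps) ∪ X) z ⊎ FLassoW (pr B) ((_∈ ps) ∪ X) → ⊥
          hit (inj₁ q) = nz (within-mono _ q)
          hit (inj₂ q) = no-base-lasso j q
          onPt : ∀ {c xs z u} → Occ c → Reach (pt c) xs z → u ∈ xs → Occ u
          onPt o (stop refl) (here refl) = o
          onPt o (go {e = just _} (via r) n _ _) (here refl) = _ , _ , sw₁ (sw₂ n)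
          onPt o (go {e = just _} (via r) n _ _) (there (here refl)) = _ , _ , sw₁ n
          onPt o (go {e = just _} (via r) n _ _) (there (there m)) = onPt o r m
          onPr : ∀ {ys v u} → Reach (pr (Tb c)) ys v → u ∈ ys → Occ u
          onPr (go none n _ _) (here refl) = _ , _ , sw₁ (sw₂ n)
          onPr (go none n _ _) (there (here refl)) = _ , _ , sw₁ n
          onPr (go {e = just _} (via r) n _ _) (here refl) = _ , _ , sw₁ (sw₂ n)
          onPr (go {e = just _} (via r) n _ _) (there (here refl)) = _ , _ , sw₁ n
          onPr (go {e = just _} (via r) n _ _) (there (there m)) = onPr r m
          occ : u ∈ (w ∷ xs ++ ys) → Occ u
          occ (here refl) = _ , _ , sw₁ (sw₂ cl)
          occ (there k) = [ onPt (_ , _ , cl) t , onPr r ]′ (∈-++⁻ xs k)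

      lost-path : ∀ {r z ws u} → Reach (pt r) ws z → Occ r → ¬ Reached r → ¬ Reached z → u ∈ ws → Lost u
      lost-path {r} {z} w o nr nz m = occ w m , λ { (ps , p , _) → hit (contact p w (λ ()) (_ , end∈ p , m)) }
        where
          hit : ∀ {X} → Meet (pr B) (pt r) X ⊎ YShape (pr B) (pt r) z X → ⊥
          hit (inj₁ q) = nr (within-mono _ (meet-pt q))
          hit (inj₂ q) = nz (within-mono _ (y-left q))
          occ : ∀ {ws z u} → Reach (pt r) ws z → u ∈ ws → Occ u
          occ (stop refl) (here refl) = o
          occ (go {e = just _} (via r) n _ _) (here refl) = _ , _ , sw₁ (sw₂ n)
          occ (go {e = just _} (via r) n _ _) (there (here refl)) = _ , _ , sw₁ n
          occ (go {e = just _} (via r) n _ _) (there (there m)) = occ r m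

      up-lasso : ∀ {z X} → LassoW z X → A.LassoW z X
      up-lasso = A.lasso-mono proj₁ ∘ Up.lasso

      record FirstLost : Set where
        field
          {π}  : List V
          {e}  : Maybe V
          {r r'} : V
          arm  : A.Arm (A.pr B₀) π e
          nx   : A.Nx (A.pr B₀) e r' r
          r∉   : r ∉ π
          r'∉  : r' ∉ π
          safe : ∀ {u} → u ∈ π → ¬ Lost u
          lost : Lost r

      first-lost : ∀ {xs v u} → A.Reach (A.pr B₀) xs v → u ∈ xs → Lost u → ¬¬ FirstLost
      first-lost {u = u} (A.go {xs} {e} {w} {v} a n w∉ v∉) m l = em {A = Σ V λ k → k ∈ xs × Lost k} >>= λ
        { (yes (k , k∈ , lk)) → deeper a k∈ lk
        ; (no clean) → pure (here-lost m λ m l → clean (_ , m , l)) }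
        where
          deeper : ∀ {e k} → A.Arm (A.pr B₀) xs e → k ∈ xs → Lost k → ¬¬ FirstLost
          deeper (A.via r) k∈ lk = first-lost r k∈ lk
          here-lost : u ∈ (v ∷ w ∷ xs) → (∀ {k} → k ∈ xs → ¬ Lost k) → FirstLost
          here-lost (here refl) s = record { arm = a ; nx = n ; r∉ = v∉ ; r'∉ = w∉ ; safe = s ; lost = l }
          here-lost (there (here refl)) s = record { arm = a ; nx = A.nx-sym (A.pr B₀) e n ; r∉ = w∉ ; r'∉ = v∉ ; safe = s ; lost = l }
          here-lost (there (there k)) s = ⊥-elim (s k l)

      module Step (fl : FirstLost) where
        open FirstLost fl
        r≢r' : r ≢ r'
        r≢r' eq = A.nx-irr (A.pr B₀) e nx (sym eq)

        rπ : A.Reach (A.pr B₀) (r ∷ r' ∷ π) r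
        rπ = A.go arm nx r'∉ r∉

        module Both (lost' : Lost r') where
          G : Base V
          G = record { R = λ u v → (u ≡ r × v ≡ r') ⊎ (u ≡ r' × v ≡ r) ; symR = λ { (inj₁ (p , q)) → inj₂ (q , p) ; (inj₂ (p , q)) → inj₁ (q , p) }
                     ; irrR = λ { (inj₁ (refl , refl)) → r≢r' ; (inj₂ (refl , refl)) → ≢-sym r≢r' } }
          G-lost : ∀ {u v} → R G u v → Lost u × Lost v
          G-lost (inj₁ (refl , refl)) = lost , lost'
          G-lost (inj₂ (refl , refl)) = lost' , lost
          B₁ : Base V
          B₁ = union B G
          nc : ¬ Meet (pr B) (pr G) (λ _ → ⊤)
          nc (meet p q o _ _) with uncons q
          ... | opened f ρ _ _ ρ⊆ _ = proj₂ (proj₂ (G-lost f)) (within-mono _ (join (toWithin p) (reverse ρ) (λ a b → o a (ρ⊆ b))))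
          -- The new pair stands for the last edge of the ambient path through `π`; putting `π` in
          -- front turns its paths into ambient ones.
          graft : ∀ {xs z} → Reach (pr G) xs z → (∀ {u} → u ∈ xs → u ∉ π) → A.Reach (A.pr B₀) (xs ++ π) z
          graft (go none (inj₁ (refl , refl)) _ _) d = A.go arm (A.nx-sym (A.pr B₀) e nx) r∉ r'∉
          graft (go none (inj₂ (refl , refl)) _ _) d = A.go arm nx r'∉ r∉
          graft (go {xs} {e = just _} {w} {v} (via q) n w∉ v∉) d =
            A.go (A.via (graft q (λ m → d (there (there m))))) (sub n) (out w∉ (d (there (here refl)))) (out v∉ (d (here refl)))
            where out : ∀ {u} → u ∉ xs → u ∉ π → u ∉ (xs ++ π)
                  out a b m = [ a , b ]′ (∈-++⁻ xs m)
          occ : ∀ {xs z u} → Reach (pr G) xs z → u ∈ xs → Occ u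
          occ (go none n _ _) (here refl) = proj₁ (proj₂ (G-lost n))
          occ (go none n _ _) (there (here refl)) = proj₁ (proj₁ (G-lost n))
          occ (go {e = just _} (via q) n _ _) (here refl) = _ , _ , sw₁ (sw₂ n)
          occ (go {e = just _} (via q) n _ _) (there (here refl)) = _ , _ , sw₁ n
          occ (go {e = just _} (via q) n _ _) (there (there m)) = occ q m
          lost-G : ∀ {xs z u} → Reach (pr G) xs z → ¬ Reached z → u ∈ xs → Lost u
          lost-G {z = z} q nz m = occ q m , λ { (ps , p , _) → hit (contact p q (λ ()) (_ , end∈ p , m)) }
            where
              hit : ∀ {X} → Meet (pr B) (pr G) X ⊎ YShape (pr B) (pr G) z X → ⊥
              hit (inj₁ k) = nc (meet-mono _ k)
              hit (inj₂ k) = nz (within-mono _ (y-left k))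
          j₁ : Positions.J _≟_ H B₁
          j₁ z = em >>= λ
            { (yes az) → j z >>= λ { (y , ne , h , l) →
                common₂ {B} {G} {λ _ → ⊤} nc (no-base-lasso j) az ne (h ∘ within-mono proj₂) (l ∘ lasso-mono proj₂) >>= λ { (c , ne' , hb , hg , hl) →
                  pure (c , ne' , (λ p → [ hb ∘ within-mono (tt ,_) , hg ∘ within-mono (tt ,_) ]′ (chooseW {B} {G} {B₁} id p)) , hl ∘ lasso-mono (tt ,_)) } }
            ; (no nz) → j₀ z >>= λ { (y , ne , h , l) → pure (pick nz y ne h l (y ∈? π)) } }
            where
              -- If the ambient vertex `y` is off `π`, it still hits all grafted paths. If it lies
              -- on `π`, it is not lost, so `z` has no tadpole at all and a vertex of the new pair
              -- other than `z` serves.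
              pick : ¬ Reached z → ∀ y → y ≢ z → ¬ A.Within (A.pr B₀) (_≢ y) z → ¬ A.LassoW z (_≢ y) → Dec (y ∈ π) → Σ V λ c → Positions.Int _≟_ H B₁ z c
              pick nz y ne h l (no y∉) = y , ne , (λ p → [ nz ∘ within-mono _ , viaG ]′ (chooseW {B} {G} {B₁} id p)) , l ∘ up-lasso
                where
                  viaG : ¬ Within (pr G) (_≢ y) z
                  viaG (xs , q , i) = h (_ , graft q (λ m k → safe k (lost-G q nz m)) , λ m → [ i , (λ k → λ { refl → y∉ k }) ]′ (∈-++⁻ xs m))
              pick nz y ne h l (yes y∈) with r ≟ z
              ... | no n = r , n , (λ p → [ nz ∘ within-mono _ , viaG ]′ (chooseW {B} {G} {B₁} id p)) , no-l
                where
                  viaG : ¬ Within (pr G) (_≢ r) z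
                  viaG q with pair∈ q
                  ... | _ , _ , inj₁ (refl , _) , a , _ = a refl
                  ... | _ , _ , inj₂ (_ , refl) , _ , b = b refl
                  no-l : ∀ {X} → ¬ LassoW z X
                  no-l L = safe y∈ (lost-lasso L nz (lasso∋ L (l ∘ up-lasso ∘ lasso-mono proj₂)))
              ... | yes eq = r' , (λ e' → r≢r' (trans eq (sym e'))) , (λ p → [ nz ∘ within-mono _ , viaG ]′ (chooseW {B} {G} {B₁} id p)) , no-l
                where
                  viaG : ¬ Within (pr G) (_≢ r') z
                  viaG q with pair∈ q
                  ... | _ , _ , inj₁ (_ , refl) , _ , b = b refl
                  ... | _ , _ , inj₂ (refl , _) , a , _ = a refl
                  no-l : ∀ {X} → ¬ LassoW z X
                  no-l L = safe y∈ (lost-lasso L nz (lasso∋ L (l ∘ up-lasso ∘ lasso-mono proj₂)))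
          Lost₁ : V → Set
          Lost₁ v = Occ v × ¬ Within (pr B₁) (λ _ → ⊤) v
          lost₁ : ∀ {v} → Lost₁ v → Lost v
          lost₁ (o , n) = o , n ∘ rebaseW inj₁
          lost≢ : ∀ {v} → Lost₁ v → v ≢ r
          lost≢ (_ , n) refl = n (_ , go none (inj₂ (inj₂ (refl , refl))) (λ ()) (λ ()) , _)
          cover₁ : Cover H B H B₁
          cover₁ = record { tri = inj₁ ; prs = inj₁
            ; keep = λ f g → f , λ { (inj₁ b) → g b ; (inj₂ b) → f (proj₂ (proj₂ (proj₁ (proj₁ (G-lost b))))) } }

        module One (safe' : ¬ Lost r') where
          K : V → Set
          K u = u ≢ r
          H₁ : HG V
          H₁ = restrict H K
          B₁ : Base V
          B₁ = union B (restrictB (Tb r) K)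
          b≢r : ∀ {u v} → R B u v → K u × K v
          b≢r b = (λ { refl → proj₂ lost (_ , go none (symR B b) (λ ()) (λ ()) , _) }) , (λ { refl → proj₂ lost (_ , go none b (λ ()) (λ ()) , _) })
          t≢r : ∀ {u v} → T r u v → K u × K v
          t≢r t = (λ { refl → irr t refl }) , λ { refl → irr₃ t refl }
          module D = Transfer _≟_ H₁ H K id
          down : ∀ {X z} → Paths.Within _≟_ H₁ (Paths.pr B₁) X z → Within (pr B) (λ u → X u × K u) z ⊎ Within (pr (Tb r)) (λ u → X u × K u) z
          down p = chooseW {B} {Tb r} {union B (Tb r)} id (D.within {B₁} {union B (Tb r)}
            (λ { (inj₁ b) → inj₁ b , b≢r b ; (inj₂ (t , k)) → inj₂ t , k }) p)
          -- The ambient vertex for `r` would lie on the tadpole and be lost, yet it lies on the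
          -- ambient path to `r`, whose other vertices are not lost.
          r-free : ¬ LassoW r (λ _ → ⊤)
          r-free L = j₀ r λ { (y , ne , h , l) → at-y y ne h (lost-lasso L (proj₂ lost) (lasso∋ L (l ∘ up-lasso ∘ lasso-mono proj₂))) }
            where
              at-y : ∀ y → y ≢ r → ¬ A.Within (A.pr B₀) (_≢ y) r → Lost y → ⊥
              at-y y ne h ly = h (_ , rπ , λ { (here refl) → ≢-sym ne ; (there (here refl)) → (λ { refl → safe' ly }) ; (there (there m)) → λ { refl → safe m ly } })
          nc : ¬ Meet (pr B) (pr (Tb r)) K
          nc (meet p q o i k) = proj₂ lost (within-mono _ (join (toWithin p) (rev (lift q (λ m → k m refl)))
            λ { a (inj₁ refl) → ⊥-elim (i a refl) ; a (inj₂ b) → o a b }))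
          j₁ : Positions.J _≟_ H₁ B₁
          j₁ z with z ≟ r
          ... | yes refl = pure (r' , ≢-sym r≢r' , (λ p → [ off proj₂ , off proj₂ ]′ (down p)) , (λ L → off-l proj₂ (D.lasso L)))
            where
              off : ∀ {S X} → (∀ {u} → X u → K u) → ¬ Within S X r
              off f (ps , p , i) = f (i (end∈ p)) refl
              off-l : ∀ {X} → (∀ {u} → X u → K u) → ¬ LassoW r X
              off-l f (lasso t i _) = f (i (end∈ t)) refl
          ... | no z≢r = em {A = Reached z} >>= λ
            { (yes (ps , p , i)) → j z >>= λ { (y , ne , h , l) →
                common₂ {B} {Tb r} {K} nc (no-base-lasso j) (ps , p , λ m → λ { refl → proj₂ lost (within-mono _ (reach-any p m)) }) ne (h ∘ within-mono proj₂) (l ∘ lasso-mono proj₂) >>=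
                λ { (c , ne' , hb , hg , hl) → pure (c , ne' , (λ p → [ hb ∘ within-mono Data.Product.swap , hg ∘ within-mono Data.Product.swap ]′ (down p)) , hl ∘ lasso-mono Data.Product.swap ∘ D.lasso) } }
            ; (no nz) → j₀ z >>= λ { (y , ne , h , l) → pick nz y ne h l (y ∈? (r ∷ r' ∷ π)) } }
            where
              -- If `y` is off the ambient path to `r`, it keeps serving. Otherwise no tadpole
              -- avoiding `r` can contain it, so none exists at `z`, and a vertex common to the
              -- paths from `r` is enough.
              pick : ¬ Reached z → ∀ y → y ≢ z → ¬ A.Within (A.pr B₀) (_≢ y) z → ¬ A.LassoW z (_≢ y) → Dec (y ∈ (r ∷ r' ∷ π)) → ¬¬ (Σ V λ c → Positions.Int _≟_ H₁ B₁ z c)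
              pick nz y ne h l (no y∉) = pure (y , ne , (λ p → [ nz ∘ within-mono _ , viaR ]′ (down p)) , l ∘ up-lasso ∘ lasso-mono proj₁ ∘ D.lasso)
                where
                  viaR : ¬ Within (pr (Tb r)) (λ u → u ≢ y × K u) z
                  viaR (xs , q , i) = h (A.within-mono
                      (λ { (inj₁ m) → (λ { refl → y∉ m }) ; (inj₂ m) → [ (λ k → proj₁ (i k)) , (λ { (here refl) → λ { refl → y∉ (here refl) } }) ]′ (∈-++⁻ xs m) })
                      (A.join (A.toWithin rπ) (A.toWithin (Up.reach-pt ws))
                        λ { (here e₁) _ → e₁ ; (there (here refl)) m → ⊥-elim (safe' (lp m)) ; (there (there k)) m → ⊥-elim (safe k (lp m)) }))
                    where
                      ws : Reach (pt r) (xs ++ r ∷ []) z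
                      ws = liftᵖ q (λ m → proj₂ (i m) refl)
                      lp : ∀ {u} → u ∈ (xs ++ r ∷ []) → Lost u
                      lp = lost-path ws (proj₁ lost) (proj₂ lost) nz
              pick nz y ne h l (yes y∈) = common {r} {z} {K} (≢-sym z≢r) (λ k → k refl) (r-free ∘ lasso-mono _) >>= λ { (c , c≢z , hc) →
                pure (c , c≢z , (λ p → [ nz ∘ within-mono _ , hc ∘ within-mono Data.Product.swap ]′ (down p)) , no-l proj₂ ∘ D.lasso) }
                where
                  no-l : ∀ {X} → (∀ {u} → X u → K u) → ¬ LassoW z X
                  no-l f L = at-y y∈ (lasso∋ L (l ∘ up-lasso ∘ lasso-mono proj₂))
                    where
                      at-y : y ∈ (r ∷ r' ∷ π) → y ∈ lassoV L → ⊥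
                      at-y (here refl) m = f (lassoV⊆ L m) refl
                      at-y (there (here refl)) m = safe' (lost-lasso L nz m)
                      at-y (there (there k)) m = safe k (lost-lasso L nz m)
          lost₁ : ∀ {v} → (Σ V λ u → Σ V λ w → HG.T H₁ v u w) × ¬ Paths.Within _≟_ H₁ (Paths.pr B₁) (λ _ → ⊤) v → Lost v
          lost₁ ((_ , _ , t , _) , n) = (_ , _ , t) , λ { (ps , p , _) →
            n (ps , D.back (λ t a b c → t , a , b , c) {B₁} {B} (λ b _ _ → inj₁ b) p (λ m → λ { refl → proj₂ lost (within-mono _ (reach-any p m)) }) , _) }
          cover₁ : Cover H B H₁ B₁
          cover₁ = record { tri = tri ; prs = inj₁ ; keep = λ f g → (f ∘ proj₁) , λ { (inj₁ b) → g b ; (inj₂ (t , _)) → f (sw₁ t) } }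
            where
              tri : ∀ {a b c} → T a b c → HG.T H₁ a b c ⊎ R B₁ a b ⊎ R B₁ a c ⊎ R B₁ b c
              tri {a} {b} {c} t with a ≟ r | b ≟ r | c ≟ r
              ... | yes refl | _ | _ = inj₂ (inj₂ (inj₂ (inj₂ (t , t≢r t))))
              ... | no _ | yes refl | _ = inj₂ (inj₂ (inj₁ (inj₂ (sw₁ t , t≢r (sw₁ t)))))
              ... | no _ | no _ | yes refl = inj₂ (inj₁ (inj₂ (sw₁ (sw₂ t) , t≢r (sw₁ (sw₂ t)))))
              ... | no a≢ | no b≢ | no c≢ = inj₁ (t , a≢ , b≢ , c≢)

    -- Fullness is restored at the first vertex r lost on a path of the previous position: if its neighbour r' is lost too, {r , r'} becomes
    -- a pair of the base; otherwise r is treated as marked.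
    settle : ∀ k (H : HG V) (B : Base V) (sub : ∀ {a b c} → HG.T H a b c → HG.T H₀ a b c) (j : Positions.J _≟_ H B) (L : List V) →
             length L ≤ k → (∀ v → Current.Lost H B sub j v → v ∈ L) → ¬¬ Settled H B
    settle k H B sub j L le cand = em {A = Σ V (Current.Lost H B sub j)} >>= λ
      { (no n) → pure (record { H' = H ; B' = B ; j' = j ; full' = λ t nr → n (_ , (_ , _ , t) , nr) ; cover = cover-refl })
      ; (yes (v , lv@((_ , _ , t) , _))) → full₀ (sub t) >>= λ { (xs , p , _) → Current.first-lost H B sub j p (A.end∈ p) lv >>= λ fl → advance k le fl } }
      where
        shorter : ∀ {r} → r ∈ L → length (filter (λ v → ¬? (v ≟ r)) L) < length L
        shorter {r} m = filter-notAll (λ v → ¬? (v ≟ r)) L (Any.map (λ { refl n → n refl }) m)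
        widen : ∀ {H₁ B₁} → Cover H B H₁ B₁ → Settled H₁ B₁ → Settled H B
        widen c s = record { H' = Settled.H' s ; B' = Settled.B' s ; j' = Settled.j' s ; full' = λ {u} → Settled.full' s {u} ; cover = cover-trans c (Settled.cover s) }
        advance : ∀ k → length L ≤ k → Current.FirstLost H B sub j → ¬¬ Settled H B
        advance zero le fl = ⊥-elim (n≮0 (≤-trans (shorter (cand _ (Current.FirstLost.lost fl))) le))
        advance (suc k) le fl = em {A = Current.Lost H B sub j r'} >>= λ
          { (yes l') → settle k H (Current.Step.Both.B₁ H B sub j fl l') sub (Current.Step.Both.j₁ H B sub j fl l') L' le'
                (λ v l → ∈-filter⁺ not-r? (cand v (Current.Step.Both.lost₁ H B sub j fl l' l)) (Current.Step.Both.lost≢ H B sub j fl l' l)) >>=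
              λ s → pure (widen (Current.Step.Both.cover₁ H B sub j fl l') s)
          ; (no s') → settle k (Current.Step.One.H₁ H B sub j fl s') (Current.Step.One.B₁ H B sub j fl s') (sub ∘ proj₁) (Current.Step.One.j₁ H B sub j fl s') L' le'
                (λ v l → ∈-filter⁺ not-r? (cand v (Current.Step.One.lost₁ H B sub j fl s' l)) (proj₁ (proj₂ (proj₂ (proj₂ (proj₁ l)))))) >>=
              λ s → pure (widen (Current.Step.One.cover₁ H B sub j fl s') s) }
          where
            open Current.FirstLost fl using (r; r'; lost)
            not-r? = λ v → ¬? (v ≟ r)
            L' = filter not-r? L
            le' : length L' ≤ k
            le' = ≤-pred (≤-trans (shorter (cand r lost)) le)

-- The game: Maker cannot win a full position satisfying `J`.

open import Defs
open import Data.Bool using (Bool; true; false)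
import Data.Bool.Properties as Bool
open import Data.Fin using (Fin; zero; suc; toℕ; fromℕ; _≟_)
open import Data.Fin.Properties using (any?; all?)
open import Data.Fin.Subset using (Subset; _∈_; _∉_; _⊆_; _∩_; _─_; _-_; ⁅_⁆; ∣_∣; inside; outside) renaming (⊥ to ∅)
open import Data.Fin.Subset.Properties using (nonempty?; anySubset?; x∈⁅x⁆; x∈⁅y⁆⇒x≡y; x≢y⇒x∉⁅y⁆; ∣⁅x⁆∣≡1; ∉⊥; ∣⊥∣≡0; Empty-unique; ⊆-antisym; p⊆q⇒∣p∣≤∣q∣; p⊂q⇒∣p∣<∣q∣; x∈p∩q⁺; x∈p∩q⁻; x∈p∪q⁺; x∈p∪q⁻; p─q⊆p; p─⊥≡p; x∈p∧x∉q⇒x∈p─q; x∈p∧x≢y⇒x∈p-y; x∈p⇒∣p-x∣<∣p∣) renaming (_∈?_ to _∈ˢ?_)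
open import Data.List.Membership.Propositional using () renaming (_∈_ to _∈ˡ_; _∉_ to _∉ˡ_)
import Data.Nat.Properties as ℕ
open import Data.Vec using (lookup; tabulate; []; _∷_; here; there)
open import Data.Vec.Properties using ([]=⇒lookup; lookup⇒[]=; lookup∘tabulate; ≡-dec)

private variable n : ℕ

∈─⁻ : ∀ {x : Fin n} p q → x ∈ p ─ q → x ∈ p × x ∉ q
∈─⁻ p q m = p─q⊆p p q m , out p q m
  where
    out : ∀ {n} {x : Fin n} p q → x ∈ p ─ q → x ∉ q
    out (_ ∷ p) (outside ∷ q) (there m) (there k) = out p q m k
    out (_ ∷ p) (inside ∷ q) (there m) (there k) = out p q m k

two∈⇒2≤ : ∀ {x y : Fin n} {p : Subset n} → x ≢ y → x ∈ p → y ∈ p → 2 ≤ ∣ p ∣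
two∈⇒2≤ {x = x} {y} {p} ne a b = ≤-trans (s≤s (≤-trans (s≤s z≤n) (x∈p⇒∣p-x∣<∣p∣ {x = x} {p = p - y} (x∈p∧x≢y⇒x∈p-y a ne)))) (x∈p⇒∣p-x∣<∣p∣ b)

2≤⇒other : ∀ (p : Subset n) → 2 ≤ ∣ p ∣ → ∀ x → Σ (Fin n) λ y → y ∈ p × y ≢ x
2≤⇒other p le x with nonempty? (p - x)
... | yes (y , m) = y , p─q⊆p p ⁅ x ⁆ m , λ { refl → proj₂ (∈─⁻ p ⁅ x ⁆ m) (x∈⁅x⁆ x) }
... | no e = ⊥-elim (<⇒≱ le (≤-trans (p⊆q⇒∣p∣≤∣q∣ sub) (≤-reflexive (∣⁅x⁆∣≡1 x))))
  where
    sub : p ⊆ ⁅ x ⁆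
    sub {y} m with y ≟ x
    ... | yes refl = x∈⁅x⁆ x
    ... | no ne = ⊥-elim (e (y , x∈p∧x≢y⇒x∈p-y m ne))

del-edge : ∀ (G : MHG n) y {e} → E (delV G y) e ≡ true → E G e ≡ true × y ∉ e
del-edge G y {e} eq with E G e | lookup e y in l
... | true | false = refl , λ m → contra (trans (sym l) ([]=⇒lookup m))
  where contra : false ≢ true
        contra ()

del-edge⁺ : ∀ (G : MHG n) y {e} → E G e ≡ true → y ∉ e → E (delV G y) e ≡ true
del-edge⁺ G y {e} eq ne rewrite eq with lookup e y in l
... | true = ⊥-elim (ne (lookup⇒[]= y e l))
... | false = refl

module Game {n : ℕ} where
  open Devices (_≟_ {n})
  open Base

  Live : MHG n → Fin n → Set
  Live G a = a ∈ V G × a ∉ M G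

  live-next : ∀ G x y {a} → Live G a → a ≢ x → a ≢ y → Live (delV (markV G x) y) a
  live-next G x y (a∈ , a∉) nx ny = x∈p∧x∉q⇒x∈p─q a∈ (x≢y⇒x∉⁅y⁆ ny) ,
    λ m → [ a∉ , (λ k → nx (x∈⁅y⁆⇒x≡y x k)) ]′ (x∈p∪q⁻ (M G) ⁅ x ⁆ (p─q⊆p _ ⁅ y ⁆ m))

  data Covered (H : HG (Fin n)) (B : Base (Fin n)) (e : Subset n) : Set where
    triple : ∀ {a b c} → HG.T H a b c → a ∈ e → b ∈ e → c ∈ e → Covered H B e
    pair   : ∀ {a b} → R B a b → a ∈ e → b ∈ e → Covered H B e

  record Rel (G : MHG n) (H : HG (Fin n)) (B : Base (Fin n)) : Set where
    field
      edges : ∀ e → E G e ≡ true → ¬¬ Covered H B e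
      liveT : ∀ {a b c} → HG.T H a b c → Live G a
      liveB : ∀ {a b} → R B a b → Live G a

  rel-cover : ∀ {G H B H' B'} → Cover H B H' B' → Rel G H B → Rel G H' B'
  rel-cover {H' = H'} {B'} c r = record
    { edges = λ e m → Rel.edges r e m >>= λ
        { (triple t a b d) → pure (tr (Cover.tri c t) a b d) ; (pair p a b) → pure (pair (Cover.prs c p) a b) }
    ; liveT = proj₁ (Cover.keep c (Rel.liveT r) (Rel.liveB r)) ; liveB = proj₂ (Cover.keep c (Rel.liveT r) (Rel.liveB r)) }
    where
      tr : ∀ {a b d e} → HG.T H' a b d ⊎ R B' a b ⊎ R B' a d ⊎ R B' b d → a ∈ e → b ∈ e → d ∈ e → Covered H' B' e
      tr (inj₁ t) a b d = triple t a b d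
      tr (inj₂ (inj₁ p)) a b d = pair p a b
      tr (inj₂ (inj₂ (inj₁ p))) a b d = pair p a d
      tr (inj₂ (inj₂ (inj₂ p))) a b d = pair p b d

  -- Induction on the win of Maker, with the invariant reestablished after each reply by `settle`. A
  -- final winning edge would contain two live vertices.
  maker-loses : ∀ {G} → MakerWin G → ∀ H B → Rel G H B → Positions.J _≟_ H B → Full H B → ⊥
  maker-loses {G} (base _ (e , e∈ , le)) H B rel j full = Rel.edges rel e e∈ λ
    { (triple t a b _) → clash (HG.irr H t) a b (Rel.liveT rel t) (Rel.liveT rel (HG.sw₁ H t))
    ; (pair p a b) → clash (irrR B p) a b (Rel.liveB rel p) (Rel.liveB rel (symR B p)) }
    where
      clash : ∀ {a b} → a ≢ b → a ∈ e → b ∈ e → Live G a → Live G b → ⊥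
      clash ne a b la lb = <⇒≱ (two∈⇒2≤ ne (x∈p∧x∉q⇒x∈p─q a (proj₂ la)) (x∈p∧x∉q⇒x∈p─q b (proj₂ lb))) le
  maker-loses {G} (step two x x∈ x∉ win) H B rel j full = em {A = Within (pr B) (λ _ → ⊤) x} λ
    { (yes reached) → Rounds.reply _≟_ H B j x reached (allFin n) ∈-allFin λ { (s , ix , good) → answered reached s ix good }
    -- By fullness an unreached `x` lies in no triple and no pair, so any other unmarked vertex can
    -- be deleted.
    ; (no un) → let (y , m , ne) = 2≤⇒other (V G ─ M G) two x ; (y∈ , y∉) = ∈─⁻ (V G) (M G) m in idle un y y∈ y∉ ne }
    where
      open Positions _≟_ H B
      open HG H using (T; sw₁; sw₂)

      proceed : ∀ s → Live G s → s ≢ x → ∀ H' B' → (∀ {a b c} → HG.T H' a b c → T a b c) → Positions.J _≟_ H' B' → Rel (delV (markV G x) s) H' B' → ⊥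
      proceed s (s∈ , s∉) ne H' B' sub j' rel' = Ambient.settle H B j full _ H' B' sub j' (allFin n) ≤-refl (λ v _ → ∈-allFin v) λ st →
        maker-loses (win s s∈ s∉ ne) (Settled.H' st) (Settled.B' st) (rel-cover (Settled.cover st) rel') (Settled.j' st) (λ {u} → Settled.full' st {u})

      live-path : ∀ {xs v u} → Reach (pr B) xs v → u ∈ˡ xs → Live G u
      live-path (go none b _ _) (here refl) = Rel.liveB rel (symR B b)
      live-path (go none b _ _) (there (here refl)) = Rel.liveB rel b
      live-path (go {e = just _} (via r) t _ _) (here refl) = Rel.liveT rel (sw₁ (sw₂ t))
      live-path (go {e = just _} (via r) t _ _) (there (here refl)) = Rel.liveT rel (sw₁ t)
      live-path (go {e = just _} (via r) t _ _) (there (there m)) = live-path r m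

      answered : Within (pr B) (λ _ → ⊤) x → ∀ s (ix : Int x s) → (∀ z → z ≢ x → ¬¬ Good x s z) → ⊥
      answered (ps , p , _) s ix good = proceed s (live-path p s∈) s≢x (restrict H Ok) B' proj₁ j' rel'
        where
          s≢x = proj₁ ix
          Ok = Off x s
          s∈ : s ∈ˡ ps
          s∈ with s ∈? ps
          ... | yes m = m
          ... | no m = ⊥-elim (proj₁ (proj₂ ix) (ps , p , λ k → λ { refl → m k }))
          B' = restrictB (union B (Tb x)) Ok
          module D = Transfer _≟_ (restrict H Ok) H Ok id
          down : ∀ {X z} → Paths.Within _≟_ (restrict H Ok) (Paths.pr B') X z → Within (pr B) (λ u → X u × Ok u) z ⊎ Within (pr (Tb x)) (λ u → X u × Ok u) z
          down p = chooseW {B} {Tb x} {union B (Tb x)} id (D.within {B'} {union B (Tb x)} id p)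
          off : ∀ {z S X} → ¬ Ok z → (∀ {u} → X u → Ok u) → ¬ Within S X z
          off n f (ps , p , i) = n (f (i (end∈ p)))
          off-l : ∀ {z X} → ¬ Ok z → (∀ {u} → X u → Ok u) → ¬ LassoW z X
          off-l n f (lasso t i _) = n (f (i (end∈ t)))
          dead : ∀ {z y} → ¬ Ok z → y ≢ z → Positions.Int _≟_ (restrict H Ok) B' z y
          dead n ne = ne , (λ p → [ off n proj₂ , off n proj₂ ]′ (down p)) , off-l n proj₂ ∘ D.lasso
          j' : Positions.J _≟_ (restrict H Ok) B'
          j' z with z ≟ x | z ≟ s
          -- `x` and `s` have left the position; no path or tadpole ends there, and each can be
          -- given the other.
          ... | yes refl | _ = pure (s , dead (λ k → proj₂ k refl) s≢x)
          ... | no _ | yes refl = pure (x , dead (λ k → proj₁ k refl) (≢-sym s≢x))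
          ... | no ne | no _ = good z ne >>= λ { (c , c≢z , hb , hx , hl) →
                pure (c , c≢z , (λ p → [ hb ∘ within-mono Data.Product.swap , hx ∘ within-mono Data.Product.swap ]′ (down p)) , hl ∘ lasso-mono Data.Product.swap ∘ D.lasso) }
          rel' : Rel (delV (markV G x) s) (restrict H Ok) B'
          rel' = record
            { edges = λ e m → let (m' , s∉) = del-edge (markV G x) s m in Rel.edges rel e m' >>= λ
                { (triple t a b c) → pure (tr t a b c s∉) ; (pair b a c) → pure (pairs b a c s∉) }
            ; liveT = λ { (t , k , _) → live-next G x s (Rel.liveT rel t) (proj₂ k) (proj₁ k) }
            ; liveB = λ { (inj₁ b , k , _) → live-next G x s (Rel.liveB rel b) (proj₂ k) (proj₁ k) ; (inj₂ t , k , _) → live-next G x s (Rel.liveT rel (sw₁ t)) (proj₂ k) (proj₁ k) } }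
            where
              okay : ∀ {e u} → s ∉ e → u ∈ e → u ≢ x → Ok u
              okay n m ne = (λ { refl → n m }) , ne
              tr : ∀ {e a b c} → T a b c → a ∈ e → b ∈ e → c ∈ e → s ∉ e → Covered (restrict H Ok) B' e
              tr {a = a} {b} {c} t a∈ b∈ c∈ n with a ≟ x | b ≟ x | c ≟ x
              ... | yes refl | _ | _ = pair (inj₂ t , okay n b∈ (≢-sym (HG.irr H t)) , okay n c∈ (≢-sym (irr₃ t))) b∈ c∈
              ... | no _ | yes refl | _ = pair (inj₂ (sw₁ t) , okay n a∈ (HG.irr H t) , okay n c∈ (≢-sym (irr₂ t))) a∈ c∈
              ... | no _ | no _ | yes refl = pair (inj₂ (sw₁ (sw₂ t)) , okay n a∈ (irr₃ t) , okay n b∈ (irr₂ t)) a∈ b∈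
              ... | no na | no nb | no nc = triple (t , okay n a∈ na , okay n b∈ nb , okay n c∈ nc) a∈ b∈ c∈
              pairs : ∀ {e a b} → R B a b → a ∈ e → b ∈ e → s ∉ e → Covered (restrict H Ok) B' e
              pairs {a = a} {b} r a∈ b∈ n = pair (inj₁ r , okay n a∈ (no-x (symR B r) b∈) , okay n b∈ (no-x r a∈)) a∈ b∈
                where
                  no-x : ∀ {u v} → R B u v → u ∈ _ → v ≢ x
                  -- A pair at `x` whose other vertex is not `s` would be a base path to `x`
                  -- avoiding `s`.
                  no-x {u} r m refl = proj₁ (proj₂ ix) (_ , go none r (λ ()) (λ ()) , λ { (here refl) → ≢-sym s≢x ; (there (here refl)) → λ { refl → n m } })

      idle : ¬ Within (pr B) (λ _ → ⊤) x → ∀ y → y ∈ V G → y ∉ M G → y ≢ x → ⊥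
      idle un y y∈ y∉ ne = proceed y (y∈ , y∉) ne (restrict H K) (restrictB B K) proj₁ j' rel'
        where
          K : Fin n → Set
          K u = u ≢ y
          module D = Transfer _≟_ (restrict H K) H K id
          j' : Positions.J _≟_ (restrict H K) (restrictB B K)
          j' z = j z >>= λ { (c , c≢z , h , l) → pure (c , c≢z , h ∘ within-mono proj₁ ∘ D.within {restrictB B K} {B} id , l ∘ lasso-mono proj₁ ∘ D.lasso) }
          noT : ∀ {a b c} → T a b c → a ≢ x
          noT t refl = full t un
          noB : ∀ {a b} → R B a b → a ≢ x
          noB b refl = un (_ , go none (symR B b) (λ ()) (λ ()) , _)
          rel' : Rel (delV (markV G x) y) (restrict H K) (restrictB B K)
          rel' = record
            { edges = λ e m → let (m' , y∉) = del-edge (markV G x) y m in Rel.edges rel e m' >>= λ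
                { (triple t a b c) → pure (triple (t , (λ { refl → y∉ a }) , (λ { refl → y∉ b }) , (λ { refl → y∉ c })) a b c)
                ; (pair r a b) → pure (pair (r , (λ { refl → y∉ a }) , (λ { refl → y∉ b })) a b) }
            ; liveT = λ { (t , k , _) → live-next G x y (Rel.liveT rel t) (noT t) k }
            ; liveB = λ { (b , k , _) → live-next G x y (Rel.liveB rel b) (noB b) k } }

-- Counting in subsets and edges of three vertices.

size-remove : ∀ {x : Fin n} {p} → x ∈ p → suc ∣ p - x ∣ ≡ ∣ p ∣
size-remove {p = _ ∷ p} here = cong (suc ∘ ∣_∣) (p─⊥≡p p)
size-remove {p = inside ∷ p} (there m) = cong suc (size-remove m)
size-remove {p = outside ∷ p} (there m) = size-remove m

size0⇒∉ : ∀ {p : Subset n} → ∣ p ∣ ≡ 0 → ∀ {x} → x ∉ p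
size0⇒∉ {p = p} eq {x} m with subst (suc ∣ p - x ∣ ≤_) eq (≤-reflexive (size-remove m))
... | ()

size⇒nonempty : ∀ {p : Subset n} {k} → ∣ p ∣ ≡ suc k → ∃ (_∈ p)
size⇒nonempty {n} {p} eq with nonempty? p
... | yes m = m
... | no e with trans (sym eq) (trans (cong ∣_∣ (Empty-unique e)) (∣⊥∣≡0 n))
...   | ()

remove⁻ : ∀ {x y : Fin n} {p} → x ∈ p - y → x ∈ p × x ≢ y
remove⁻ {y = y} {p} m = p─q⊆p p ⁅ y ⁆ m , λ { refl → proj₂ (∈─⁻ p ⁅ y ⁆ m) (x∈⁅x⁆ y) }

size1⁺ : ∀ {p : Subset n} {t} → t ∈ p → (∀ {x} → x ∈ p → x ≡ t) → ∣ p ∣ ≡ 1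
size1⁺ {p = p} {t} m f = trans (cong ∣_∣ (⊆-antisym {i = p} {⁅ t ⁆} (λ k → subst (_∈ ⁅ t ⁆) (sym (f k)) (x∈⁅x⁆ t)) λ k → subst (_∈ p) (sym (x∈⁅y⁆⇒x≡y t k)) m)) (∣⁅x⁆∣≡1 t)

size2⁺ : ∀ {p : Subset n} {a b} → a ∈ p → b ∈ p → a ≢ b → (∀ {x} → x ∈ p → x ≡ a ⊎ x ≡ b) → ∣ p ∣ ≡ 2
size2⁺ {p = p} {a} {b} ma mb ne f = trans (sym (size-remove ma)) (cong suc (size1⁺ (x∈p∧x≢y⇒x∈p-y mb (≢-sym ne))
  λ k → [ (λ e → ⊥-elim (proj₂ (remove⁻ {p = p} k) e)) , id ]′ (f (proj₁ (remove⁻ {p = p} k)))))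

empty⁺ : ∀ {p : Subset n} → (∀ {x} → x ∉ p) → p ≡ ∅
empty⁺ f = Empty-unique λ { (x , m) → f m }

record Tri (e : Subset n) (u v w : Fin n) : Set where
  constructor tri
  field
    u∈   : u ∈ e
    v∈   : v ∈ e
    w∈   : w ∈ e
    only : ∀ {x} → x ∈ e → x ≡ u ⊎ x ≡ v ⊎ x ≡ w
    u≢v  : u ≢ v
    v≢w  : v ≢ w
    u≢w  : u ≢ w

tri₁ : ∀ {e : Subset n} {u v w} → Tri e u v w → Tri e v u w
tri₁ (tri a b c o p q r) = tri b a c (λ m → [ inj₂ ∘ inj₁ , [ inj₁ , inj₂ ∘ inj₂ ]′ ]′ (o m)) (≢-sym p) r q

tri₂ : ∀ {e : Subset n} {u v w} → Tri e u v w → Tri e u w v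
tri₂ (tri a b c o p q r) = tri a c b (λ m → [ inj₁ , [ inj₂ ∘ inj₂ , inj₂ ∘ inj₁ ]′ ]′ (o m)) r (≢-sym q) p

third : ∀ {e : Subset n} {u v} → ∣ e ∣ ≡ 3 → u ∈ e → v ∈ e → u ≢ v → ∃ (Tri e u v)
third {e = e} {u} {v} eq u∈ v∈ ne = w , tri u∈ v∈ (proj₁ w∈e) only ne (≢-sym (proj₂ w∈p)) (≢-sym (proj₂ w∈e))
  where
    v∈p : v ∈ e - u
    v∈p = x∈p∧x≢y⇒x∈p-y v∈ (≢-sym ne)
    sz : ∣ (e - u) - v ∣ ≡ 1
    sz = suc-injective (suc-injective (trans (cong suc (size-remove v∈p)) (trans (size-remove u∈) eq)))
    w = proj₁ (size⇒nonempty sz)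
    w∈ : w ∈ (e - u) - v
    w∈ = proj₂ (size⇒nonempty sz)
    w∈p = remove⁻ {p = e - u} w∈
    w∈e = remove⁻ {p = e} (proj₁ w∈p)
    only : ∀ {x} → x ∈ e → x ≡ u ⊎ x ≡ v ⊎ x ≡ w
    only {x} m with x ≟ u | x ≟ v | x ≟ w
    ... | yes p | _ | _ = inj₁ p
    ... | no _ | yes p | _ = inj₂ (inj₁ p)
    ... | no _ | no _ | yes p = inj₂ (inj₂ p)
    ... | no a | no b | no c = ⊥-elim (size0⇒∉ (suc-injective (trans (size-remove w∈) sz))
            (x∈p∧x≢y⇒x∈p-y (x∈p∧x≢y⇒x∈p-y (x∈p∧x≢y⇒x∈p-y m a) b) c))

three : ∀ {e : Subset n} {u} → ∣ e ∣ ≡ 3 → u ∈ e → Σ (Fin n) λ v → ∃ (Tri e u v)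
three {e = e} {u} eq u∈ with size⇒nonempty (suc-injective (trans (size-remove u∈) eq))
... | v , m = v , third eq u∈ (proj₁ (remove⁻ {p = e} m)) (≢-sym (proj₂ (remove⁻ {p = e} m)))

hg : MHG n → (Fin n → Set) → HG (Fin n)
hg H P = record
  { T = λ u v w → Σ (Subset _) λ e → E H e ≡ true × Tri e u v w × P u × P v × P w
  ; sw₁ = λ { (e , m , t , a , b , c) → e , m , tri₁ t , b , a , c }
  ; sw₂ = λ { (e , m , t , a , b , c) → e , m , tri₂ t , a , c , b }
  ; irr = λ { (e , m , t , _) → Tri.u≢v t } }

marked-pairs : MHG n → Base (Fin n)
marked-pairs H = record
  { R = λ v w → Σ (Fin _) λ m → Σ (Subset _) λ e → E H e ≡ true × Tri e m v w × m ∈ M H × v ∉ M H × w ∉ M H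
  ; symR = λ { (m , e , a , t , p , q , r) → m , e , a , tri₂ t , p , r , q }
  ; irrR = λ { (m , e , a , t , _) → Tri.v≢w t } }

-- Translation into the paths, cycles and subhypergraphs of the statement.

edgePath : ∀ {e : Subset n} {m w v} → ∣ e ∣ ≡ 3 → Tri e m w v → Path v m
edgePath {e = e} eq t = record
  { k = 0 ; es = λ _ → e ; size3 = λ _ → eq ; adj = λ { zero zero () } ; far = λ { zero zero () }
  ; a≢b = ≢-sym (Tri.u≢w t) ; a∈ = Tri.w∈ t ; a∉ = λ { zero () } ; b∈ = Tri.u∈ t ; b∉ = λ _ () }

consPath : ∀ {t m : Fin n} (P : Path t m) {e w v} → ∣ e ∣ ≡ 3 → Tri e t w v → ¬ PathVs P w → ¬ PathVs P v → Path v m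
consPath {t = t} {m} P {e} {w} {v} eq tr w∉ v∉ = record
  { k = suc (Path.k P) ; es = es' ; size3 = size' ; adj = adj' ; far = far'
  ; a≢b = λ { refl → v∉ (_ , Path.b∈ P) } ; a∈ = Tri.w∈ tr ; a∉ = a∉' ; b∈ = Path.b∈ P ; b∉ = b∉' }
  where
    es' : Fin (suc (suc (Path.k P))) → Subset _
    es' zero = e
    es' (suc i) = Path.es P i
    size' : ∀ i → ∣ es' i ∣ ≡ 3
    size' zero = eq
    size' (suc i) = Path.size3 P i
    meets-t : ∀ {x} i → x ∈ e → x ∈ Path.es P i → x ≡ t
    meets-t i m k with Tri.only tr m
    ... | inj₁ q = q
    ... | inj₂ (inj₁ refl) = ⊥-elim (w∉ (i , k))
    ... | inj₂ (inj₂ refl) = ⊥-elim (v∉ (i , k))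
    adj' : ∀ i j → toℕ j ≡ suc (toℕ i) → ∣ es' i ∩ es' j ∣ ≡ 1
    adj' zero (suc zero) _ = size1⁺ (x∈p∩q⁺ (Tri.u∈ tr , Path.a∈ P)) λ k → let (a , b) = x∈p∩q⁻ e _ k in meets-t zero a b
    adj' (suc i) (suc j) q = Path.adj P i j (suc-injective q)
    far' : ∀ i j → suc (toℕ i) < toℕ j → es' i ∩ es' j ≡ ∅
    far' zero (suc j) (s≤s lt) = empty⁺ λ k → let (a , b) = x∈p∩q⁻ e _ k in Path.a∉ P j lt (subst (_∈ Path.es P j) (meets-t j a b) b)
    far' (suc i) (suc j) (s≤s lt) = Path.far P i j lt
    a∉' : ∀ i → 1 ≤ toℕ i → v ∉ es' i
    a∉' (suc i) _ k = v∉ (i , k)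
    b∉' : ∀ i → toℕ i < suc (Path.k P) → m ∉ es' i
    b∉' zero _ k = Path.a≢b P (sym (meets-t (fromℕ (Path.k P)) k (Path.b∈ P)))
    b∉' (suc i) (s≤s lt) k = Path.b∉ P i lt k

-- The closing edge is put first, so that both the first and the last edge contain `c`; a path of
-- one edge yields the cycle of length two.
mkCycle : ∀ {v c : Fin n} (P : Path v c) {e w} → ∣ e ∣ ≡ 3 → Tri e c v w → ¬ PathVs P w → Cycle c
mkCycle {v = v} {c} P {e} {w} eq tr w∉ = record
  { k = Path.k P ; es = es' ; size3 = size' ; a∈first = Tri.u∈ tr ; a∈last = Path.b∈ P ; a∉ = a∉' ; shape = shape (Path.k P) refl }
  where
    es' : Fin (suc (suc (Path.k P))) → Subset _
    es' zero = e
    es' (suc i) = Path.es P i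
    size' : ∀ i → ∣ es' i ∣ ≡ 3
    size' zero = eq
    size' (suc i) = Path.size3 P i
    a∉' : ∀ i → 1 ≤ toℕ i → toℕ i < suc (Path.k P) → c ∉ es' i
    a∉' (suc i) _ (s≤s lt) = Path.b∉ P i lt
    common : ∀ {x} i → x ∈ e ∩ Path.es P i → x ≡ c ⊎ x ≡ v
    common i k with x∈p∩q⁻ e _ k
    ... | a , b with Tri.only tr a
    ...   | inj₁ q = inj₁ q
    ...   | inj₂ (inj₁ q) = inj₂ q
    ...   | inj₂ (inj₂ refl) = ⊥-elim (w∉ (i , b))
    first : ∀ {i : Fin (suc (Path.k P))} → toℕ i ≡ 0 → i ≡ zero
    first {zero} _ = refl
    last : ∀ k (i : Fin (suc k)) → ¬ (toℕ i < k) → i ≡ fromℕ k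
    last zero zero _ = refl
    last (suc k) zero n = ⊥-elim (n (s≤s z≤n))
    last (suc k) (suc i) n = cong suc (last k i (n ∘ s≤s))
    toℕ-last : ∀ k → toℕ (fromℕ k) ≡ k
    toℕ-last zero = refl
    toℕ-last (suc k) = cong suc (toℕ-last k)
    shape : ∀ k → Path.k P ≡ k →
      (Path.k P ≡ 0 × ∣ es' zero ∩ es' (fromℕ (suc (Path.k P))) ∣ ≡ 2)
      ⊎
      (1 ≤ Path.k P
       × (∀ i j → toℕ j ≡ suc (toℕ i) → ∣ es' i ∩ es' j ∣ ≡ 1)
       × es' zero ∩ es' (fromℕ (suc (Path.k P))) ≡ ⁅ c ⁆
       × (∀ i j → suc (toℕ i) < toℕ j → ¬ (toℕ i ≡ 0 × toℕ j ≡ suc (Path.k P)) → es' i ∩ es' j ≡ ∅))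
    shape zero eq₀ = inj₁ (eq₀ , size2⁺ (x∈p∩q⁺ (Tri.u∈ tr , Path.b∈ P))
      (x∈p∩q⁺ (Tri.v∈ tr , subst (λ i → v ∈ Path.es P i) (sym (first (trans (toℕ-last _) eq₀))) (Path.a∈ P))) (Tri.u≢v tr) (common (fromℕ (Path.k P))))
    shape (suc k) eq₀ = inj₂ (k≥1 , adj' , ends , far')
      where
        k≥1 : 1 ≤ Path.k P
        k≥1 = subst (1 ≤_) (sym eq₀) (s≤s z≤n)
        adj' : ∀ i j → toℕ j ≡ suc (toℕ i) → ∣ es' i ∩ es' j ∣ ≡ 1
        adj' zero (suc zero) _ = size1⁺ (x∈p∩q⁺ (Tri.v∈ tr , Path.a∈ P))
          λ m → [ (λ { refl → ⊥-elim (Path.b∉ P zero k≥1 (proj₂ (x∈p∩q⁻ e _ m))) }) , id ]′ (common zero m)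
        adj' (suc i) (suc j) q = Path.adj P i j (suc-injective q)
        ends : es' zero ∩ es' (fromℕ (suc (Path.k P))) ≡ ⁅ c ⁆
        ends = ⊆-antisym (λ {x} m → [ (λ { refl → x∈⁅x⁆ c }) , (λ { refl → ⊥-elim (Path.a∉ P _ (subst (1 ≤_) (sym (toℕ-last _)) k≥1) (proj₂ (x∈p∩q⁻ e _ m))) }) ]′ (common _ m))
          (λ m → subst (_∈ _) (sym (x∈⁅y⁆⇒x≡y c m)) (x∈p∩q⁺ (Tri.u∈ tr , Path.b∈ P)))
        far' : ∀ i j → suc (toℕ i) < toℕ j → ¬ (toℕ i ≡ 0 × toℕ j ≡ suc (Path.k P)) → es' i ∩ es' j ≡ ∅
        far' zero (suc j) (s≤s lt) nl = empty⁺ λ m → [ (λ { refl → Path.b∉ P j (small j nl) (proj₂ (x∈p∩q⁻ e _ m)) })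
                                                  , (λ { refl → Path.a∉ P j lt (proj₂ (x∈p∩q⁻ e _ m)) }) ]′ (common j m)
          where
            small : ∀ j → ¬ (0 ≡ 0 × suc (toℕ j) ≡ suc (Path.k P)) → toℕ j < Path.k P
            small j nl with toℕ j <? Path.k P
            ... | yes lt = lt
            ... | no nlt = ⊥-elim (nl (refl , cong suc (trans (cong toℕ (last _ j nlt)) (toℕ-last _))))
        far' (suc i) (suc j) (s≤s lt) _ = Path.far P i j lt

cycleVs : ∀ {v c : Fin n} (P : Path v c) {e w} (eq : ∣ e ∣ ≡ 3) (tr : Tri e c v w) (w∉ : ¬ PathVs P w) {u} →
          CycleVs (mkCycle P eq tr w∉) u → u ∈ e ⊎ PathVs P u
cycleVs P eq tr w∉ (zero , m) = inj₁ m
cycleVs P eq tr w∉ (suc i , m) = inj₂ (i , m)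

module Pathify {n : ℕ} (H : MHG n) (uni : ThreeUniform H) (P : Fin n → Set) where
  open Paths using (pr; go; none; via)
  open Base

  record Along (Mk : Fin n → Set) (xs : List (Fin n)) (v : Fin n) : Set where
    field
      {m}   : Fin n
      mk    : Mk m
      path  : Path v m
      verts : ∀ {u} → PathVs path u → u ≡ m ⊎ u ∈ˡ xs
      edges : ∀ i → E H (Path.es path i) ≡ true

  -- The completing vertex of the first pair is a parameter: a marked vertex for snakes, and `c` for
  -- tails and opened cycles.
  pathify : ∀ {A xs v} {Mk : Fin n → Set} → (∀ {w v} → R A w v → Σ (Fin n) λ m → Mk m × Σ (Subset n) λ e → E H e ≡ true × Tri e m w v) →
            Paths.Reach _≟_ (hg H P) (pr A) xs v → (∀ {m} → Mk m → m ∉ˡ xs) → Along Mk xs v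
  pathify h (go none r _ _) d with h r
  ... | m , mk , e , e∈ , t = record { mk = mk ; path = edgePath (uni e e∈) t
        ; verts = λ { (_ , k) → [ inj₁ , [ (λ q → inj₂ (there (here q))) , (λ q → inj₂ (here q)) ]′ ]′ (Tri.only t k) } ; edges = λ _ → e∈ }
  pathify h (go {xs} {e = just t} {w} {v} (via r) (e , e∈ , tr , _) w∉ v∉) d with pathify h r (λ k l → d k (there (there l)))
  ... | al = record { mk = mk ; path = consPath path (uni e e∈) tr w∉P v∉P ; verts = verts' ; edges = λ { zero → e∈ ; (suc i) → edges i } }
    where
      open Along al
      w∉P : ¬ PathVs path w
      w∉P k = [ (λ { refl → d mk (there (here refl)) }) , w∉ ]′ (verts k)
      v∉P : ¬ PathVs path v
      v∉P k = [ (λ { refl → d mk (here refl) }) , v∉ ]′ (verts k)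
      verts' : ∀ {u} → PathVs (consPath path (uni e e∈) tr w∉P v∉P) u → u ≡ m ⊎ u ∈ˡ (v ∷ w ∷ xs)
      verts' (zero , k) = inj₂ ([ (λ { refl → there (there (Paths.end∈ _≟_ (hg H P) r)) }) , [ (λ q → there (here q)) , here ]′ ]′ (Tri.only tr k))
      verts' (suc i , k) = [ inj₁ , (λ l → inj₂ (there (there l))) ]′ (verts (i , k))

⌊⌋⁺ : ∀ {A : Set} (d : Dec A) → A → ⌊ d ⌋ ≡ true
⌊⌋⁺ (yes _) _ = refl
⌊⌋⁺ (no n) a = ⊥-elim (n a)

⌊⌋⁻ : ∀ {A : Set} (d : Dec A) → ⌊ d ⌋ ≡ true → A
⌊⌋⁻ (yes a) _ = a

∈-tabulate⁺ : ∀ (f : Fin n → Bool) {v} → f v ≡ true → v ∈ tabulate f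
∈-tabulate⁺ f {v} e = lookup⇒[]= v _ (trans (lookup∘tabulate f v) e)

∈-tabulate⁻ : ∀ (f : Fin n → Bool) {v} → v ∈ tabulate f → f v ≡ true
∈-tabulate⁻ f {v} m = trans (sym (lookup∘tabulate f v)) ([]=⇒lookup m)

∈-image⁺ : ∀ {m} (f : Fin n → Fin m) {e v} → v ∈ e → f v ∈ image f e
∈-image⁺ f {e} {v} k = ∈-tabulate⁺ _ (⌊⌋⁺ (any? (λ u → (u ∈ˢ? e) ×-dec (f u ≟ f v))) (v , k , refl))

∈-image⁻ : ∀ {m} (f : Fin n → Fin m) {e w} → w ∈ image f e → ∃ λ v → v ∈ e × f v ≡ w
∈-image⁻ f {e} {w} k = ⌊⌋⁻ (any? (λ u → (u ∈ˢ? e) ×-dec (f u ≟ w))) (∈-tabulate⁻ _ k)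

image-id : ∀ (e : Subset n) → image id e ≡ e
image-id e = ⊆-antisym (λ k → let (v , m , q) = ∈-image⁻ id k in subst (_∈ e) q m) (∈-image⁺ id)

_≟ˢ_ : (e f : Subset n) → Dec (e ≡ f)
_≟ˢ_ = ≡-dec Bool._≟_

-- Decidable vertex and edge sets, closed under incidence, as needed to write a subhypergraph by
-- characteristic functions.
record Realizable (H : MHG n) (z : Fin n) : Set₁ where
  field
    {Vs}   : Fin n → Set
    {Es}   : Subset n → Set
    Vs?    : ∀ v → Dec (Vs v)
    Es?    : ∀ e → Dec (Es e)
    z∈     : Vs z
    Vs⊆    : ∀ {v} → Vs v → v ∈ V H
    Es⊆    : ∀ {e} → Es e → E H e ≡ true
    closed : ∀ {e x} → Es e → x ∈ e → Vs x

  subgraph : MHG n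
  subgraph = mhg (tabulate (λ v → ⌊ Vs? v ⌋)) (λ e → ⌊ Es? e ⌋) (tabulate (λ v → ⌊ Vs? v ⌋) ∩ M H)

  V⁺ : ∀ {v} → Vs v → v ∈ V subgraph
  V⁺ {v} p = ∈-tabulate⁺ _ (⌊⌋⁺ (Vs? v) p)
  V⁻ : ∀ {v} → v ∈ V subgraph → Vs v
  V⁻ {v} m = ⌊⌋⁻ (Vs? v) (∈-tabulate⁻ _ m)

  realizes : Realizes subgraph Vs Es
  realizes = (λ v → mk⇔ V⁻ V⁺) , (λ e → mk⇔ (⌊⌋⁻ (Es? e)) (⌊⌋⁺ (Es? e)))

  wf-sub : WF H → WF subgraph
  wf-sub wf = record
    { V-nonempty = z , V⁺ z∈ ; edge⊆V = λ e p m → V⁺ (closed (⌊⌋⁻ (Es? e) p) m)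
    ; edge-nonempty = λ e p → WF.edge-nonempty wf e (Es⊆ (⌊⌋⁻ (Es? e) p)) ; M⊆V = λ m → proj₁ (x∈p∩q⁻ _ _ m) }

  sub : WF H → Sub subgraph H
  sub wf = record { wf = wf-sub wf ; V⊆ = Vs⊆ ∘ V⁻ ; E⊆ = λ e p → Es⊆ (⌊⌋⁻ (Es? e) p) ; Meq = refl }

  member : WF H → 𝒟₁ subgraph z → subgraph ∈x z [ (𝒟₁ , H) ]
  member wf d = sub wf , V⁺ z∈ , n , subgraph , z , d , record
    { f = id ; g = id ; f∈ = λ _ m → m ; g∈ = λ _ m → m ; gf = λ _ _ → refl ; fg = λ _ _ → refl ; marks = λ _ _ → mk⇔ id id
    ; edges = λ e _ → mk⇔ (subst (λ d → E subgraph d ≡ true) (sym (image-id e))) (subst (λ d → E subgraph d ≡ true) (image-id e)) ; point = refl }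

pathVs? : ∀ {a b : Fin n} (P : Path a b) v → Dec (PathVs P v)
pathVs? P v = any? (λ i → v ∈ˢ? Path.es P i)

pathEs? : ∀ {a b : Fin n} (P : Path a b) e → Dec (PathEs P e)
pathEs? P e = any? (λ i → Path.es P i ≟ˢ e)

path₀Vs? : ∀ {a b : Fin n} (P : Path₀ a b) v → Dec (Path₀Vs P v)
path₀Vs? {a = a} (len0 _) v = v ≟ a
path₀Vs? (pos P) v = pathVs? P v

path₀Es? : ∀ {a b : Fin n} (P : Path₀ a b) e → Dec (Path₀Es P e)
path₀Es? (len0 _) e = no id
path₀Es? (pos P) e = pathEs? P e

cycleVs? : ∀ {a : Fin n} (C : Cycle a) v → Dec (CycleVs C v)
cycleVs? C v = any? (λ i → v ∈ˢ? Cycle.es C i)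

cycleEs? : ∀ {a : Fin n} (C : Cycle a) e → Dec (CycleEs C e)
cycleEs? C e = any? (λ i → Cycle.es C i ≟ˢ e)

record Unconsed {a b : Fin n} (P : Path a b) : Set where
  field
    {t w}  : Fin n
    tr     : Tri (Path.es P zero) a t w
    rest   : Path t b
    k≡     : Path.k P ≡ suc (Path.k rest)
    a∉     : ¬ PathVs rest a
    w∉     : ¬ PathVs rest w
    verts  : ∀ {u} → PathVs rest u → PathVs P u
    edges  : ∀ i → PathEs P (Path.es rest i)

unconsPath : ∀ {a b : Fin n} (P : Path a b) → (Path.k P ≡ 0 × ∃ (Tri (Path.es P zero) a b)) ⊎ Unconsed P
unconsPath {n} {a} {b} record { k = zero ; es = es ; size3 = size3 ; a≢b = a≢b ; a∈ = a∈ ; b∈ = b∈ } = inj₁ (refl , third (size3 zero) a∈ b∈ a≢b)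
unconsPath {n} {a} {b} record { k = suc k ; es = es ; size3 = size3 ; adj = adj ; far = far ; a≢b = a≢b ; a∈ = a∈ ; a∉ = a∉ ; b∈ = b∈ ; b∉ = b∉ } = inj₂ record
  { tr = proj₂ tw
  ; rest = record { k = k ; es = es ∘ suc ; size3 = size3 ∘ suc ; adj = λ i j q → adj (suc i) (suc j) (cong suc q) ; far = λ i j lt → far (suc i) (suc j) (s≤s lt)
                  ; a≢b = λ { refl → b∉ zero (s≤s z≤n) (proj₁ t∈) } ; a∈ = proj₂ t∈
                  ; a∉ = λ i le m → ∅-elim (far zero (suc i) (s≤s le)) (proj₁ t∈) m ; b∈ = b∈ ; b∉ = λ i lt → b∉ (suc i) (s≤s lt) }
  ; k≡ = refl
  ; a∉ = λ { (i , m) → a∉ (suc i) (s≤s z≤n) m }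
  ; w∉ = λ { (zero , m) → Tri.v≢w (proj₂ tw) (sym (only (Tri.w∈ (proj₂ tw)) m)) ; (suc i , m) → ∅-elim (far zero (suc (suc i)) (s≤s (s≤s z≤n))) (Tri.w∈ (proj₂ tw)) m }
  ; verts = λ { (i , m) → suc i , m } ; edges = λ i → suc i , refl }
  where
    sz : ∣ es zero ∩ es (suc zero) ∣ ≡ 1
    sz = adj zero (suc zero) refl
    t = proj₁ (size⇒nonempty sz)
    t∈ : t ∈ es zero × t ∈ es (suc zero)
    t∈ = x∈p∩q⁻ _ _ (proj₂ (size⇒nonempty sz))
    only : ∀ {x} → x ∈ es zero → x ∈ es (suc zero) → x ≡ t
    only {x} p q with x ≟ t
    ... | yes e = e
    ... | no ne with ≤-trans (two∈⇒2≤ ne (x∈p∩q⁺ (p , q)) (x∈p∩q⁺ t∈)) (≤-reflexive sz)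
    ...   | s≤s ()
    ∅-elim : ∀ {p q : Subset n} {x} → p ∩ q ≡ ∅ → x ∈ p → x ∈ q → ⊥
    ∅-elim eq p q = ∉⊥ (subst (_ ∈_) eq (x∈p∩q⁺ (p , q)))
    tw = third (size3 zero) a∈ (proj₁ t∈) (λ q → a∉ (suc zero) (s≤s z≤n) (subst (_∈ es (suc zero)) (sym q) (proj₂ t∈)))

-- From `J₁` and the snakes of `H` to `J` and fullness.

module Links {n : ℕ} (H : MHG n) (wf : WF H) (uni : ThreeUniform H) (nontriv : ¬ TrivialMakerWin H) (two : 2 ≤ nonMarkedCount H) where
  open Game {n} using (Live; Rel; Covered; triple; pair)
  open Devices (_≟_ {n}) using (Full)
  open Base

  HH : HG (Fin n)
  HH = hg H (_∉ M H)
  BB : Base (Fin n)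
  BB = marked-pairs H
  open Positions _≟_ HH BB
  open Pathify H uni (_∉ M H)

  live-T : ∀ {a b c} → HG.T HH a b c → Live H a
  live-T (e , e∈ , t , p , _) = WF.edge⊆V wf e e∈ (Tri.u∈ t) , p
  live-B : ∀ {a b} → R BB a b → Live H a
  live-B (m , e , e∈ , t , _ , p , _) = WF.edge⊆V wf e e∈ (Tri.v∈ t) , p

  -- Two marks in an edge of three vertices leave only `w`, which would be a trivial Maker win.
  one-mark : ∀ {e u v w} → E H e ≡ true → Tri e u v w → u ∈ M H → v ∉ M H
  one-mark {e} {u} {v} {w} e∈ t u∈ v∈ = nontriv (e , e∈ , ≤-trans (p⊆q⇒∣p∣≤∣q∣ sub) (≤-reflexive (∣⁅x⁆∣≡1 w)))
    where
      sub : e ─ M H ⊆ ⁅ w ⁆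
      sub {x} m with ∈─⁻ e (M H) m
      ... | p , q with Tri.only t p
      ...   | inj₁ refl = ⊥-elim (q u∈)
      ...   | inj₂ (inj₁ refl) = ⊥-elim (q v∈)
      ...   | inj₂ (inj₂ refl) = x∈⁅x⁆ w

  rel : Rel H HH BB
  rel = record { edges = λ e e∈ → pure (cov e e∈) ; liveT = live-T ; liveB = live-B }
    where
      cov : ∀ e → E H e ≡ true → Covered HH BB e
      cov e e∈ with size⇒nonempty (uni e e∈)
      ... | u , u∈ with three (uni e e∈) u∈
      ...   | v , w , t with u ∈ˢ? M H | v ∈ˢ? M H | w ∈ˢ? M H
      ...     | yes p | _ | _ = pair (u , e , e∈ , t , p , one-mark e∈ t p , one-mark e∈ (tri₂ t) p) (Tri.v∈ t) (Tri.w∈ t)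
      ...     | no a | yes p | _ = pair (v , e , e∈ , tri₁ t , p , a , one-mark e∈ (tri₂ (tri₁ t)) p) (Tri.u∈ t) (Tri.w∈ t)
      ...     | no a | no b | yes p = pair (w , e , e∈ , tri₁ (tri₂ t) , p , a , b) (Tri.u∈ t) (Tri.v∈ t)
      ...     | no a | no b | no c = triple (e , e∈ , t , a , b , c) (Tri.u∈ t) (Tri.v∈ t) (Tri.w∈ t)

  -- A snake may contain marks before its end. It is cut at the first edge, seen from `a`, that
  -- contains one, and there the base path begins.
  snake-reach : ∀ k {a b} (P : Path a b) → Path.k P ≡ k → (∀ i → E H (Path.es P i) ≡ true) → b ∈ M H → a ∉ M H → Within (pr BB) (PathVs P) a
  snake-reach k {a} {b} P eq es b∈ a∉ with unconsPath P
  ... | inj₁ (_ , w , t) = _ , go none (b , _ , es zero , tri₂ (tri₁ t) , b∈ , one-mark (es zero) (tri₂ (tri₁ t)) b∈ , a∉) (λ ()) (λ ()) ,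
        λ { (here refl) → zero , Tri.u∈ t ; (there (here refl)) → zero , Tri.w∈ t }
  ... | inj₂ u with Unconsed.t u ∈ˢ? M H | Unconsed.w u ∈ˢ? M H
  ...   | yes p | _ = _ , go none (_ , _ , es zero , tri₂ (tri₁ (Unconsed.tr u)) , p , one-mark (es zero) (tri₂ (tri₁ (Unconsed.tr u))) p , a∉) (λ ()) (λ ()) ,
        λ { (here refl) → zero , Tri.u∈ (Unconsed.tr u) ; (there (here refl)) → zero , Tri.w∈ (Unconsed.tr u) }
  ...   | no _ | yes p = _ , go none (_ , _ , es zero , tri₂ (tri₁ (tri₂ (Unconsed.tr u))) , p , one-mark (es zero) (tri₂ (tri₁ (tri₂ (Unconsed.tr u)))) p , a∉) (λ ()) (λ ()) ,
        λ { (here refl) → zero , Tri.u∈ (Unconsed.tr u) ; (there (here refl)) → zero , Tri.v∈ (Unconsed.tr u) }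
  ...   | no t∉ | no w∉M = next k eq
    where
      open Unconsed u hiding (a∉)
      next : ∀ k → Path.k P ≡ k → Within (pr BB) (PathVs P) a
      next zero eq with trans (sym k≡) eq
      ... | ()
      next (suc k) eq = within-mono (λ { (inj₁ m) → verts m ; (inj₂ (inj₁ refl)) → zero , Tri.w∈ tr ; (inj₂ (inj₂ refl)) → zero , Tri.u∈ tr })
        (snoc (snake-reach k rest (suc-injective (trans (sym k≡) eq)) (λ i → subst (λ e → E H e ≡ true) (proj₂ (edges i)) (es (proj₁ (edges i)))) b∈ t∉)
          (_ , es zero , tri₂ (tri₁ tr) , t∉ , w∉M , a∉) w∉ (Unconsed.a∉ u))

  full : (∀ x → x ∈ V H → x ∉ M H → ∃ λ X → Sub X H × IsSnake X x) → Full HH BB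
  full snakes {u} t with snakes u (proj₁ (live-T t)) (proj₂ (live-T t))
  ... | X , sub , y , y∈ , P , _ , re = pure (within-mono _ (snake-reach _ P refl (λ i → Sub.E⊆ sub _ (Equivalence.from (re _) (i , refl)))
        (proj₂ (x∈p∩q⁻ _ _ (subst (y ∈_) (Sub.Meq sub) y∈))) (proj₂ (live-T t))))

  module D = Transfer _≟_ HH HH (Live H) (λ t → t , live-T t , live-T (HG.sw₁ HH t) , live-T (HG.sw₁ HH (HG.sw₂ HH t)))

  live-path : ∀ {xs z u} → Reach (pr BB) xs z → u ∈ˡ xs → Live H u
  live-path = D.kept-pr (λ b → live-B b , live-B (symR BB b))

  snake-member : ∀ {xs z} → Reach (pr BB) xs z → Σ (Realizable H z) λ r → 𝒟₁ (Realizable.subgraph r) z × (∀ {u} → Realizable.Vs r u → u ∈ M H ⊎ u ∈ˡ xs)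
  snake-member {xs} {z} r = real , inj₁ (wf-sub wf , V⁺ z∈ , (λ m → proj₂ (live-path r (end∈ r)) (proj₂ (x∈p∩q⁻ _ _ m))) ,
      (_ , x∈p∩q⁺ (V⁺ (_ , Path.b∈ path) , mk) , path , realizes) ,
      size1⁺ (x∈p∩q⁺ (V⁺ (_ , Path.b∈ path) , x∈p∩q⁺ (V⁺ (_ , Path.b∈ path) , mk)))
        λ k → [ id , (λ l → ⊥-elim (proj₂ (live-path r l) (proj₂ (x∈p∩q⁻ (V subgraph) _ (proj₂ (x∈p∩q⁻ (V subgraph) _ k)))))) ]′ (verts (V⁻ (proj₁ (x∈p∩q⁻ (V subgraph) _ k))))) ,
      λ k → [ (λ { refl → inj₁ mk }) , inj₂ ]′ (verts k)
    where
      al : Along (_∈ M H) xs z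
      al = pathify {BB} (λ { (m , e , e∈ , t , p , _) → m , p , e , e∈ , t }) r (λ m∈ l → proj₂ (live-path r l) m∈)
      open Along al
      real : Realizable H z
      real = record { Vs = PathVs path ; Es = PathEs path ; Vs? = pathVs? path ; Es? = pathEs? path ; z∈ = zero , Path.a∈ path
        ; Vs⊆ = λ { (i , k) → WF.edge⊆V wf _ (edges i) k } ; Es⊆ = λ { (i , refl) → edges i } ; closed = λ { (i , refl) k → i , k } }
      open Realizable real

  tadpole-member : ∀ {X z} (L : LassoW z X) → Σ (Realizable H z) λ r → 𝒟₁ (Realizable.subgraph r) z × (∀ {u} → Realizable.Vs r u → u ∈ˡ lassoV L)
  tadpole-member {X} {z} L₀@(lasso {c} {xs} t i (cyc {ys} {v} {w} r cl@(e , e∈ , tr , _) w∉ ys⊆ w∈)) =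
      real , inj₂ (wf-sub wf , V⁺ z∈ , (λ m → unmarked z∈ (proj₂ (x∈p∩q⁻ _ _ m))) , (c , stem , C , meets-c , realizes) ,
        trans (cong ∣_∣ (empty⁺ λ k → unmarked (V⁻ (proj₁ (x∈p∩q⁻ (V subgraph) _ k))) (proj₂ (x∈p∩q⁻ (V subgraph) _ (proj₂ (x∈p∩q⁻ (V subgraph) _ k)))))) (∣⊥∣≡0 n)) ,
      inL
    where
      head : ∀ {w v} → R (Tb c) w v → Σ (Fin n) λ m → m ≡ c × Σ (Subset n) λ e → E H e ≡ true × Tri e m w v
      head (e , e∈ , t , _) = c , refl , e , e∈ , t
      c∉ys : c ∉ˡ ys
      c∉ys m = proj₂ (ys⊆ m) (start∈ t)
      al : Along (_≡ c) ys v
      al = pathify {Tb c} head r (λ { refl → c∉ys })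
      m≡c : Along.m al ≡ c
      m≡c = Along.mk al
      P : Path v c
      P = subst (Path v) m≡c (Along.path al)
      vertsP : ∀ {u} → PathVs P u → u ≡ c ⊎ u ∈ˡ ys
      vertsP = go-verts m≡c (Along.path al) (Along.verts al)
        where go-verts : ∀ {m u} (q : m ≡ c) (p : Path v m) → (∀ {u} → PathVs p u → u ≡ m ⊎ u ∈ˡ ys) → PathVs (subst (Path v) q p) u → u ≡ c ⊎ u ∈ˡ ys
              go-verts refl p f = f
      edgesP : ∀ i → E H (Path.es P i) ≡ true
      edgesP = go-edges m≡c (Along.path al) (Along.edges al)
        where go-edges : ∀ {m} (q : m ≡ c) (p : Path v m) → (∀ i → E H (Path.es p i) ≡ true) → ∀ i → E H (Path.es (subst (Path v) q p) i) ≡ true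
              go-edges refl p f = f
      w∉P : ¬ PathVs P w
      w∉P k = [ (λ { refl → proj₂ w∈ (start∈ t) }) , w∉ ]′ (vertsP k)
      C : Cycle c
      C = mkCycle P (uni e e∈) tr w∉P
      vertsC : ∀ {u} → CycleVs C u → u ≡ c ⊎ u ∈ˡ ys ⊎ u ≡ w
      vertsC k with cycleVs P (uni e e∈) tr w∉P k
      ... | inj₁ m = [ inj₁ , [ (λ { refl → inj₂ (inj₁ (end∈ r)) }) , inj₂ ∘ inj₂ ]′ ]′ (Tri.only tr m)
      ... | inj₂ m = [ inj₁ , inj₂ ∘ inj₁ ]′ (vertsP m)
      edgesC : ∀ {f} → CycleEs C f → E H f ≡ true
      edgesC (zero , refl) = e∈
      edgesC (suc i , refl) = edgesP i
      tail : Σ (Path₀ z c) λ S → (∀ {u} → Path₀Vs S u → u ∈ˡ xs) × (∀ {f} → Path₀Es S f → E H f ≡ true) × Path₀Vs S z × (∀ {f x} → Path₀Es S f → x ∈ f → Path₀Vs S x)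
      tail with z ≟ c
      ... | yes eq = len0 eq , (λ { refl → end∈ t }) , (λ ()) , refl , λ ()
      ... | no ne with drop⁺ t ne
      ...   | ds , q , d⊆ , _ with pathify {Tb c} head q (λ { refl m → proj₂ (d⊆ m) refl })
      ...     | record { mk = refl ; path = p ; verts = vs ; edges = es } = pos p , (λ k → [ (λ { refl → start∈ t }) , (λ l → proj₁ (d⊆ l)) ]′ (vs k)) ,
                (λ { (i , refl) → es i }) , (zero , Path.a∈ p) , λ { (i , refl) k → i , k }
      stem = proj₁ tail
      inL : ∀ {u} → Path₀Vs stem u ⊎ CycleVs C u → u ∈ˡ (w ∷ xs ++ ys)
      inL (inj₁ k) = there (∈-++⁺ˡ (proj₁ (proj₂ tail) k))
      inL (inj₂ k) = [ (λ { refl → there (∈-++⁺ˡ (start∈ t)) }) , [ (λ l → there (∈-++⁺ʳ xs l)) , here ]′ ]′ (vertsC k)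
      liveL : LassoW z (λ u → X u × Live H u)
      liveL = D.lasso L₀
      unmarked : ∀ {u} → Path₀Vs stem u ⊎ CycleVs C u → u ∉ M H
      unmarked k = proj₂ (proj₂ (lassoV⊆ liveL (inL k)))
      alive : ∀ {u} → Path₀Vs stem u ⊎ CycleVs C u → u ∈ V H
      alive k = proj₁ (proj₂ (lassoV⊆ liveL (inL k)))
      meets-c : ∀ u → Path₀Vs stem u → CycleVs C u → u ≡ c
      meets-c u k l with vertsC l
      ... | inj₁ q = q
      ... | inj₂ (inj₁ m) = ⊥-elim (proj₂ (ys⊆ m) (proj₁ (proj₂ tail) k))
      ... | inj₂ (inj₂ refl) = ⊥-elim (proj₂ w∈ (proj₁ (proj₂ tail) k))
      real : Realizable H z
      real = record { Vs = λ u → Path₀Vs stem u ⊎ CycleVs C u ; Es = λ f → Path₀Es stem f ⊎ CycleEs C f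
        ; Vs? = λ u → path₀Vs? stem u ⊎-dec cycleVs? C u ; Es? = λ f → path₀Es? stem f ⊎-dec cycleEs? C f
        ; z∈ = inj₁ (proj₁ (proj₂ (proj₂ (proj₂ tail)))) ; Vs⊆ = alive
        ; Es⊆ = [ proj₁ (proj₂ (proj₂ tail)) , edgesC ]′
        ; closed = λ { (inj₁ f) k → inj₁ (proj₂ (proj₂ (proj₂ (proj₂ tail))) f k) ; (inj₂ (i , refl)) k → inj₂ (i , k) } }
      open Realizable real

  in-member : ∀ {z v} {Y : Fin n → Set} → (Σ (Realizable H z) λ r → 𝒟₁ (Realizable.subgraph r) z × (∀ {u} → Realizable.Vs r u → Y u)) →
              (∀ X → X ∈x z [ (𝒟₁ , H) ] → v ∈ V X) → Y v
  in-member (r , d , vs) all = vs (Realizable.V⁻ r (all _ (Realizable.member r wf d)))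

  -- `J` ranges over all of `Fin n`. At a marked or absent vertex no path or tadpole ends, so any
  -- other vertex will do, and two unmarked vertices guarantee one.
  int-dead : ∀ {z} → ¬ Live H z → Σ (Fin n) λ y → Int z y
  int-dead {z} nl with 2≤⇒other (V H ─ M H) two z
  ... | y , _ , ne = y , ne , (λ { (xs , r , _) → nl (live-path r (end∈ r)) }) , λ L → nl (proj₂ (lassoV⊆ (D.lasso L) (z∈ (D.lasso L))))
    where z∈ : ∀ {X} (L : LassoW z X) → z ∈ˡ lassoV L
          z∈ (lasso t _ _) = there (∈-++⁺ˡ (end∈ t))

  j : J₁ 𝒟₁ H → J
  j j₁ z with z ∈ˢ? V H | z ∈ˢ? M H
  ... | no z∉ | _ = pure (int-dead (z∉ ∘ proj₁))
  ... | yes _ | yes z∈ = pure (int-dead (λ l → proj₂ l z∈))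
  ... | yes z∈ | no z∉ with j₁ z z∈ z∉
  ...   | v , _ , v∉ , inAll = pure (v , (λ { refl → v∉ (x∈p∪q⁺ (inj₂ (x∈⁅x⁆ z))) }) , no-snake , no-tadpole)
    where
      no-snake : ¬ Within (pr BB) (_≢ v) z
      no-snake (xs , r , i) = [ (λ m → v∉ (x∈p∪q⁺ (inj₁ m))) , (λ m → i m refl) ]′ (in-member (snake-member r) inAll)
      no-tadpole : ¬ LassoW z (_≢ v)
      no-tadpole L = lassoV⊆ L (in-member (tadpole-member L) inAll) refl

  breaker : (∀ x → x ∈ V H → x ∉ M H → ∃ λ X → Sub X H × IsSnake X x) → J₁ 𝒟₁ H → BreakerWin H
  breaker snakes j₁ win = Game.maker-loses win HH BB rel (j j₁) (λ {u} → full snakes {u})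

-- Maker's side: forcing along snakes and tadpoles.

next : MHG n → Fin n → Fin n → MHG n
next G x y = delV (markV G x) y

next-M⁺ : ∀ (G : MHG n) x y {u} → u ∈ M G ⊎ u ≡ x → u ≢ y → u ∈ M (next G x y)
next-M⁺ G x y p ne = x∈p∧x∉q⇒x∈p─q (x∈p∪q⁺ ([ inj₁ , (λ { refl → inj₂ (x∈⁅x⁆ x) }) ]′ p)) (x≢y⇒x∉⁅y⁆ ne)

next-M⁻ : ∀ (G : MHG n) x y {u} → u ∈ M (next G x y) → u ∈ M G ⊎ u ≡ x
next-M⁻ G x y m = [ inj₁ , (λ k → inj₂ (x∈⁅y⁆⇒x≡y x k)) ]′ (x∈p∪q⁻ (M G) ⁅ x ⁆ (p─q⊆p _ ⁅ y ⁆ m))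

next-V⁺ : ∀ (G : MHG n) x y {u} → u ∈ V G → u ≢ y → u ∈ V (next G x y)
next-V⁺ G x y m ne = x∈p∧x∉q⇒x∈p─q m (x≢y⇒x∉⁅y⁆ ne)

count-next : ∀ (G : MHG n) x y → x ∈ V G → x ∉ M G → nonMarkedCount (next G x y) < nonMarkedCount G
count-next G x y x∈ x∉ = p⊂q⇒∣p∣<∣q∣ (sub , x , x∈p∧x∉q⇒x∈p─q x∈ x∉ , gone)
  where
    split⁻ : ∀ {u} → u ∈ V (next G x y) ─ M (next G x y) → (u ∈ V G × u ≢ y) × u ∉ M (next G x y)
    split⁻ m = let (a , b) = ∈─⁻ (V (next G x y)) _ m ; (c , d) = ∈─⁻ (V G) ⁅ y ⁆ a in (c , λ { refl → d (x∈⁅x⁆ y) }) , b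
    sub : V (next G x y) ─ M (next G x y) ⊆ V G ─ M G
    sub m = let ((a , ne) , b) = split⁻ m in x∈p∧x∉q⇒x∈p─q a (λ k → b (next-M⁺ G x y (inj₁ k) ne))
    gone : x ∉ V (next G x y) ─ M (next G x y)
    gone m = let ((a , ne) , b) = split⁻ m in b (next-M⁺ G x y (inj₂ refl) ne)

trivial? : ∀ (G : MHG n) → Dec (TrivialMakerWin G)
trivial? G = anySubset? (λ e → (E G e Bool.≟ true) ×-dec (∣ e ─ M G ∣ ≤? 1))

-- Deciding the game, by recursion on the number of unmarked vertices, lets a safe reply be found by
-- search, as the existential in `J₁` requires.
makerWin? : ∀ k (G : MHG n) → nonMarkedCount G ≤ k → Dec (MakerWin G)
makerWin? {n} k G le with nonMarkedCount G ≤? 1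
... | yes one with trivial? G
...   | yes t = yes (base one t)
...   | no nt = no λ { (base _ t) → nt t ; (step two _ _ _ _) → <⇒≱ two one }
makerWin? {n} zero G le | no many = ⊥-elim (many (≤-trans le z≤n))
makerWin? {n} (suc k) G le | no many = map′ (λ { (x , x∈ , x∉ , w) → step (≰⇒> many) x x∈ x∉ w })
    (λ { (base one _) → ⊥-elim (many one) ; (step _ x x∈ x∉ w) → x , x∈ , x∉ , w }) (any? move?)
  where
    Move : Fin n → Set
    Move x = x ∈ V G × x ∉ M G × (∀ y → y ∈ V G → y ∉ M G → y ≢ x → MakerWin (next G x y))
    move? : ∀ x → Dec (Move x)
    move? x with x ∈ˢ? V G | x ∈ˢ? M G
    ... | no x∉V | _ = no (x∉V ∘ proj₁)
    ... | yes _ | yes x∈M = no (λ m → proj₁ (proj₂ m) x∈M)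
    ... | yes x∈V | no x∉M = map′ (λ w → x∈V , x∉M , w) (proj₂ ∘ proj₂) (all? reply?)
      where
        reply? : ∀ y → Dec (y ∈ V G → y ∉ M G → y ≢ x → MakerWin (next G x y))
        reply? y with makerWin? k (next G x y) (≤-pred (≤-trans (count-next G x y x∈V x∉M) le)) | y ∈ˢ? V G | y ∈ˢ? M G | y ≟ x
        ... | yes w | _ | _ | _ = yes λ _ _ _ → w
        ... | no _ | no y∉V | _ | _ = yes λ y∈ → ⊥-elim (y∉V y∈)
        ... | no _ | yes _ | yes y∈M | _ = yes λ _ y∉ → ⊥-elim (y∉ y∈M)
        ... | no _ | yes _ | no _ | yes e = yes λ _ _ ne → ⊥-elim (ne e)
        ... | no nw | yes y∈ | no y∉ | no ne = no λ f → nw (f y∈ y∉ ne)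

-- Maker marks the last unmarked vertex of the edge, or any vertex if there is none; no deletion can
-- then touch the edge. The play continues because `base` is available only when at most one
-- unmarked vertex is left.
trivial-win : ∀ k (G : MHG n) → nonMarkedCount G ≤ k → ∀ e → E G e ≡ true → e ⊆ V G → ∣ e ─ M G ∣ ≤ 1 → MakerWin G
trivial-win k G le e e∈ e⊆ small with nonMarkedCount G ≤? 1
... | yes one = base one (e , e∈ , small)
trivial-win zero G le e e∈ e⊆ small | no many = ⊥-elim (many (≤-trans le z≤n))
trivial-win {n} (suc k) G le e e∈ e⊆ small | no many = choose-move (nonempty? (e ─ M G))
  where
    play : ∀ x → x ∈ V G → x ∉ M G → (∀ y → y ∉ M G → y ≢ x → y ∉ e) → MakerWin G
    play x x∈ x∉ safe = step (≰⇒> many) x x∈ x∉ λ y y∈ y∉ ne →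
      trivial-win k (next G x y) (≤-pred (≤-trans (count-next G x y x∈ x∉) le)) e (del-edge⁺ (markV G x) y e∈ (safe y y∉ ne))
        (λ m → next-V⁺ G x y (e⊆ m) (λ { refl → safe y y∉ ne m }))
        (≤-trans (p⊆q⇒∣p∣≤∣q∣ λ m → let (a , b) = ∈─⁻ e _ m in x∈p∧x∉q⇒x∈p─q a (λ k → b (next-M⁺ G x y (inj₁ k) (λ { refl → safe y y∉ ne a })))) small)
    choose-move : Dec (∃ (_∈ e ─ M G)) → MakerWin G
    choose-move (yes (x , m)) = let (a , b) = ∈─⁻ e (M G) m in play x (e⊆ a) b
      λ y y∉ ne y∈ → <⇒≱ (two∈⇒2≤ ne (x∈p∧x∉q⇒x∈p─q y∈ y∉) m) small
    choose-move (no none) with nonempty? (V G ─ M G)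
    ... | yes (x , m) = let (a , b) = ∈─⁻ (V G) (M G) m in play x a b λ y y∉ _ y∈ → none (y , x∈p∧x∉q⇒x∈p─q y∈ y∉)
    ... | no empty with 2≤⇒other (V G ─ M G) (≰⇒> many) (proj₁ (size-pos (≰⇒> many)))
      where size-pos : 2 ≤ ∣ V G ─ M G ∣ → ∃ (_∈ V G ─ M G)
            size-pos two with ∣ V G ─ M G ∣ in eq
            ... | suc _ = size⇒nonempty eq
    ...   | y , m , _ = ⊥-elim (empty (y , m))

small-edge : ∀ (G : MHG n) {e u v w} → Tri e u v w → u ∈ M G → w ∈ M G → ∣ e ─ M G ∣ ≤ 1
small-edge G {e} {u} {v} {w} t u∈ w∈ = ≤-trans (p⊆q⇒∣p∣≤∣q∣ sub) (≤-reflexive (∣⁅x⁆∣≡1 v))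
  where
    sub : e ─ M G ⊆ ⁅ v ⁆
    sub m with ∈─⁻ e (M G) m
    ... | a , b with Tri.only t a
    ...   | inj₁ refl = ⊥-elim (b u∈)
    ...   | inj₂ (inj₁ refl) = x∈⁅x⁆ v
    ...   | inj₂ (inj₂ refl) = ⊥-elim (b w∈)

-- With x marked, marking t threatens the edge {t , w , x} and so forces the deletion of w.
force : ∀ (G : MHG n) {e t w x} → E G e ≡ true → e ⊆ V G → Tri e t w x → x ∈ M G → t ∉ M G → w ∉ M G → MakerWin (next G t w) → MakerWin G
force G {e} {t} {w} {x} e∈ e⊆ tr x∈ t∉ w∉ win =
  step (two∈⇒2≤ (Tri.u≢v tr) (x∈p∧x∉q⇒x∈p─q (e⊆ (Tri.u∈ tr)) t∉) (x∈p∧x∉q⇒x∈p─q (e⊆ (Tri.v∈ tr)) w∉)) t (e⊆ (Tri.u∈ tr)) t∉ answer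
  where
    answer : ∀ y → y ∈ V G → y ∉ M G → y ≢ t → MakerWin (next G t y)
    answer y y∈ y∉ ne with y ≟ w
    ... | yes refl = win
    ... | no ne' = trivial-win _ (next G t y) ≤-refl e (del-edge⁺ (markV G t) y e∈ y∉e)
            (λ m → next-V⁺ G t y (e⊆ m) (λ { refl → y∉e m }))
            (small-edge (next G t y) tr (next-M⁺ G t y (inj₂ refl) (≢-sym ne)) (next-M⁺ G t y (inj₁ x∈) (λ { refl → y∉ x∈ })))
      where
        y∉e : y ∉ e
        y∉e m with Tri.only tr m
        ... | inj₁ q = ne q
        ... | inj₂ (inj₁ q) = ne' q
        ... | inj₂ (inj₂ refl) = y∉ x∈

module Forcing {n : ℕ} (H : MHG n) where
  open Paths using (pt; pr; stop; go; none; via; Cyc; cyc)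
  U = hg H (λ _ → ⊤)
  Reach = Paths.Reach _≟_ U
  Tb = Paths.Tb _≟_ U
  end∈ = λ {S xs v} → Paths.end∈ _≟_ U {S} {xs} {v}

  record Inside-of (G : MHG n) (X : Fin n → Set) : Set where
    field
      verts : ∀ {u} → X u → u ∈ V G
      edges : ∀ {e} → E H e ≡ true → (∀ {u} → u ∈ e → X u) → E G e ≡ true

  inside-next : ∀ {G X Y} t w → Inside-of G X → (∀ {u} → Y u → X u) → ¬ Y w → Inside-of (next G t w) Y
  inside-next {G} t w i f n = record
    { verts = λ y → next-V⁺ G t w (Inside-of.verts i (f y)) (λ { refl → n y })
    ; edges = λ e∈ sub → del-edge⁺ (markV G t) w (Inside-of.edges i e∈ (f ∘ sub)) (n ∘ sub) }

  in-edge : ∀ {e t w x} {X : Fin n → Set} → Tri e t w x → X t → X w → X x → ∀ {u} → u ∈ e → X u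
  in-edge tr a b c m with Tri.only tr m
  ... | inj₁ refl = a
  ... | inj₂ (inj₁ refl) = b
  ... | inj₂ (inj₂ refl) = c

  unmarked-next : ∀ {G : MHG n} {t w u} → u ∉ M G → u ≢ t → u ∉ M (next G t w)
  unmarked-next {G} {t} {w} u∉ ne m = [ u∉ , ne ]′ (next-M⁻ G t w m)

  -- Each forcing move marks the next articulation `t`, shortening the path by an edge, until the
  -- remaining edge contains both marks.
  chain-win : ∀ {m xs x} → Reach (pr (Tb m)) xs x → m ∉ˡ xs → ∀ G → Inside-of G (λ u → u ≡ m ⊎ u ∈ˡ xs) →
              x ∈ M G → m ∈ M G → (∀ {u} → u ∈ˡ xs → u ≢ x → u ∉ M G) → MakerWin G
  chain-win (go none (e , e∈ , tr , _) _ _) m∉ G i x∈ m∈ un =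
    trivial-win _ G ≤-refl e (Inside-of.edges i e∈ inX) (λ k → Inside-of.verts i (inX k)) (small-edge G tr m∈ x∈)
    where inX = λ {u} → in-edge {X = λ u → u ≡ _ ⊎ u ∈ˡ _} tr (inj₁ refl) (inj₂ (there (here refl))) (inj₂ (here refl)) {u}
  chain-win {m} (go {xs} {e = just t} {w} {x} (via r) (e , e∈ , tr , _) w∉ x∉) m∉ G i x∈ m∈ un =
    force G (Inside-of.edges i e∈ inX) (λ k → Inside-of.verts i (inX k)) tr x∈ t∉ (un (there (here refl)) (Tri.v≢w tr))
      (chain-win r (λ k → m∉ (there (there k))) (next G t w)
        (inside-next t w i [ inj₁ , (λ k → inj₂ (there (there k))) ]′ [ (λ { refl → m∉ (there (here refl)) }) , w∉ ]′)
        (next-M⁺ G t w (inj₂ refl) (Tri.u≢v tr)) (next-M⁺ G t w (inj₁ m∈) (λ { refl → m∉ (there (here refl)) }))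
        (λ k ne → unmarked-next {G} (un (there (there k)) (λ { refl → x∉ k })) ne))
    where
      inX = λ {u} → in-edge {X = λ u → u ≡ m ⊎ u ∈ˡ (x ∷ w ∷ xs)} tr (inj₂ (there (there (end∈ r)))) (inj₂ (there (here refl))) (inj₂ (here refl)) {u}
      t∉ : t ∉ M G
      t∉ = un (there (there (end∈ r))) (λ { refl → x∉ (end∈ r) })

  -- Forcing runs down the tail until `c` is marked. Marking `v` in the closing edge then forces
  -- `w`, and the opened cycle is a path between the marked vertices `v` and `c`.
  lasso-win : ∀ {c xs x Y} → Reach (pt c) xs x → Cyc _≟_ U c Y → (∀ {u} → Y u → u ∉ˡ xs) → ∀ G → Inside-of G (λ u → u ∈ˡ xs ⊎ Y u) →
              x ∈ M G → (∀ {u} → u ∈ˡ xs ⊎ Y u → u ≢ x → u ∉ M G) → MakerWin G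
  lasso-win {c} {Y = Y} (stop refl) (cyc {ys} {v} {w} r (e , e∈ , tr , _) w∉ ys⊆ w∈) d G i x∈ un =
    force G {t = v} {w} {c} (Inside-of.edges i e∈ inX) (λ k → Inside-of.verts i (inX k)) tr' x∈
      (un (inj₂ (ys⊆ (end∈ r))) (≢-sym (Tri.u≢v tr))) (un (inj₂ w∈) (≢-sym (Tri.u≢w tr)))
      (chain-win r c∉ (next G v w) (inside-next v w i [ (λ { refl → inj₁ (here refl) }) , inj₂ ∘ ys⊆ ]′ [ (λ { refl → d w∈ (here refl) }) , w∉ ]′)
        (next-M⁺ G v w (inj₂ refl) (Tri.v≢w tr)) (next-M⁺ G v w (inj₁ x∈) (Tri.u≢w tr))
        (λ k ne → unmarked-next {G} (un (inj₂ (ys⊆ k)) (λ { refl → d (ys⊆ k) (here refl) })) ne))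
    where
      tr' : Tri e v w c
      tr' = tri₂ (tri₁ tr)
      inX = λ {u} → in-edge {X = λ u → u ∈ˡ (c ∷ []) ⊎ Y u} tr' (inj₂ (ys⊆ (end∈ r))) (inj₂ w∈) (inj₁ (here refl)) {u}
      c∉ : c ∉ˡ ys
      c∉ k = d (ys⊆ k) (here refl)
  lasso-win {Y = Y} (go {xs} {e = just t} {w} {x} (via r) (e , e∈ , tr , _) w∉ x∉) cy d G i x∈ un =
    force G (Inside-of.edges i e∈ inX) (λ k → Inside-of.verts i (inX k)) tr x∈ t∉ (un (inj₁ (there (here refl))) (Tri.v≢w tr))
      (lasso-win r cy (λ y k → d y (there (there k))) (next G t w)
        (inside-next t w i [ (λ k → inj₁ (there (there k))) , inj₂ ]′ [ w∉ , (λ y → d y (there (here refl))) ]′)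
        (next-M⁺ G t w (inj₂ refl) (Tri.u≢v tr))
        (λ k ne → unmarked-next {G} (un ([ (λ l → inj₁ (there (there l))) , inj₂ ]′ k) (λ { refl → [ x∉ , (λ y → d y (here refl)) ]′ k })) ne))
    where
      inX = λ {u} → in-edge {X = λ u → u ∈ˡ (x ∷ w ∷ xs) ⊎ Y u} tr (inj₁ (there (there (end∈ r)))) (inj₁ (there (here refl))) (inj₁ (here refl)) {u}
      t∉ : t ∉ M G
      t∉ = un (inj₁ (there (there (end∈ r)))) (λ { refl → x∉ (end∈ r) })

record Opened-cycle {n} {c : Fin n} (C : Cycle c) : Set where
  field
    {v w} : Fin n
    tr    : Tri (Cycle.es C zero) c v w
    path  : Path v c
    w∉    : ¬ PathVs path w
    edges : ∀ i → CycleEs C (Path.es path i)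

-- Removing the first edge leaves a path back to `c` from the vertex `v` shared with the second
-- edge; for length two, `v` is the common vertex other than `c`.
open-cycle : ∀ {n} {c : Fin n} (C : Cycle c) → Opened-cycle C
open-cycle {n} {c} record { k = zero ; es = es ; size3 = size3 ; a∈first = a∈first ; a∈last = a∈last ; shape = inj₁ (_ , sz) } = record
  { tr = proj₂ vw ; path = edgePath (size3 (suc zero)) (proj₂ last) ; w∉ = λ { (_ , m) → wout m } ; edges = λ _ → suc zero , refl }
  where
    p = es zero ∩ es (suc zero)
    c∈ : c ∈ p
    c∈ = x∈p∩q⁺ (a∈first , a∈last)
    found = size⇒nonempty (suc-injective (trans (size-remove c∈) sz))
    v = proj₁ found
    v∈ : v ∈ p × v ≢ c
    v∈ = remove⁻ {p = p} (proj₂ found)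
    vw : ∃ (Tri (es zero) c v)
    vw = third (size3 zero) a∈first (proj₁ (x∈p∩q⁻ _ _ (proj₁ v∈))) (≢-sym (proj₂ v∈))
    last : Σ (Fin n) λ u → Tri (es (suc zero)) c u v
    last = let (u , t) = third (size3 (suc zero)) a∈last (proj₂ (x∈p∩q⁻ (es zero) _ (proj₁ v∈))) (≢-sym (proj₂ v∈)) in u , tri₂ t
    wout : proj₁ vw ∉ es (suc zero)
    wout m = size0⇒∉ {p = (p - c) - v} (suc-injective (trans (size-remove (proj₂ found)) (suc-injective (trans (size-remove c∈) sz))))
      (x∈p∧x≢y⇒x∈p-y (x∈p∧x≢y⇒x∈p-y (x∈p∩q⁺ (Tri.w∈ (proj₂ vw) , m)) (≢-sym (Tri.u≢w (proj₂ vw)))) (≢-sym (Tri.v≢w (proj₂ vw))))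
open-cycle {n} {c} record { k = zero ; shape = inj₂ (() , _) }
open-cycle {n} {c} record { k = suc k ; shape = inj₁ (() , _) }
open-cycle {n} {c} record { k = suc k ; es = es ; size3 = size3 ; a∈first = a∈first ; a∈last = a∈last ; a∉ = a∉ ; shape = inj₂ (_ , adj , ends , far) } = record
  { tr = proj₂ vw
  ; path = record { k = suc k ; es = es ∘ suc ; size3 = size3 ∘ suc ; adj = λ i j q → adj (suc i) (suc j) (cong suc q)
                  ; far = λ i j lt → far (suc i) (suc j) (s≤s lt) (λ { (() , _) })
                  ; a≢b = v≢c ; a∈ = proj₂ v∈ ; a∉ = λ { (suc i) _ m → v≢c (later i (proj₁ v∈) m) } ; b∈ = a∈last
                  ; b∉ = λ i lt → a∉ (suc i) (s≤s z≤n) (s≤s lt) }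
  ; w∉ = λ { (zero , m) → Tri.v≢w (proj₂ vw) (sym (only (Tri.w∈ (proj₂ vw)) m)) ; (suc i , m) → Tri.u≢w (proj₂ vw) (sym (later i (Tri.w∈ (proj₂ vw)) m)) }
  ; edges = λ i → suc i , refl }
  where
    sz : ∣ es zero ∩ es (suc zero) ∣ ≡ 1
    sz = adj zero (suc zero) refl
    v = proj₁ (size⇒nonempty sz)
    v∈ : v ∈ es zero × v ∈ es (suc zero)
    v∈ = x∈p∩q⁻ _ _ (proj₂ (size⇒nonempty sz))
    v≢c : v ≢ c
    v≢c q = a∉ (suc zero) (s≤s z≤n) (s≤s (s≤s z≤n)) (subst (_∈ es (suc zero)) q (proj₂ v∈))
    vw : ∃ (Tri (es zero) c v)
    vw = third (size3 zero) a∈first (proj₁ v∈) (≢-sym v≢c)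
    only : ∀ {x} → x ∈ es zero → x ∈ es (suc zero) → x ≡ v
    only {x} p q with x ≟ v
    ... | yes e = e
    ... | no ne with ≤-trans (two∈⇒2≤ ne (x∈p∩q⁺ (p , q)) (x∈p∩q⁺ v∈)) (≤-reflexive sz)
    ...   | s≤s ()
    last : ∀ k (i : Fin (suc k)) → toℕ i ≡ k → i ≡ fromℕ k
    last zero zero _ = refl
    last (suc k) (suc i) q = cong suc (last k i (suc-injective q))
    later : ∀ {x} i → x ∈ es zero → x ∈ es (suc (suc i)) → x ≡ c
    later {x} i p q with toℕ i ℕ.≟ k
    ... | yes e = x∈⁅y⁆⇒x≡y c (subst (x ∈_) ends (x∈p∩q⁺ (p , subst (λ j → x ∈ es (suc (suc j))) (last k i e) q)))
    ... | no ne = ⊥-elim (∉⊥ (subst (x ∈_) (far zero (suc (suc i)) (s≤s (s≤s z≤n)) (λ { (_ , e) → ne (suc-injective (suc-injective e)) })) (x∈p∩q⁺ (p , q))))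

module Unfold {n : ℕ} (D : MHG n) where
  open Paths using (pt; pr; go; none; lasso; cyc)
  U = hg D (λ _ → ⊤)
  Within = Paths.Within _≟_ U
  Tb = Paths.Tb _≟_ U

  path-reach : ∀ k {a b} (P : Path a b) → Path.k P ≡ k → (∀ i → E D (Path.es P i) ≡ true) → Within (pr (Tb b)) (λ u → PathVs P u × u ≢ b) a
  path-reach k {a} {b} P eq es with unconsPath P
  ... | inj₁ (_ , w , t) = _ , go none (_ , es zero , tri₂ (tri₁ t) , _) (λ ()) (λ ()) ,
        λ { (here refl) → (zero , Tri.u∈ t) , Tri.u≢v t ; (there (here refl)) → (zero , Tri.w∈ t) , ≢-sym (Tri.v≢w t) }
  ... | inj₂ u = next' k eq
    where
      open Unconsed u
      next' : ∀ k → Path.k P ≡ k → Within (pr (Tb b)) (λ u → PathVs P u × u ≢ b) a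
      next' zero eq with trans (sym k≡) eq
      ... | ()
      next' (suc k) eq = Paths.within-mono _≟_ U
        (λ { (inj₁ (m , ne)) → verts m , ne ; (inj₂ (inj₁ refl)) → (zero , Tri.w∈ tr) , (λ { refl → w∉ (_ , Path.b∈ rest) }) ; (inj₂ (inj₂ refl)) → (zero , Tri.u∈ tr) , Path.a≢b P })
        (Paths.snoc _≟_ U (path-reach k rest (suc-injective (trans (sym k≡) eq)) (λ i → subst (λ e → E D e ≡ true) (proj₂ (edges i)) (es (proj₁ (edges i)))))
          (_ , es zero , tri₂ (tri₁ tr) , _) (w∉ ∘ proj₁) (a∉ ∘ proj₁))

  snake-chain : ∀ {x} → IsSnake D x → ∃ λ y → y ∈ M D × y ∈ V D × Within (pr (Tb y)) (λ u → u ∈ V D × u ≢ y) x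
  snake-chain (y , y∈ , P , vs , es) = y , y∈ , Equivalence.from (vs _) (_ , Path.b∈ P) ,
    Paths.within-mono _≟_ U (λ { (m , ne) → Equivalence.from (vs _) m , ne }) (path-reach _ P refl (λ i → Equivalence.from (es _) (i , refl)))

  tadpole-lasso : ∀ {x} → IsTadpole D x → Paths.LassoW _≟_ U x (_∈ V D)
  tadpole-lasso {x} (b , S , C , only , vs , es) = build tail
    where
      oc = open-cycle C
      open Opened-cycle oc
      P-reach : Within (pr (Tb b)) (λ u → PathVs path u × u ≢ b) v
      P-reach = path-reach _ path refl (λ i → Equivalence.from (es _) (inj₂ (edges i)))
      inC : ∀ {u} → PathVs path u → CycleVs C u
      inC {u} (i , m) = proj₁ (edges i) , subst (u ∈_) (sym (proj₂ (edges i))) m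
      w∈C : CycleVs C w
      w∈C = zero , Tri.w∈ tr
      tail : Within (pt b) (Path₀Vs S) x
      tail = go-tail S (λ f → Equivalence.from (es _) (inj₁ f))
        where
          go-tail : (S : Path₀ x b) → (∀ {e} → Path₀Es S e → E D e ≡ true) → Within (pt b) (Path₀Vs S) x
          go-tail (len0 refl) _ = Paths.at _≟_ U x
          go-tail (pos P) f = Paths.within-mono _≟_ U (λ { (inj₁ refl) → _ , Path.b∈ P ; (inj₂ k) → proj₁ k })
            (Paths.liftW _≟_ U (path-reach _ P refl (λ i → f (i , refl))) (λ k → proj₂ k refl))
      build : Within (pt b) (Path₀Vs S) x → Paths.LassoW _≟_ U x (_∈ V D)
      build (xs , t , i) = lasso t (λ m → Equivalence.from (vs _) (inj₁ (i m)))
        (cyc (proj₁ (proj₂ P-reach)) (_ , Equivalence.from (es _) (inj₂ (zero , refl)) , tr , _) (λ m → w∉ (proj₁ (proj₂ (proj₂ P-reach) m)))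
          (λ m → Equivalence.from (vs _) (inj₂ (inC (proj₁ (proj₂ (proj₂ P-reach) m)))) , λ k → proj₂ (proj₂ (proj₂ P-reach) m) (only _ (i k) (inC (proj₁ (proj₂ (proj₂ P-reach) m)))))
          (Equivalence.from (vs _) (inj₂ w∈C) , λ k → Tri.u≢w tr (sym (only _ (i k) w∈C))))

-- Members of the family are given on other vertex sets; their paths and cycles are pulled back into
-- `H` along the inverse `g`.
module Transport {n m : ℕ} {H X : MHG n} {D : MHG m} {x y} (sub : Sub X H) (wfD : WF D) (iso : Iso X x D y) where
  open Iso iso
  open Paths using (pt; pr; stop; go; none; via)
  UD = hg D (λ _ → ⊤)
  UH = hg H (λ _ → ⊤)

  inj : ∀ {u v} → u ∈ V D → v ∈ V D → g u ≡ g v → u ≡ v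
  inj a b q = trans (sym (fg _ a)) (trans (cong f q) (fg _ b))

  edge-image : ∀ {e} → E D e ≡ true → E H (image g e) ≡ true
  edge-image {e} e∈ = Sub.E⊆ sub _ (Equivalence.from (edges (image g e) into) (subst (λ d → E D d ≡ true) (sym back) e∈))
    where
      e⊆ : e ⊆ V D
      e⊆ = WF.edge⊆V wfD e e∈
      into : image g e ⊆ V X
      into k = let (v , v∈ , q) = ∈-image⁻ g k in subst (_∈ V X) q (g∈ v (e⊆ v∈))
      back : image f (image g e) ≡ e
      back = ⊆-antisym (λ k → let (u , u∈ , q) = ∈-image⁻ f k ; (v , v∈ , r) = ∈-image⁻ g u∈ in
               subst (_∈ e) (trans (sym (fg v (e⊆ v∈))) (trans (cong f r) q)) v∈)
             (λ k → subst (_∈ image f (image g e)) (fg _ (e⊆ k)) (∈-image⁺ f (∈-image⁺ g k)))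

  T-image : ∀ {u v w} → HG.T (hg D (λ _ → ⊤)) u v w → HG.T (hg H (λ _ → ⊤)) (g u) (g v) (g w)
  T-image (e , e∈ , t , _) = image g e , edge-image e∈ , tri (∈-image⁺ g (Tri.u∈ t)) (∈-image⁺ g (Tri.v∈ t)) (∈-image⁺ g (Tri.w∈ t))
      (λ k → let (v , v∈ , q) = ∈-image⁻ g k in
        [ (λ { refl → inj₁ (sym q) }) , [ (λ { refl → inj₂ (inj₁ (sym q)) }) , (λ { refl → inj₂ (inj₂ (sym q)) }) ]′ ]′ (Tri.only t v∈))
      (λ q → Tri.u≢v t (inj (e⊆ (Tri.u∈ t)) (e⊆ (Tri.v∈ t)) q)) (λ q → Tri.v≢w t (inj (e⊆ (Tri.v∈ t)) (e⊆ (Tri.w∈ t)) q))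
      (λ q → Tri.u≢w t (inj (e⊆ (Tri.u∈ t)) (e⊆ (Tri.w∈ t)) q)) , _
    where e⊆ : e ⊆ V D
          e⊆ = WF.edge⊆V wfD e e∈

  ∉-image : ∀ {u xs} → u ∈ V D → (∀ {v} → v ∈ˡ xs → v ∈ V D) → u ∉ˡ xs → g u ∉ˡ map g xs
  ∉-image u∈ i n k = let (v , v∈ , q) = ∈-map⁻ g k in n (subst (_∈ˡ _) (sym (inj u∈ (i v∈) q)) v∈)

  reach-pt : ∀ {c xs v} → Paths.Reach _≟_ UD (pt c) xs v → (∀ {u} → u ∈ˡ xs → u ∈ V D) → Paths.Reach _≟_ UH (pt (g c)) (map g xs) (g v)
  reach-pt (stop refl) i = stop refl
  reach-pt (go {e = just _} (via r) t w∉ v∉) i = go (via (reach-pt r (λ k → i (there (there k))))) (T-image t)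
    (∉-image (i (there (here refl))) (λ k → i (there (there k))) w∉) (∉-image (i (here refl)) (λ k → i (there (there k))) v∉)

  reach-pr : ∀ {c xs v} → Paths.Reach _≟_ UD (pr (Paths.Tb _≟_ UD c)) xs v → (∀ {u} → u ∈ˡ xs → u ∈ V D) → Paths.Reach _≟_ UH (pr (Paths.Tb _≟_ UH (g c))) (map g xs) (g v)
  reach-pr (go none t _ _) i = go none (T-image t) (λ ()) (λ ())
  reach-pr (go {e = just _} (via r) t w∉ v∉) i = go (via (reach-pr r (λ k → i (there (there k))))) (T-image t)
    (∉-image (i (there (here refl))) (λ k → i (there (there k))) w∉) (∉-image (i (here refl)) (λ k → i (there (there k))) v∉)

module _ {n : ℕ} (H : MHG n) where
  open Forcing H

  win-avoiding : ∀ {x v X} → X ∈x x [ (𝒟₁ , H) ] → x ∈ V H → v ∉ V X → MakerWin (next H x v)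
  win-avoiding {x} {v} {X} (sub , x∈X , m , D , y , d , iso) x∈ v∉ = from d
    where
      open Iso iso
      gy : g y ≡ x
      gy = trans (cong g (sym point)) (gf x x∈X)
      inV : ∀ {u} → u ∈ V D → g u ∈ V X
      inV {u} = g∈ u
      ≢v : ∀ {u} → u ∈ V D → g u ≢ v
      ≢v m q = v∉ (subst (_∈ V X) q (inV m))
      kept : ∀ {Y : Fin n → Set} → (∀ {u} → Y u → u ∈ V X) → Inside-of (next H x v) Y
      kept f = record { verts = λ k → next-V⁺ H x v (Sub.V⊆ sub (f k)) (λ { refl → v∉ (f k) })
                        ; edges = λ e∈ s → del-edge⁺ (markV H x) v e∈ (λ k → v∉ (f (s k))) }
      x∈M : x ∈ M (next H x v)
      x∈M = next-M⁺ H x v (inj₂ refl) (λ { refl → v∉ x∈X })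
      marked⁻ : ∀ {u} → u ∈ V D → g u ∈ M (next H x v) → g u ≢ x → u ∈ M D
      marked⁻ {u} u∈ k ne with next-M⁻ H x v k
      ... | inj₂ q = ⊥-elim (ne q)
      ... | inj₁ q = subst (_∈ M D) (fg u u∈) (Equivalence.to (marks (g u) (inV u∈)) (subst (g u ∈_) (sym (Sub.Meq sub)) (x∈p∩q⁺ (inV u∈ , q))))
      marked⁺ : ∀ {u} → u ∈ V D → u ∈ M D → g u ∈ M (next H x v)
      marked⁺ {u} u∈ k = next-M⁺ H x v (inj₁ (proj₂ (x∈p∩q⁻ _ _ (subst (g u ∈_) (Sub.Meq sub)
        (Equivalence.from (marks (g u) (inV u∈)) (subst (_∈ M D) (sym (fg u u∈)) k)))))) (≢v u∈)
      from : 𝒟₁ D y → MakerWin (next H x v)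
      from (inj₁ (wfD , y∈ , y∉ , snake , one)) with Unfold.snake-chain D snake
      ... | z , z∈M , z∈V , xs , r , i = chain-win (subst (Reach _ _) gy (reach-pr r (proj₁ ∘ i))) (∉-image z∈V (proj₁ ∘ i) (λ k → proj₂ (i k) refl)) (next H x v)
            (kept [ (λ { refl → inV z∈V }) , (λ k → let (u , u∈ , q) = ∈-map⁻ g k in subst (_∈ V X) (sym q) (inV (proj₁ (i u∈)))) ]′)
            x∈M (marked⁺ z∈V z∈M) unmarked
        where
          open Transport sub wfD iso
          unmarked : ∀ {u} → u ∈ˡ map g xs → u ≢ x → u ∉ M (next H x v)
          unmarked k ne l with ∈-map⁻ g k
          ... | u , u∈ , refl with ≤-trans (two∈⇒2≤ (proj₂ (i u∈)) (x∈p∩q⁺ (proj₁ (i u∈) , marked⁻ (proj₁ (i u∈)) l ne)) (x∈p∩q⁺ (z∈V , z∈M))) (≤-reflexive one)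
          ...   | s≤s ()
      from (inj₂ (wfD , y∈ , y∉ , enter-lasso , none)) with Unfold.tadpole-lasso D enter-lasso
      ... | Paths.lasso {c} {xs} t i (Paths.cyc {ys} {a} {w} r cl w∉ ys⊆ w∈) =
            lasso-win (subst (Reach _ _) gy (reach-pt t i)) (Paths.cyc {X = λ u → u ∈ˡ map g (w ∷ ys)} (reach-pr r (proj₁ ∘ ys⊆)) (T-image cl)
                (∉-image (proj₁ w∈) (proj₁ ∘ ys⊆) w∉) there (here refl)) off-tail (next H x v) (kept inX) x∈M unmarked
        where
          open Transport sub wfD iso
          cyc∈ : ∀ {u} → u ∈ˡ (w ∷ ys) → u ∈ V D × u ∉ˡ xs
          cyc∈ (here refl) = w∈
          cyc∈ (there k) = ys⊆ k
          off-tail : ∀ {u} → u ∈ˡ map g (w ∷ ys) → u ∉ˡ map g xs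
          off-tail k with ∈-map⁻ g k
          ... | u , u∈ , refl = ∉-image (proj₁ (cyc∈ u∈)) i (proj₂ (cyc∈ u∈))
          pre : ∀ {u} → u ∈ˡ map g xs ⊎ u ∈ˡ map g (w ∷ ys) → ∃ λ u' → u' ∈ V D × u ≡ g u'
          pre (inj₁ k) = let (u , u∈ , q) = ∈-map⁻ g k in u , i u∈ , q
          pre (inj₂ k) = let (u , u∈ , q) = ∈-map⁻ g k in u , proj₁ (cyc∈ u∈) , q
          inX : ∀ {u} → u ∈ˡ map g xs ⊎ u ∈ˡ map g (w ∷ ys) → u ∈ V X
          inX k = let (u , u∈ , q) = pre k in subst (_∈ V X) (sym q) (inV u∈)
          unmarked : ∀ {u} → u ∈ˡ map g xs ⊎ u ∈ˡ map g (w ∷ ys) → u ≢ x → u ∉ M (next H x v)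
          unmarked k ne l with pre k
          ... | u , u∈ , refl = size0⇒∉ none (x∈p∩q⁺ (u∈ , marked⁻ u∈ l ne))

  -- A reply after which Maker does not win lies in every snake and tadpole at `x`, since Maker
  -- would win along one it misses. Without such a reply, `x` would be a winning first move.
  breaker⇒J₁ : 2 ≤ nonMarkedCount H → BreakerWin H → J₁ 𝒟₁ H
  breaker⇒J₁ two bw x x∈ x∉ with any? good?
    where
      Good : Fin n → Set
      Good y = (y ∈ V H × y ∉ M H × y ≢ x) × ¬ MakerWin (next H x y)
      good? : ∀ y → Dec (Good y)
      good? y = ((y ∈ˢ? V H) ×-dec (¬? (y ∈ˢ? M H)) ×-dec (¬? (y ≟ x))) ×-dec ¬? (makerWin? _ (next H x y) ≤-refl)
  ... | yes (y , (y∈ , y∉ , ne) , nw) = y , y∈ , (λ m → [ y∉ , (λ k → ne (x∈⁅y⁆⇒x≡y x k)) ]′ (x∈p∪q⁻ (M H) ⁅ x ⁆ m)) , λ X X∈ → holds X X∈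
    where
      holds : ∀ X → X ∈x x [ (𝒟₁ , H) ] → y ∈ V X
      holds X X∈ with y ∈ˢ? V X
      ... | yes m = m
      ... | no m = ⊥-elim (nw (win-avoiding X∈ x∈ m))
  ... | no bad = ⊥-elim (bw (step two x x∈ x∉ λ y y∈ y∉ ne → win y y∈ y∉ ne))
    where
      win : ∀ y → y ∈ V H → y ∉ M H → y ≢ x → MakerWin (next H x y)
      win y y∈ y∉ ne with makerWin? _ (next H x y) ≤-refl
      ... | yes w = w
      ... | no nw = ⊥-elim (bad (y , (y∈ , y∉ , ne) , nw))

mainTheorem5 : ∀ {n : ℕ} (H : MHG n) → WF H → ThreeUniform H →
    ¬ TrivialMakerWin H → 2 ≤ nonMarkedCount H →
    (∀ x → x ∈ V H → x ∉ M H → ∃ λ X → Sub X H × IsSnake X x) →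
    BreakerWin H ⇔ J₁ 𝒟₁ H
mainTheorem5 H wf uni nontriv two snakes = mk⇔ (breaker⇒J₁ H two) (Links.breaker H wf uni nontriv two snakes)
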